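{- Up to isomorphism there are exactly three proper Mathon arcs of degree $8$ in $\mathrm{PG}(2,32)$.
   Context: Let $q$ be a power of $2$ and $\mathrm{Tr}:\mathrm{GF}(q)\to\mathrm{GF}(2)$ the absolute trace. A maximal arc of degree $d$ in $\mathrm{PG}(2,q)$ is a non-empty proper set of points meeting every line in $0$ or $d$ points. For $\alpha,\beta,\lambda\in\mathrm{GF}(q)$ with $\mathrm{Tr}(\alpha\beta)=1$ let $F_{\alpha,\beta,\lambda}=\{(x,y,z):\alpha x^2+xy+\beta y^2+\lambda z^2=0\}$. For $\lambda\ne0$ this is a non-degenerate conic with nucleus $F_0=(0,0,1)$, and the line $z=0$ is external to it. For $\lambda\ne\lambda'$ define $F_{\alpha,\beta,\lambda}\oplus F_{\alpha',\beta',\lambda'}=F_{\alpha'',\beta'',\lambda''}$ with $\alpha''=\frac{\alpha\lambda+\alpha'\lambda'}{\lambda+\lambda'}$, $\beta''=\frac{\beta\lambda+\beta'\lambda'}{\lambda+\lambda'}$, $\lambda''=\lambda+\lambda'$. A set $\mathcal C$ of such conics ($\lambda\neq0$, distinct members having distinct $\lambda$) is closed if the composition of any two distinct members is again a member of $\mathcal C$ (in particular the parameters of the composition satisfy the trace condition). For closed $\mathcal C$ the union of the conics of $\mathcal C$ together with $F_0$ is a maximal arc of degree $|\mathcal C|+1$; a maximal arc which, after a change of coordinates of the plane, arises in this way from a non-empty closed set is called of Mathon type (a Mathon arc). If $\mathrm{Tr}(\alpha)=1$ and $A\subset\mathrm{GF}(q)$ is an additive subgroup, the set $\{F_{\alpha,1,\lambda}:\lambda\in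 A\setminus\{0\}\}$ is closed; a maximal arc arising (up to change of coordinates) from such a set is of Denniston type. A proper Mathon arc is a maximal arc of Mathon type that is not of Denniston type. Two maximal arcs are isomorphic if some element of $\mathrm{P\Gamma L}(3,q)$ maps one onto the other. -}

module Defs where

open import Algebra.Bundles using (CommutativeRing; RawRing)
open import Algebra.Structures using (IsCommutativeRing)
open import Algebra.Morphism.Structures using (IsRingIsomorphism)
import Algebra.Definitions.RawSemiring as RawSemiringOps
open import Data.Bool.Base using (Bool; true; false; if_then_else_; _xor_)
import Data.Bool.Properties as Bool
open import Data.Fin.Base using (Fin)
open import Data.Fin.Properties using (2↔Bool; *↔×)
open import Data.List.Base as List using (List; length; upTo)
import Data.List.Membership.Setoid as SetoidMembership
import Data.List.Relation.Unary.Unique.Setoid as SetoidUnique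
open import Data.Nat.Base as ℕ using (ℕ; zero; suc)
open import Data.Product.Base using (Σ; ∃-syntax; _×_; _,_; uncurry)
open import Data.Product.Function.NonDependent.Propositional using (_×-↔_)
open import Data.Sum.Base using (_⊎_)
open import Data.Vec.Base as Vec using (Vec; []; _∷_; replicate; zipWith)
open import Data.Vec.Properties using (≡-dec; zipWith-assoc; zipWith-comm; zipWith-identityˡ; zipWith-identityʳ)
open import Function.Base using (id; _∘_)
open import Function.Bundles using (_⇔_; _↔_; mk↔ₛ′)
open import Function.Properties.Inverse using (↔-trans)
open import Level using (0ℓ)
open import Relation.Binary.Bundles using (Setoid)
open import Relation.Binary.Definitions using (_Respects_; DecidableEquality)
open import Relation.Binary.PropositionalEquality
open import Relation.Nullary.Decidable using (Dec; toWitness; _×-dec_; map′; ¬?; _→-dec_)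
open import Relation.Nullary.Negation using (¬_)
open import Relation.Unary using (Pred; Decidable; Satisfiable; _∩_)

record BinaryField (h : ℕ) : Set₁ where
  infix  8 _⁻¹
  infixl 7 _*_
  infixl 6 _+_
  field
    Carrier           : Set
    _+_ _*_           : Carrier → Carrier → Carrier
    -_                : Carrier → Carrier
    0# 1#             : Carrier
    isCommutativeRing : IsCommutativeRing _≡_ _+_ _*_ -_ 0# 1#
    -- the value of 0# ⁻¹ is unconstrained
    _⁻¹               : Carrier → Carrier
    *-inverseʳ        : ∀ x → x ≢ 0# → x * x ⁻¹ ≡ 1#
    0≢1               : 0# ≢ 1#
    order             : Fin (2 ℕ.^ h) ↔ Carrier

  commutativeRing : CommutativeRing 0ℓ 0ℓ
  commutativeRing = record { isCommutativeRing = isCommutativeRing }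

  open CommutativeRing commutativeRing public
    using (rawRing; *-assoc; *-comm; *-identityˡ; *-identityʳ; zeroˡ; zeroʳ;
           +-identityˡ; +-identityʳ)
  open RawSemiringOps (RawRing.rawSemiring rawRing) public
    using (_^_)

  -- The absolute trace; GF(2) is identified with the subfield {0# , 1#}.
  Tr : Carrier → Carrier
  Tr x = List.foldr _+_ 0# (List.map (λ i → x ^ (2 ℕ.^ i)) (upTo h))

module ProjectivePlane {h : ℕ} (𝔽 : BinaryField h) where
  open BinaryField 𝔽

  Vec₃ : Set
  Vec₃ = Vec Carrier 3

  0ᵥ : Vec₃
  0ᵥ = replicate 3 0#

  infix 7 _•_ _∙_ _·_

  _•_ : Carrier → Vec₃ → Vec₃
  k • v = Vec.map (k *_) v

  _∙_ : Vec₃ → Vec₃ → Carrier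
  (a ∷ b ∷ c ∷ []) ∙ (x ∷ y ∷ z ∷ []) = a * x + b * y + c * z

  -- Homogeneous coordinates; equality of points is _≈ₚ_ below, not _≡_.
  record Point : Set where
    constructor point
    field
      coords  : Vec₃
      nonzero : coords ≢ 0ᵥ
  open Point public

  infix 4 _≈ₚ_
  _≈ₚ_ : Point → Point → Set
  p ≈ₚ q = ∃[ k ] k ≢ 0# × coords q ≡ k • coords p

  •-assoc : ∀ k l v → k • (l • v) ≡ (k * l) • v
  •-assoc k l (x ∷ y ∷ z ∷ [])
    rewrite *-assoc k l x | *-assoc k l y | *-assoc k l z = refl

  •-identity : ∀ v → 1# • v ≡ v
  •-identity (x ∷ y ∷ z ∷ [])
    rewrite *-identityˡ x | *-identityˡ y | *-identityˡ z = refl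

  *-inverseˡ : ∀ k → k ≢ 0# → k ⁻¹ * k ≡ 1#
  *-inverseˡ k k≢0 = trans (*-comm _ _) (*-inverseʳ k k≢0)

  ⁻¹≢0 : ∀ k → k ≢ 0# → k ⁻¹ ≢ 0#
  ⁻¹≢0 k k≢0 eq = 0≢1 (trans (sym (zeroʳ k))
    (trans (cong (k *_) (sym eq)) (*-inverseʳ k k≢0)))

  *≢0 : ∀ k l → k ≢ 0# → l ≢ 0# → k * l ≢ 0#
  *≢0 k l k≢0 l≢0 eq = l≢0 (trans (sym (*-identityˡ l))
    (trans (cong (_* l) (sym (*-inverseˡ k k≢0)))
    (trans (*-assoc _ k l) (trans (cong (k ⁻¹ *_) eq) (zeroʳ _)))))

  pointSetoid : Setoid 0ℓ 0ℓ
  pointSetoid = record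
    { Carrier = Point
    ; _≈_ = _≈ₚ_
    ; isEquivalence = record
      { refl  = 1# , 0≢1 ∘ sym , sym (•-identity _)
      ; sym   = λ { {p} (k , k≢0 , eq) → k ⁻¹ , ⁻¹≢0 k k≢0 ,
                    trans (sym (•-identity _))
                    (trans (cong (_• coords p) (sym (*-inverseˡ k k≢0)))
                    (trans (sym (•-assoc _ k _)) (cong (k ⁻¹ •_) (sym eq)))) }
      ; trans = λ { (k , k≢0 , eq) (l , l≢0 , eq′) → l * k , *≢0 l k l≢0 k≢0 ,
                    trans eq′ (trans (cong (l •_) eq) (•-assoc l k _)) }
      }
    }

  -- The line with coordinates [a,b,c] has the equation ax + by + cz = 0.
  Line : Set
  Line = Point

  OnLine : Line → Pred Point 0ℓ
  OnLine ℓ p = coords ℓ ∙ coords p ≡ 0#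

  record PointSet : Set₁ where
    field
      _∋_       : Pred Point 0ℓ
      respects  : _∋_ Respects _≈ₚ_
      decidable : Decidable _∋_
  open PointSet public using (_∋_)

  HasCardinality : Pred Point 0ℓ → ℕ → Set
  HasCardinality P n =
    ∃[ ps ] length ps ≡ n × Unique ps × (∀ p → P p ⇔ p ∈ ps)
    where
    open SetoidUnique pointSetoid using (Unique)
    open SetoidMembership pointSetoid using (_∈_)

  IsMaximalArc : ℕ → PointSet → Set
  IsMaximalArc d K =
    (∃[ p ] K ∋ p) × (∃[ p ] ¬ (K ∋ p)) ×
    (∀ ℓ → HasCardinality ((K ∋_) ∩ OnLine ℓ) 0 ⊎
           HasCardinality ((K ∋_) ∩ OnLine ℓ) d)

  Matrix : Set
  Matrix = Vec Vec₃ 3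

  _·_ : Matrix → Vec₃ → Vec₃
  M · v = Vec.map (_∙ v) M

  record GL₃ : Set where
    field
      matrix inverse : Matrix
      inverseˡ       : ∀ v → inverse · (matrix · v) ≡ v
      inverseʳ       : ∀ v → matrix · (inverse · v) ≡ v

  record FieldAutomorphism : Set where
    field
      to                : Carrier → Carrier
      isRingIsomorphism : IsRingIsomorphism rawRing rawRing to
    open IsRingIsomorphism isRingIsomorphism public using (0#-homo; injective)

  -- Representatives of the elements of PΓL(3,q): v ↦ matrix · σ(v).
  record ΓL₃ : Set where
    field
      linear       : GL₃
      automorphism : FieldAutomorphism
    open GL₃ linear public
    open FieldAutomorphism automorphism public renaming (to to σ)

  ∙-zeroʳ : ∀ r → r ∙ 0ᵥ ≡ 0#
  ∙-zeroʳ (a ∷ b ∷ c ∷ []) rewrite zeroʳ a | zeroʳ b | zeroʳ c =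
    trans (+-identityʳ _) (+-identityʳ _)

  ·-zeroʳ : ∀ M → M · 0ᵥ ≡ 0ᵥ
  ·-zeroʳ (r ∷ s ∷ t ∷ []) rewrite ∙-zeroʳ r | ∙-zeroʳ s | ∙-zeroʳ t = refl

  linear-nonzero : (g : GL₃) → ∀ {v} → v ≢ 0ᵥ → GL₃.matrix g · v ≢ 0ᵥ
  linear-nonzero g {v} v≢0 eq = v≢0
    (trans (sym (inverseˡ v)) (trans (cong (inverse ·_) eq) (·-zeroʳ inverse)))
    where open GL₃ g

  σ-nonzero : (s : FieldAutomorphism) → ∀ {v} → v ≢ 0ᵥ →
              Vec.map (FieldAutomorphism.to s) v ≢ 0ᵥ
  σ-nonzero s {x ∷ y ∷ z ∷ []} v≢0 eq = v≢0
    (cong₂ _∷_ (zero⁻ (cong Vec.head eq))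
    (cong₂ _∷_ (zero⁻ (cong (Vec.head ∘ Vec.tail) eq))
    (cong₂ _∷_ (zero⁻ (cong (Vec.head ∘ Vec.tail ∘ Vec.tail) eq)) refl)))
    where
    open FieldAutomorphism s
    zero⁻ : ∀ {a} → to a ≡ 0# → a ≡ 0#
    zero⁻ e = injective (trans e (sym 0#-homo))

  projectivity : GL₃ → Point → Point
  projectivity g (point v v≢0) = point (GL₃.matrix g · v) (linear-nonzero g v≢0)

  collineation : ΓL₃ → Point → Point
  collineation g (point v v≢0) =
    point (matrix · Vec.map σ v)
          (linear-nonzero linear (σ-nonzero automorphism v≢0))
    where open ΓL₃ g

  infix 4 _≅_
  _≅_ : PointSet → PointSet → Set
  K ≅ L = ∃[ g ] (∀ p → (K ∋ p) ⇔ (L ∋ collineation g p))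

module MathonArcs {h : ℕ} (𝔽 : BinaryField h) where
  open BinaryField 𝔽
  open ProjectivePlane 𝔽

  -- F α β l stands for the conic F_{α,β,λ} with λ = l.
  record Conic : Set where
    constructor F
    field
      α β l : Carrier
  open Conic

  OnConic : Conic → Pred Point 0ℓ
  OnConic (F α β l) (point (x ∷ y ∷ z ∷ []) _) =
    α * (x * x) + x * y + β * (y * y) + l * (z * z) ≡ 0#

  F₀ : Point
  F₀ = point (0# ∷ 0# ∷ 1# ∷ [])
             (λ eq → 0≢1 (sym (cong (Vec.head ∘ Vec.tail ∘ Vec.tail) eq)))

  -- Meaningful only for l ≢ l′.
  infixl 6 _⊕_
  _⊕_ : Conic → Conic → Conic
  F α β l ⊕ F α′ β′ l′ =
    F ((α * l + α′ * l′) * (l + l′) ⁻¹) ((β * l + β′ * l′) * (l + l′) ⁻¹) (l + l′)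

  record IsClosed (C : Pred Conic 0ℓ) : Set where
    field
      trace-one  : ∀ {c} → C c → Tr (α c * β c) ≡ 1#
      l-nonzero  : ∀ {c} → C c → l c ≢ 0#
      l-distinct : ∀ {c d} → C c → C d → c ≢ d → l c ≢ l d
      ⊕-closed   : ∀ {c d} → C c → C d → c ≢ d → C (c ⊕ d)

  ConicUnion : Pred Conic 0ℓ → Pred Point 0ℓ
  ConicUnion C p = p ≈ₚ F₀ ⊎ (∃[ c ] C c × OnConic c p)

  -- K arises from C after a change of coordinates.
  ArisesFrom : PointSet → Pred Conic 0ℓ → Set
  ArisesFrom K C = ∃[ g ] (∀ p → (K ∋ p) ⇔ ConicUnion C (projectivity g p))

  IsMathonType : PointSet → Set₁
  IsMathonType K =
    ∃[ C ] Decidable C × Satisfiable C × IsClosed C × ArisesFrom K C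

  record IsAdditiveSubgroup (A : Pred Carrier 0ℓ) : Set where
    field
      0∈       : A 0#
      +-closed : ∀ {x y} → A x → A y → A (x + y)
      -‿closed : ∀ {x} → A x → A (- x)

  DennistonConics : Carrier → Pred Carrier 0ℓ → Pred Conic 0ℓ
  DennistonConics a A c = ∃[ l ] A l × l ≢ 0# × c ≡ F a 1# l

  IsDennistonType : PointSet → Set₁
  IsDennistonType K =
    ∃[ a ] Σ (Pred Carrier 0ℓ) λ A → Tr a ≡ 1# × Decidable A ×
    IsAdditiveSubgroup A × ArisesFrom K (DennistonConics a A)

  IsProperMathonArc : ℕ → PointSet → Set₁
  IsProperMathonArc d K =
    IsMaximalArc d K × IsMathonType K × ¬ IsDennistonType K

-- GF(32) = GF(2)[t] / (t⁵ + t² + 1), with a₀ + a₁ t + ⋯ + a₄ t⁴ represented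
-- by a₀ ∷ a₁ ∷ ⋯ ∷ a₄ ∷ [].
module GF32 where

  Element : Set
  Element = Vec Bool 5

  infixl 7 _*_
  infixl 6 _+_

  _+_ : Element → Element → Element
  _+_ = zipWith _xor_

  0# 1# : Element
  0# = replicate 5 false
  1# = true ∷ false ∷ false ∷ false ∷ false ∷ []

  -- multiplication by t, using t⁵ = 1 + t²
  t* : Element → Element
  t* (a₀ ∷ a₁ ∷ a₂ ∷ a₃ ∷ a₄ ∷ []) = a₄ ∷ a₀ ∷ (a₁ xor a₄) ∷ a₂ ∷ a₃ ∷ []

  scale : Bool → Element → Element
  scale b y = if b then y else 0#

  -- Horner's rule
  times : ∀ {n} → Vec Bool n → Element → Element
  times []       y = 0#
  times (a ∷ as) y = scale a y + t* (times as y)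

  _*_ : Element → Element → Element
  _*_ = times

  -- x³⁰
  _⁻¹ : Element → Element
  x ⁻¹ = x² * (x⁴ * (x⁸ * x¹⁶))
    where
    x²  = x * x
    x⁴  = x² * x²
    x⁸  = x⁴ * x⁴
    x¹⁶ = x⁸ * x⁸

  _≟_ : DecidableEquality Element
  _≟_ = ≡-dec Bool._≟_

  all? : ∀ n {P : Pred (Vec Bool n) 0ℓ} → Decidable P → Dec (∀ v → P v)
  all? zero    P? = map′ (λ { p [] → p }) (λ f → f []) (P? [])
  all? (suc n) P? =
    map′ (λ { (f , g) (false ∷ v) → f v ; (f , g) (true ∷ v) → g v })
         (λ f → (f ∘ (false ∷_)) , (f ∘ (true ∷_)))
         (all? n (P? ∘ (false ∷_)) ×-dec all? n (P? ∘ (true ∷_)))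

  +-assoc : ∀ x y z → (x + y) + z ≡ x + (y + z)
  +-assoc = zipWith-assoc Bool.xor-assoc

  +-comm : ∀ x y → x + y ≡ y + x
  +-comm = zipWith-comm Bool.xor-comm

  +-identityˡ : ∀ x → 0# + x ≡ x
  +-identityˡ = zipWith-identityˡ Bool.xor-identityˡ

  +-identityʳ : ∀ x → x + 0# ≡ x
  +-identityʳ = zipWith-identityʳ Bool.xor-identityʳ

  +-self : ∀ x → x + x ≡ 0#
  +-self = toWitness {a? = all? 5 λ x → (x + x) ≟ 0#} _

  interchange : ∀ w x y z → (w + x) + (y + z) ≡ (w + y) + (x + z)
  interchange w x y z = begin
    (w + x) + (y + z) ≡⟨ +-assoc w x (y + z) ⟩
    w + (x + (y + z)) ≡⟨ cong (w +_) (+-assoc x y z) ⟨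
    w + ((x + y) + z) ≡⟨ cong (λ u → w + (u + z)) (+-comm x y) ⟩
    w + ((y + x) + z) ≡⟨ cong (w +_) (+-assoc y x z) ⟩
    w + (y + (x + z)) ≡⟨ +-assoc w y (x + z) ⟨
    (w + y) + (x + z) ∎
    where open ≡-Reasoning

  t*-+ : ∀ x y → t* (x + y) ≡ t* x + t* y
  t*-+ = toWitness {a? = all? 5 λ x → all? 5 λ y → t* (x + y) ≟ (t* x + t* y)} _

  scale-xor : ∀ a b y → scale (a xor b) y ≡ scale a y + scale b y
  scale-xor false b     y = sym (+-identityˡ _)
  scale-xor true  false y = sym (+-identityʳ _)
  scale-xor true  true  y = sym (+-self y)

  scale-+ : ∀ a y z → scale a (y + z) ≡ scale a y + scale a z
  scale-+ false y z = refl
  scale-+ true  y z = refl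

  distribʳ : ∀ {n} z (x y : Vec Bool n) →
             times (zipWith _xor_ x y) z ≡ times x z + times y z
  distribʳ z []       []       = refl
  distribʳ z (a ∷ as) (b ∷ bs) = trans
    (cong₂ _+_ (scale-xor a b z)
               (trans (cong t* (distribʳ z as bs)) (t*-+ (times as z) (times bs z))))
    (interchange (scale a z) (scale b z) (t* (times as z)) (t* (times bs z)))

  distribˡ : ∀ {n} (x : Vec Bool n) y z → times x (y + z) ≡ times x y + times x z
  distribˡ []       y z = refl
  distribˡ (a ∷ as) y z = trans
    (cong₂ _+_ (scale-+ a y z)
               (trans (cong t* (distribˡ as y z)) (t*-+ (times as y) (times as z))))
    (interchange (scale a y) (scale a z) (t* (times as y)) (t* (times as z)))

  *-comm : ∀ x y → x * y ≡ y * x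
  *-comm = toWitness {a? = all? 5 λ x → all? 5 λ y → (x * y) ≟ (y * x)} _

  t*-* : ∀ x y → t* x * y ≡ t* (x * y)
  t*-* = toWitness {a? = all? 5 λ x → all? 5 λ y → (t* x * y) ≟ t* (x * y)} _

  0*-zero : ∀ y → 0# * y ≡ 0#
  0*-zero y = refl

  times-assoc : ∀ {n} (x : Vec Bool n) y z → times x y * z ≡ times x (y * z)
  times-assoc []       y z = 0*-zero z
  times-assoc (a ∷ as) y z = begin
    (scale a y + t* (times as y)) * z       ≡⟨ distribʳ z (scale a y) _ ⟩
    scale a y * z + t* (times as y) * z     ≡⟨ cong₂ _+_ (scale-* a) (t*-* (times as y) z) ⟩
    scale a (y * z) + t* (times as y * z)   ≡⟨ cong (λ u → scale a (y * z) + t* u) (times-assoc as y z) ⟩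
    scale a (y * z) + t* (times as (y * z)) ∎
    where
    open ≡-Reasoning
    scale-* : ∀ a → scale a y * z ≡ scale a (y * z)
    scale-* false = 0*-zero z
    scale-* true  = refl

  *-identityˡ : ∀ x → 1# * x ≡ x
  *-identityˡ = toWitness {a? = all? 5 λ x → (1# * x) ≟ x} _

  *-inverseʳ : ∀ x → x ≢ 0# → x * x ⁻¹ ≡ 1#
  *-inverseʳ = toWitness {a? = all? 5 λ x → ¬? (x ≟ 0#) →-dec ((x * x ⁻¹) ≟ 1#)} _

  Vec↔ : ∀ n → Fin (2 ℕ.^ n) ↔ Vec Bool n
  Vec↔ zero    = mk↔ₛ′ (λ _ → []) (λ _ → Fin.zero)
                       (λ { [] → refl }) (λ { Fin.zero → refl ; (Fin.suc ()) })
  Vec↔ (suc n) =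
    ↔-trans (*↔× {2} {2 ℕ.^ n})
    (↔-trans (2↔Bool ×-↔ Vec↔ n)
    (mk↔ₛ′ (uncurry _∷_) (λ v → Vec.head v , Vec.tail v)
           (λ { (_ ∷ _) → refl }) (λ _ → refl)))

  isCommutativeRing : IsCommutativeRing _≡_ _+_ _*_ id 0# 1#
  isCommutativeRing = record
    { isRing = record
      { +-isAbelianGroup = record
        { isGroup = record
          { isMonoid = record
            { isSemigroup = record
              { isMagma = record { isEquivalence = isEquivalence ; ∙-cong = cong₂ _+_ }
              ; assoc   = +-assoc
              }
            ; identity = +-identityˡ , +-identityʳ
            }
          ; inverse = +-self , +-self
          ; ⁻¹-cong = cong id
          }
        ; comm = +-comm
        }
      ; *-cong     = cong₂ _*_
      ; *-assoc    = times-assoc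
      ; *-identity = *-identityˡ , λ x → trans (*-comm x 1#) (*-identityˡ x)
      ; distrib    = distribˡ , distribʳ
      }
    ; *-comm = *-comm
    }

  field32 : BinaryField 5
  field32 = record
    { Carrier           = Element
    ; _+_               = _+_
    ; _*_               = _*_
    ; -_                = id
    ; 0#                = 0#
    ; 1#                = 1#
    ; isCommutativeRing = isCommutativeRing
    ; _⁻¹               = _⁻¹
    ; *-inverseʳ        = *-inverseʳ
    ; 0≢1               = λ ()
    ; order             = Vec↔ 5
    }

GF32 : BinaryField 5
GF32 = GF32.field32

{-# OPTIONS --safe #-}

-- For a closed set of conics F α β λ the products αλ and βλ are additive in λ.
-- For degree 8 the parameters λ form a 3-dimensional GF(2)-space A without 0, so
-- that α = l₀ + l₁λ + l₂λ³ and β = m₀ + m₁λ + m₂λ³.  If l₂ = m₂ = 0 the arc is of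
-- Denniston type; otherwise a change of coordinates fixing F₀ (but moving the line
-- z = 0) leads to α = 1 + λ³ and β = 1.  The trace conditions then say that A is
-- totally isotropic for the alternating form Tr (x²y + xy²), which has rank 4 on
-- GF(32): there are 15 such spaces, in three orbits under the Frobenius map.
-- Conversely, a conic contained in one of these arcs is one of its 7 conics (Bézout
-- and the pigeonhole principle), and comparing coefficients of polynomials in λ then
-- shows that isomorphisms between the three arcs come from field automorphisms, and
-- that none of the arcs is of Denniston type.
module Submission where

open import Defs
import Algebra.Solver.Ring as RingSolver
open import Algebra.Bundles using (CommutativeRing; RawRing)
open import Algebra.Morphism.Structures using (IsRingIsomorphism)
open import Algebra.Solver.Ring.AlmostCommutativeRing
  using (AlmostCommutativeRing; fromCommutativeRing; _-Raw-AlmostCommutative⟶_)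
open import Data.Bool.Base using (Bool; true; false; not; _xor_; _∧_)
import Data.Bool.Properties as Bool
open import Data.Empty using (⊥; ⊥-elim)
open import Data.Fin.Base as Fin using (Fin; zero; suc)
import Data.Fin.Properties as Fin
open import Data.List.Base as List using (List; []; _∷_; length; map; filter; _++_; cartesianProduct)
open import Data.List.Membership.DecPropositional GF32._≟_ using (_∈?_)
open import Data.List.Membership.Propositional using (_∈_; lose; find)
open import Data.List.Membership.Propositional.Properties using (∈-lookup)
import Data.List.Membership.Setoid as SetoidMembership
import Data.List.Membership.Setoid.Properties as SetoidMembershipProperties
open import Data.List.Properties using (length-++; length-map)
open import Data.List.Relation.Unary.All as All using (All; []; _∷_)
open import Data.List.Relation.Unary.All.Properties as All using (all-filter)
open import Data.List.Relation.Unary.AllPairs using ([]; _∷_)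
open import Data.List.Relation.Unary.Any as Any using (Any; here; there)
import Data.List.Relation.Unary.Any.Properties as Any
open import Data.List.Relation.Unary.Unique.DecPropositional using (unique?)
open import Data.List.Relation.Unary.Unique.Propositional using (Unique)
import Data.List.Relation.Unary.Unique.Propositional.Properties as Unique
import Data.List.Relation.Unary.Unique.Setoid as SetoidUnique
import Data.List.Relation.Unary.Unique.Setoid.Properties as SetoidUniqueProperties
open import Data.Nat.Base as ℕ using (ℕ; zero; suc; s≤s; z≤n; _≤_; _<_)
open import Data.Nat.ListAction using (sum)
import Data.Nat.Properties as ℕ
open import Data.Product.Base using (Σ; ∃-syntax; _×_; _,_; proj₁; proj₂)
open import Data.Product.Properties using (≡-dec)
open import Data.Sum.Base as Sum using (_⊎_; inj₁; inj₂)
open import Data.Vec.Base as Vec using (Vec; []; _∷_)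
import Data.Vec.Relation.Unary.All as VecAll
open import Function.Base using (id; _∘_)
open import Function.Bundles using (_⇔_; mk⇔; Equivalence)
open import Function.Construct.Composition using (_⇔-∘_)
open import Level using (0ℓ)
open import Relation.Binary.Bundles using (Setoid)
open import Relation.Binary.Definitions using (DecidableEquality)
open import Relation.Binary.PropositionalEquality
open import Relation.Nullary.Decidable
  using (Dec; yes; no; ¬?; _×-dec_; _⊎-dec_; _→-dec_; map′; dec⇒maybe; toWitness; from-yes)
open import Relation.Nullary.Negation using (¬_)
open import Relation.Unary using (Pred; Decidable; _∩_; _∪_)

-- The products αλ and βλ, being additive on a three-dimensional A, are linearised polynomials of
-- degree at most 4; division by λ leaves the exponents 0, 1 and 3. Replacing z by z + ux + vy adds
-- u²λ to α and v²λ to β: this absorbs every term linear in λ, and it is why the line z = 0 has to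
-- move. The price is that in normal form z = 0 may meet the arc, so the single traces Tr (αβ) are
-- no longer controlled. Their sums over x, y and x + y still are, and these suffice for
-- disjointness and for counting points on lines. To see that a normal form is of Mathon type,
-- another line missing the arc has to be exhibited. The number 15: Tr (x²y + xy²) = Tr ((x⁴ + x)y²)
-- has the radical GF(4) ∩ GF(32) = GF(2), so each maximal totally isotropic subspace contains 1,
-- and they correspond to the 15 totally isotropic planes of the 4-dimensional symplectic quotient.
-- The Bézout argument just fits: 32 parameters on a conic against 2 + 7 · 4 = 30 zeros.

-- Algebra in finite fields of odd degree over GF(2)

record OddField {h : ℕ} (𝔽 : BinaryField h) : Set where
  open BinaryField 𝔽
  field
    _≟_           : DecidableEquality Carrier
    x+x≡0         : ∀ x → x + x ≡ 0#
    √             : Carrier → Carrier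
    √-square      : ∀ x → √ x * √ x ≡ x
    -- Oddness of h enters here and in `Tr-1`: 3 is then prime to 2^h - 1, so that cubing is
    -- bijective, and the trace of 1 is h mod 2.
    ∛             : Carrier → Carrier
    ∛-cube        : ∀ x → ∛ x * (∛ x * ∛ x) ≡ x
    cube≡1        : ∀ x → x * (x * x) ≡ 1# → x ≡ 1#
    Tr-+          : ∀ x y → Tr (x + y) ≡ Tr x + Tr y
    Tr-square     : ∀ x → Tr (x * x) ≡ Tr x
    Tr-0⊎1        : ∀ x → Tr x ≡ 0# ⊎ Tr x ≡ 1#
    Tr-1          : Tr 1# ≡ 1#
    artinSchreier : ∀ x → Tr x ≡ 0# → ∃[ w ] w * w + w ≡ x

Bool-rawRing : RawRing 0ℓ 0ℓ
Bool-rawRing = record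
  { Carrier = Bool ; _≈_ = _≡_ ; _+_ = _xor_ ; _*_ = _∧_ ; -_ = id ; 0# = false ; 1# = true }

module OddFieldProperties {h : ℕ} (𝔽 : BinaryField h) (O : OddField 𝔽) where

  open BinaryField 𝔽
  open OddField O
  open ProjectivePlane 𝔽 using (*≢0; *-inverseˡ; ⁻¹≢0)
  open CommutativeRing commutativeRing using (-‿inverseˡ; +-assoc)

  ⟦_⟧₂ : Bool → Carrier
  ⟦ false ⟧₂ = 0#
  ⟦ true  ⟧₂ = 1#

  ⟦⟧₂-+ : ∀ a b → ⟦ a xor b ⟧₂ ≡ ⟦ a ⟧₂ + ⟦ b ⟧₂
  ⟦⟧₂-+ false b     = sym (+-identityˡ _)
  ⟦⟧₂-+ true  false = sym (+-identityʳ _)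
  ⟦⟧₂-+ true  true  = sym (x+x≡0 1#)

  -‿identity : ∀ x → - x ≡ x
  -‿identity x = begin
    - x           ≡⟨ +-identityʳ _ ⟨
    - x + 0#      ≡⟨ cong (- x +_) (x+x≡0 x) ⟨
    - x + (x + x) ≡⟨ +-assoc _ x x ⟨
    (- x + x) + x ≡⟨ cong (_+ x) (-‿inverseˡ x) ⟩
    0# + x        ≡⟨ +-identityˡ x ⟩
    x             ∎
    where open ≡-Reasoning

  -- A ring solver with coefficients in GF(2), so that x + x = 0 is built in.
  private
    ring : AlmostCommutativeRing 0ℓ 0ℓ
    ring = fromCommutativeRing commutativeRing

    coefficients : Bool-rawRing -Raw-AlmostCommutative⟶ ring
    coefficients = record
      { ⟦_⟧    = ⟦_⟧₂
      ; +-homo = ⟦⟧₂-+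
      ; *-homo = λ { false _ → sym (zeroˡ _) ; true _ → sym (*-identityˡ _) }
      ; -‿homo = λ _ → sym (-‿identity _)
      ; 0-homo = refl
      ; 1-homo = refl
      }

    _≟₂_ : ∀ a b → Dec (⟦ a ⟧₂ ≡ ⟦ b ⟧₂)
    false ≟₂ false = yes refl
    false ≟₂ true  = no 0≢1
    true  ≟₂ false = no (0≢1 ∘ sym)
    true  ≟₂ true  = yes refl

  open RingSolver Bool-rawRing ring coefficients (λ a b → dec⇒maybe (a ≟₂ b)) public
    using (solve; _:=_; _:+_; _:*_; con)

  +≡0⇒≡ : ∀ {x y} → x + y ≡ 0# → x ≡ y
  +≡0⇒≡ {x} {y} eq = begin
    x           ≡⟨ solve 2 (λ x y → x := (x :+ y) :+ y) refl x y ⟩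
    (x + y) + y ≡⟨ cong (_+ y) eq ⟩
    0# + y      ≡⟨ +-identityˡ y ⟩
    y           ∎
    where open ≡-Reasoning

  ≡⇒+≡0 : ∀ {x y} → x ≡ y → x + y ≡ 0#
  ≡⇒+≡0 {x} refl = x+x≡0 x

  -- In characteristic 2, `x ≡ y` follows from equations `p ≡ q` once `x + y` is a combination of
  -- the sums `p + q`. The multipliers form a certificate of ideal membership that the ring solver
  -- checks.
  by₁ : ∀ {x y p q} c → x + y ≡ c * (p + q) → p ≡ q → x ≡ y
  by₁ c eq p≡q = +≡0⇒≡ (trans eq (trans (cong (c *_) (≡⇒+≡0 p≡q)) (zeroʳ c)))

  by₂ : ∀ {x y p q p′ q′} c c′ → x + y ≡ c * (p + q) + c′ * (p′ + q′) →
        p ≡ q → p′ ≡ q′ → x ≡ y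
  by₂ c c′ eq p≡q p′≡q′ = +≡0⇒≡ (trans eq (trans
    (cong₂ (λ s t → c * s + c′ * t) (≡⇒+≡0 p≡q) (≡⇒+≡0 p′≡q′))
    (solve 2 (λ c d → c :* con false :+ d :* con false := con false) refl c c′)))

  by₃ : ∀ {x y p q p′ q′ p″ q″} c c′ c″ →
        x + y ≡ c * (p + q) + c′ * (p′ + q′) + c″ * (p″ + q″) →
        p ≡ q → p′ ≡ q′ → p″ ≡ q″ → x ≡ y
  by₃ c c′ c″ eq p≡q p′≡q′ p″≡q″ = +≡0⇒≡ (trans eq (trans
    (cong₂ _+_ (cong₂ (λ s t → c * s + c′ * t) (≡⇒+≡0 p≡q) (≡⇒+≡0 p′≡q′))
               (cong (c″ *_) (≡⇒+≡0 p″≡q″)))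
    (solve 3 (λ c d e → c :* con false :+ d :* con false :+ e :* con false := con false) refl c c′ c″)))

  *≡0⇒ʳ : ∀ {x y} → x ≢ 0# → x * y ≡ 0# → y ≡ 0#
  *≡0⇒ʳ {x} {y} x≢0 eq with y ≟ 0#
  ... | yes y≡0 = y≡0
  ... | no  y≢0 = ⊥-elim (*≢0 x y x≢0 y≢0 eq)

  square≡0 : ∀ {x} → x * x ≡ 0# → x ≡ 0#
  square≡0 {x} eq with x ≟ 0#
  ... | yes x≡0 = x≡0
  ... | no  x≢0 = ⊥-elim (*≢0 x x x≢0 x≢0 eq)

  *-cancelˡ : ∀ k {x y} → k ≢ 0# → k * x ≡ k * y → x ≡ y
  *-cancelˡ k {x} {y} k≢0 eq = +≡0⇒≡ (*≡0⇒ʳ k≢0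
    (trans (solve 3 (λ k x y → k :* (x :+ y) := k :* x :+ k :* y) refl k x y) (≡⇒+≡0 eq)))

  square-injective : ∀ {x y} → x * x ≡ y * y → x ≡ y
  square-injective {x} {y} eq = +≡0⇒≡ (square≡0
    (trans (solve 2 (λ x y → (x :+ y) :* (x :+ y) := x :* x :+ y :* y) refl x y) (≡⇒+≡0 eq)))

  √≢0 : ∀ {x} → x ≢ 0# → √ x ≢ 0#
  √≢0 {x} x≢0 eq = x≢0 (trans (sym (√-square x)) (trans (cong (√ x *_) eq) (zeroʳ _)))

  Tr-0 : Tr 0# ≡ 0#
  Tr-0 = trans (cong Tr (sym (x+x≡0 0#))) (trans (Tr-+ 0# 0#) (x+x≡0 _))

  Tr-+₃ : ∀ x y z → Tr (x + y + z) ≡ Tr x + Tr y + Tr z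
  Tr-+₃ x y z = trans (Tr-+ (x + y) z) (cong (_+ Tr z) (Tr-+ x y))

  -- For y ≠ 0 the element w = αx/y would solve w² + w = αβ, whose left-hand side has trace 0.
  anisotropic : ∀ {α β x y} → Tr (α * β) ≡ 1# →
                α * (x * x) + x * y + β * (y * y) ≡ 0# → x ≡ 0# × y ≡ 0#
  anisotropic {α} {β} {x} {y} tr eq = x≡0 , y≡0
    where
    α≢0 : α ≢ 0#
    α≢0 refl = 0≢1 (trans (sym Tr-0) (trans (cong Tr (sym (zeroˡ β))) tr))

    y≡0 : y ≡ 0#
    y≡0 with y ≟ 0#
    ... | yes y≡0 = y≡0
    ... | no  y≢0 = ⊥-elim (0≢1 (begin
      0#                      ≡⟨ x+x≡0 _ ⟨
      Tr w + Tr w             ≡⟨ cong (_+ Tr w) (Tr-square w) ⟨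
      Tr (w * w) + Tr w       ≡⟨ Tr-+ (w * w) w ⟨
      Tr (w * w + w)          ≡⟨ cong Tr w²+w ⟩
      Tr (α * β)              ≡⟨ tr ⟩
      1#                      ∎))
      where
      open ≡-Reasoning
      w = α * x * y ⁻¹
      w²+w : w * w + w ≡ α * β
      w²+w = by₂ (α * y ⁻¹ * y ⁻¹) (α * x * y ⁻¹ + α * β * (1# + y * y ⁻¹))
        (solve 5 (λ α β x y i → ((α :* x :* i) :* (α :* x :* i) :+ α :* x :* i) :+ α :* β
            := α :* i :* i :* ((α :* (x :* x) :+ x :* y :+ β :* (y :* y)) :+ con false)
            :+ (α :* x :* i :+ α :* β :* (con true :+ y :* i)) :* (y :* i :+ con true)) refl α β x y (y ⁻¹))
        eq (*-inverseʳ y y≢0)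

    x≡0 : x ≡ 0#
    x≡0 = square≡0 (*≡0⇒ʳ α≢0 (by₂ 1# (x + β * y)
      (solve 4 (λ α β x y → α :* (x :* x) :+ con false
          := con true :* ((α :* (x :* x) :+ x :* y :+ β :* (y :* y)) :+ con false)
          :+ (x :+ β :* y) :* (y :+ con false)) refl α β x y)
      eq y≡0))

length-filter-¬ : ∀ {A : Set} {P : Pred A 0ℓ} (P? : Decidable P) xs →
                  length xs ≡ length (filter P? xs) ℕ.+ length (filter (λ x → ¬? (P? x)) xs)
length-filter-¬ P? [] = refl
length-filter-¬ P? (x ∷ xs) with P? x
... | yes _ = cong suc (length-filter-¬ P? xs)
... | no  _ = trans (cong suc (length-filter-¬ P? xs)) (sym (ℕ.+-suc _ _))

-- Roots of polynomials and the pigeonhole principle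

module Polynomials {h : ℕ} (𝔽 : BinaryField h) (O : OddField 𝔽) where

  open BinaryField 𝔽
  open OddField O
  open OddFieldProperties 𝔽 O

  eval : ∀ {n} → Vec Carrier n → Carrier → Carrier
  eval []       x = 0#
  eval (c ∷ cs) x = c + x * eval cs x

  quotient : ∀ {n} → Vec Carrier (suc n) → Carrier → Vec Carrier n
  quotient (c ∷ [])      r = []
  quotient (c ∷ d ∷ cs) r = eval (d ∷ cs) r ∷ quotient (d ∷ cs) r

  -- Synthetic division by X + r: the coefficients of the quotient are the intermediate values of
  -- Horner's rule at r, and the remainder is its final value.
  eval-quotient : ∀ {n} (cs : Vec Carrier (suc n)) r x →
                  eval cs x + eval cs r ≡ (x + r) * eval (quotient cs r) x
  eval-quotient (c ∷ []) r x =
    (solve 3 (λ c r x → (c :+ x :* con false) :+ (c :+ r :* con false) := (x :+ r) :* con false) refl) c r x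
  eval-quotient (c ∷ d ∷ cs) r x =
    by₁ x (solve 6 (λ c p q r s x → ((c :+ x :* p) :+ (c :+ r :* q)) :+ (x :+ r) :* (q :+ x :* s)
        := x :* ((p :+ q) :+ (x :+ r) :* s)) refl
             c (eval (d ∷ cs) x) (eval (d ∷ cs) r) r (eval (quotient (d ∷ cs) r) x) x)
          (eval-quotient (d ∷ cs) r x)

  AllZero : ∀ {n} → Vec Carrier n → Set
  AllZero = VecAll.All (_≡ 0#)

  -- The head of the quotient is the value of the tail at r. Its vanishing reduces `eval cs r ≡ 0#`
  -- to the vanishing of the constant term and makes r a root of the tail.
  quotient-zero : ∀ {n} (cs : Vec Carrier (suc n)) r →
                  eval cs r ≡ 0# → AllZero (quotient cs r) → AllZero cs
  quotient-zero (c ∷ []) r eq _ = trans (solve 2 (λ c r → c := c :+ r :* con false) refl c r) eq VecAll.∷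
      VecAll.[]
  quotient-zero (c ∷ d ∷ cs) r eq (eq′ VecAll.∷ zs) =
    by₂ 1# r (solve 3 (λ c e r → c :+ con false
        := con true :* ((c :+ r :* e) :+ con false) :+ r :* (e :+ con false)) refl c (eval (d ∷ cs) r) r) eq
        eq′
    VecAll.∷ quotient-zero (d ∷ cs) r eq′ zs

  Root : ∀ {n} → Vec Carrier n → Carrier → Set
  Root cs x = eval cs x ≡ 0#

  roots⇒zero : ∀ {n} (cs : Vec Carrier n) {rs} → Unique rs → All (Root cs) rs →
               n ≤ length rs → AllZero cs
  roots⇒zero []       _ _ _ = VecAll.[]
  roots⇒zero (c ∷ cs) {r ∷ rs} (r∉ ∷ urs) (root ∷ roots) (s≤s n≤) =
    quotient-zero (c ∷ cs) r root
      (roots⇒zero (quotient (c ∷ cs) r) urs (All.zipWith quotient-root (r∉ , roots)) n≤)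
    where
    quotient-root : ∀ {x} → (r ≢ x) × Root (c ∷ cs) x → Root (quotient (c ∷ cs) r) x
    quotient-root {x} (r≢x , root′) = *≡0⇒ʳ (λ eq → r≢x (sym (+≡0⇒≡ eq)))
      (trans (sym (eval-quotient (c ∷ cs) r x))
             (trans (cong₂ _+_ root′ root) (+-identityˡ 0#)))

  -- n bounds the degree
  Poly : Set
  Poly = ∃[ n ] Vec Carrier (suc n)

  Root? : ∀ {n} (cs : Vec Carrier n) → Decidable (Root cs)
  Root? cs x = eval cs x ≟ 0#

  -- A polynomial with more roots in `xs` than its degree bound is zero. Otherwise discarding its
  -- roots costs at most that many points, and the remaining ones are covered by the other
  -- polynomials.
  coverByRoots : (ps : List Poly) {xs : List Carrier} → Unique xs →
                 All (λ x → Any (λ (_ , p) → Root p x) ps) xs →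
                 sum (map proj₁ ps) < length xs → Any (λ (_ , p) → AllZero p) ps
  coverByRoots []             {_ ∷ _} _ (() ∷ _) _
  coverByRoots ((n , p) ∷ ps) {xs} uxs cover bound
    with suc n ℕ.≤? length (filter (Root? p) xs)
  ... | yes n< = here (roots⇒zero p (Unique.filter⁺ (Root? p) uxs) (all-filter (Root? p) xs) n<)
  ... | no  n≮ = there (coverByRoots ps (Unique.filter⁺ NonRoot? uxs)
    (All.zipWith (λ { (¬root , here root) → ⊥-elim (¬root root) ; (_ , there any) → any })
                 (all-filter NonRoot? xs , All.filter⁺ NonRoot? cover))
    (ℕ.+-cancelˡ-< n _ _ (begin-strict
      n ℕ.+ sum (map proj₁ ps)
        <⟨ bound ⟩
      length xs
        ≡⟨ length-filter-¬ (Root? p) xs ⟩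
      length (filter (Root? p) xs) ℕ.+ length (filter NonRoot? xs)
        ≤⟨ ℕ.+-monoˡ-≤ _ (ℕ.s≤s⁻¹ (ℕ.≰⇒> n≮)) ⟩
      n ℕ.+ length (filter NonRoot? xs) ∎)))
    where
    open ℕ.≤-Reasoning
    NonRoot? : Decidable (λ x → eval p x ≢ 0#)
    NonRoot? x = ¬? (Root? p x)

-- Conics as quadratic forms, and the linear maps fixing F₀

module Geometry {h : ℕ} (𝔽 : BinaryField h) (O : OddField 𝔽) where

  open BinaryField 𝔽
  open OddField O
  open OddFieldProperties 𝔽 O
  open Polynomials 𝔽 O
  open ProjectivePlane 𝔽
  open MathonArcs 𝔽

  ∷³ : ∀ {x y z x′ y′ z′ : Carrier} → x ≡ x′ → y ≡ y′ → z ≡ z′ →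
       _≡_ {A = Vec₃} (x ∷ y ∷ z ∷ []) (x′ ∷ y′ ∷ z′ ∷ [])
  ∷³ refl refl refl = refl

  ·-• : ∀ M k v → M · (k • v) ≡ k • (M · v)
  ·-• ((a ∷ b ∷ e ∷ []) ∷ (c ∷ d ∷ f ∷ []) ∷ (u ∷ v ∷ w ∷ []) ∷ []) k (x ∷ y ∷ z ∷ []) =
    ∷³ (eq a b e) (eq c d f) (eq u v w)
    where
    eq : ∀ a b c → a * (k * x) + b * (k * y) + c * (k * z) ≡ k * (a * x + b * y + c * z)
    eq a b c = solve 7 (λ a b c k x y z → a :* (k :* x) :+ b :* (k :* y) :+ c :* (k :* z)
        := k :* (a :* x :+ b :* y :+ c :* z)) refl a b c k x y z

  -- Defined on bare vectors, since it is also evaluated at columns of matrices, where no proof of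
  -- nonvanishing is at hand.
  Φ : Conic → Vec₃ → Carrier
  Φ (F α β l) (x ∷ y ∷ z ∷ []) = α * (x * x) + x * y + β * (y * y) + l * (z * z)

  OnConic⇔Φ : ∀ c p → OnConic c p ⇔ (Φ c (coords p) ≡ 0#)
  OnConic⇔Φ (F α β l) (point (x ∷ y ∷ z ∷ []) _) = mk⇔ (λ eq → eq) (λ eq → eq)

  Φ-• : ∀ c k v → Φ c (k • v) ≡ k * k * Φ c v
  Φ-• (F α β l) k (x ∷ y ∷ z ∷ []) =
    (solve 7 (λ α β l k x y z → α :* (k :* x :* (k :* x)) :+ k :* x :* (k :* y) :+ β :* (k :* y :* (k :* y))
        :+ l :* (k :* z :* (k :* z)) := k :* k :* (α :* (x :* x) :+ x :* y :+ β :* (y :* y)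
        :+ l :* (z :* z))) refl) α β l k x y z

  Nucleus : Vec₃ → Set
  Nucleus (x ∷ y ∷ z ∷ []) = x ≡ 0# × y ≡ 0#

  ≈F₀⇔Nucleus : ∀ p → (p ≈ₚ F₀) ⇔ Nucleus (coords p)
  ≈F₀⇔Nucleus (point (x ∷ y ∷ z ∷ []) p≢0) = mk⇔ to from
    where
    to : point (x ∷ y ∷ z ∷ []) p≢0 ≈ₚ F₀ → x ≡ 0# × y ≡ 0#
    to (k , k≢0 , eq) = *≡0⇒ʳ k≢0 (sym (cong Vec.head eq)) ,
                        *≡0⇒ʳ k≢0 (sym (cong (Vec.head ∘ Vec.tail) eq))
    from : x ≡ 0# × y ≡ 0# → point (x ∷ y ∷ z ∷ []) p≢0 ≈ₚ F₀
    from (refl , refl) = z ⁻¹ , ⁻¹≢0 z z≢0 ,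
      ∷³ (sym (zeroʳ _)) (sym (zeroʳ _)) (sym (*-inverseˡ z z≢0))
      where
      z≢0 : z ≢ 0#
      z≢0 refl = p≢0 refl

  F₀∉conic : ∀ c v → v ≢ 0ᵥ → Nucleus v → Conic.l c ≢ 0# → Φ c v ≢ 0#
  F₀∉conic (F α β l) (x ∷ y ∷ z ∷ []) v≢0 (refl , refl) l≢0 eq =
    v≢0 (cong (λ z → 0# ∷ 0# ∷ z ∷ []) (square≡0 (*≡0⇒ʳ l≢0
      (trans (solve 4 (λ α β l z → l :* (z :* z)
          := α :* (con false :* con false) :+ con false :* con false :+ β :* (con false :* con false)
          :+ l :* (z :* z)) refl α β l z) eq))))

  -- At a common point, elimination of z leaves a binary form with coefficients α + α′ + α″, 1 and β
  -- + β′ + β″, which is anisotropic. The hypothesis concerns the sum of the three traces because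
  -- the conics `cubic x` below do not all have trace 1 individually.
  conics-disjoint : ∀ {α β l α′ β′ l′ α″ β″} → l ≢ l′ →
    (l + l′) * α″ ≡ α * l + α′ * l′ → (l + l′) * β″ ≡ β * l + β′ * l′ →
    Tr (α * β) + Tr (α′ * β′) + Tr (α″ * β″) ≡ 1# →
    ∀ v → v ≢ 0ᵥ → Φ (F α β l) v ≡ 0# → Φ (F α′ β′ l′) v ≢ 0#
  conics-disjoint {α} {β} {l} {α′} {β′} {l′} {α″} {β″} l≢l′ eqα eqβ tr (x ∷ y ∷ z ∷ []) v≢0 on on′ =
    v≢0 (∷³ x≡0 y≡0 z≡0)
    where
    s = l + l′
    s≢0 : s ≢ 0#
    s≢0 = l≢l′ ∘ +≡0⇒≡
    -- composing the equations and adding both of them eliminates z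
    form : (α + α′ + α″) * (x * x) + x * y + (β + β′ + β″) * (y * y) ≡ 0#
    form = *-cancelˡ s s≢0 (by₃ (x * x) (y * y) 1#
      (solve 11 (λ α β l α′ β′ l′ α″ β″ x y z
          → (l :+ l′) :* ((α :+ α′ :+ α″) :* (x :* x) :+ x :* y :+ (β :+ β′ :+ β″) :* (y :* y))
          :+ (l :+ l′) :* con false := (x :* x) :* ((l :+ l′) :* α″ :+ (α :* l :+ α′ :* l′))
          :+ (y :* y) :* ((l :+ l′) :* β″ :+ (β :* l :+ β′ :* l′))
          :+ con true :* ((l′ :* (α :* (x :* x) :+ x :* y :+ β :* (y :* y) :+ l :* (z :* z))
          :+ l :* (α′ :* (x :* x) :+ x :* y :+ β′ :* (y :* y) :+ l′ :* (z :* z))) :+ con false)) refl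
        α β l α′ β′ l′ α″ β″ x y z)
      eqα eqβ
      (trans (cong₂ (λ p q → l′ * p + l * q) on on′)
          (solve 2 (λ l k → k :* con false :+ l :* con false := con false) refl l l′)))
    tr′ : Tr ((α + α′ + α″) * (β + β′ + β″)) ≡ 1#
    tr′ = trans (cong Tr eq) (trans (Tr-+₃ (α * β) (α′ * β′) (α″ * β″)) tr)
      where
      -- α″ and β″ are the same affine combination of the old parameters, with weights l/s and l′/s
      -- of sum 1. In characteristic 2 the product of the sums is then the sum of the products.
      eq : (α + α′ + α″) * (β + β′ + β″) ≡ α * β + α′ * β′ + α″ * β″
      eq = *-cancelˡ s s≢0 (by₂ (β + β′) (α + α′)
        (solve 8 (λ α β l α′ β′ l′ α″ β″
            → (l :+ l′) :* ((α :+ α′ :+ α″) :* (β :+ β′ :+ β″))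
            :+ (l :+ l′) :* (α :* β :+ α′ :* β′ :+ α″ :* β″)
            := (β :+ β′) :* ((l :+ l′) :* α″ :+ (α :* l :+ α′ :* l′))
            :+ (α :+ α′) :* ((l :+ l′) :* β″ :+ (β :* l :+ β′ :* l′))) refl
          α β l α′ β′ l′ α″ β″)
        eqα eqβ)
    x≡0 = proj₁ (anisotropic tr′ form)
    y≡0 = proj₂ (anisotropic tr′ form)
    z≡0 : z ≡ 0#
    z≡0 = square≡0 (*≡0⇒ʳ s≢0 (trans
      (solve 9 (λ α β l α′ β′ l′ x y z → (l :+ l′) :* (z :* z)
          := (α :* (x :* x) :+ x :* y :+ β :* (y :* y) :+ l :* (z :* z))
          :+ (α′ :* (x :* x) :+ x :* y :+ β′ :* (y :* y) :+ l′ :* (z :* z)) :+ (α :+ α′) :* (x :* x)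
          :+ (β :+ β′) :* (y :* y)) refl α β l α′ β′ l′ x y z)
      (trans (cong₂ _+_ (cong₂ _+_ (cong₂ _+_ on on′) (cong (λ x → (α + α′) * (x * x)) x≡0))
          (cong (λ y → (β + β′) * (y * y)) y≡0))
      (solve 2 (λ p q → con false :+ con false :+ p :* (con false :* con false)
          :+ q :* (con false :* con false) := con false) refl (α + α′) (β + β′)))))

  -- The shape of the linear maps that fix F₀: the last column is (0, 0, w). `det` below is the
  -- determinant of the upper left block only.
  record Shear : Set where
    constructor shear
    field
      a b c d u v w : Carrier

  open Shear

  det : Shear → Carrier
  det N = a N * d N + b N * c N

  matrixOf : Shear → Matrix
  matrixOf (shear a b c d u v w) =
    (a ∷ b ∷ 0# ∷ []) ∷ (c ∷ d ∷ 0# ∷ []) ∷ (u ∷ v ∷ w ∷ []) ∷ []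

  -- Pulling `c′` back along `N` gives `det N` times the equation of `c`. Three equations suffice:
  -- squares have no mixed terms in characteristic 2, and the term xy pulls back with mixed
  -- coefficient `det N`.
  record Maps (N : Shear) (c c′ : Conic) : Set where
    constructor maps
    field
      α-eq : det N * Conic.α c ≡ Φ c′ (a N ∷ Shear.c N ∷ u N ∷ [])
      β-eq : det N * Conic.β c ≡ Φ c′ (b N ∷ d N ∷ v N ∷ [])
      l-eq : det N * Conic.l c ≡ w N * w N * Conic.l c′

  Maps⇒Φ : ∀ N {c c′} → Maps N c c′ → ∀ v → Φ c′ (matrixOf N · v) ≡ det N * Φ c v
  Maps⇒Φ (shear a b c d u v w) {F α β l} {F α′ β′ l′} (maps eqα eqβ eql) (x ∷ y ∷ z ∷ []) =
    by₃ (x * x) (y * y) (z * z)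
      (solve 16 (λ a b c d u v w α β l α′ β′ l′ x y z
          → (α′ :* ((a :* x :+ b :* y :+ con false :* z) :* (a :* x :+ b :* y :+ con false :* z))
          :+ (a :* x :+ b :* y :+ con false :* z) :* (c :* x :+ d :* y :+ con false :* z)
          :+ β′ :* ((c :* x :+ d :* y :+ con false :* z) :* (c :* x :+ d :* y :+ con false :* z))
          :+ l′ :* ((u :* x :+ v :* y :+ w :* z) :* (u :* x :+ v :* y :+ w :* z)))
          :+ (a :* d :+ b :* c) :* (α :* (x :* x) :+ x :* y :+ β :* (y :* y) :+ l :* (z :* z))
          := x :* x :* ((a :* d :+ b :* c) :* α
          :+ (α′ :* (a :* a) :+ a :* c :+ β′ :* (c :* c) :+ l′ :* (u :* u)))
          :+ y :* y :* ((a :* d :+ b :* c) :* β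
          :+ (α′ :* (b :* b) :+ b :* d :+ β′ :* (d :* d) :+ l′ :* (v :* v)))
          :+ z :* z :* ((a :* d :+ b :* c) :* l :+ w :* w :* l′)) refl a b c d u v w α β l α′ β′ l′ x y z)
      eqα eqβ eql

  shear⁻¹ : Shear → Shear
  shear⁻¹ N@(shear a b c d u v w) =
    shear (k * d) (k * b) (k * c) (k * a) (w ⁻¹ * k * (u * d + v * c)) (w ⁻¹ * k * (u * b + v * a)) (w ⁻¹)
    where k = det N ⁻¹

  shear⁻¹-inverseˡ : ∀ N → det N ≢ 0# → w N ≢ 0# → ∀ v → matrixOf (shear⁻¹ N) · (matrixOf N · v) ≡ v
  shear⁻¹-inverseˡ N@(shear a b c d u v w) D≢0 w≢0 (x ∷ y ∷ z ∷ []) = ∷³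
    (by₁ x (solve 9 (λ a b c d k x y z t
        → (k :* d :* (a :* x :+ b :* y :+ con false :* z) :+ k :* b :* (c :* x :+ d :* y :+ con false :* z))
        :+ con false :* t :+ x := x :* ((a :* d :+ b :* c) :* k :+ con true)) refl a b c d k x y z _) eqD)
    (by₁ y (solve 9 (λ a b c d k x y z t
        → (k :* c :* (a :* x :+ b :* y :+ con false :* z) :+ k :* a :* (c :* x :+ d :* y :+ con false :* z))
        :+ con false :* t :+ y := y :* ((a :* d :+ b :* c) :* k :+ con true)) refl a b c d k x y z _) eqD)
    (by₂ (i * (u * x + v * y)) z (solve 12
        (λ a b c d u v w k i x y z → (i :* k :* (u :* d :+ v :* c) :* (a :* x :+ b :* y :+ con false :* z)
        :+ i :* k :* (u :* b :+ v :* a) :* (c :* x :+ d :* y :+ con false :* z)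
        :+ i :* (u :* x :+ v :* y :+ w :* z)) :+ z
        := i :* (u :* x :+ v :* y) :* ((a :* d :+ b :* c) :* k :+ con true) :+ z :* (w :* i :+ con true))
        refl a b c d u v w k i x y z) eqD (*-inverseʳ w w≢0))
    where
    k = det N ⁻¹
    i = w ⁻¹
    eqD = *-inverseʳ (det N) D≢0

  shear⁻¹-inverseʳ : ∀ N → det N ≢ 0# → w N ≢ 0# → ∀ v → matrixOf N · (matrixOf (shear⁻¹ N) · v) ≡ v
  shear⁻¹-inverseʳ N@(shear a b c d u v w) D≢0 w≢0 (x ∷ y ∷ z ∷ []) = ∷³
    (by₁ x (solve 9 (λ a b c d k x y z t
        → (a :* (k :* d :* x :+ k :* b :* y :+ con false :* z)
        :+ b :* (k :* c :* x :+ k :* a :* y :+ con false :* z)) :+ con false :* t :+ x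
        := x :* ((a :* d :+ b :* c) :* k :+ con true)) refl a b c d k x y z _) eqD)
    (by₁ y (solve 9 (λ a b c d k x y z t
        → (c :* (k :* d :* x :+ k :* b :* y :+ con false :* z)
        :+ d :* (k :* c :* x :+ k :* a :* y :+ con false :* z)) :+ con false :* t :+ y
        := y :* ((a :* d :+ b :* c) :* k :+ con true)) refl a b c d k x y z _) eqD)
    (by₁ (z + k * (u * d + v * c) * x + k * (u * b + v * a) * y)
        (solve 12 (λ a b c d u v w k i x y z
        → (u :* (k :* d :* x :+ k :* b :* y :+ con false :* z)
        :+ v :* (k :* c :* x :+ k :* a :* y :+ con false :* z)
        :+ w :* (i :* k :* (u :* d :+ v :* c) :* x :+ i :* k :* (u :* b :+ v :* a) :* y :+ i :* z)) :+ z
        := (z :+ k :* (u :* d :+ v :* c) :* x :+ k :* (u :* b :+ v :* a) :* y) :* (w :* i :+ con true)) refl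
        a b c d u v w k i x y z) (*-inverseʳ w w≢0))
    where
    k = det N ⁻¹
    i = w ⁻¹
    eqD = *-inverseʳ (det N) D≢0

  shearGL : ∀ N → det N ≢ 0# → w N ≢ 0# → GL₃
  shearGL N D≢0 w≢0 = record
    { matrix   = matrixOf N
    ; inverse  = matrixOf (shear⁻¹ N)
    ; inverseˡ = shear⁻¹-inverseˡ N D≢0 w≢0
    ; inverseʳ = shear⁻¹-inverseʳ N D≢0 w≢0
    }

  Nucleus-shear : ∀ N → det N ≢ 0# → ∀ v → Nucleus (matrixOf N · v) ⇔ Nucleus v
  Nucleus-shear N@(shear a b c d u v w) D≢0 (x ∷ y ∷ z ∷ []) = mk⇔ to from
    where
    to : Nucleus (matrixOf N · (x ∷ y ∷ z ∷ [])) → x ≡ 0# × y ≡ 0#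
    to (eq , eq′) =
      *≡0⇒ʳ D≢0 (by₂ d b (solve 7 (λ a b c d x y z → (a :* d :+ b :* c) :* x :+ con false
          := d :* ((a :* x :+ b :* y :+ con false :* z) :+ con false)
          :+ b :* ((c :* x :+ d :* y :+ con false :* z) :+ con false)) refl a b c d x y z) eq eq′) ,
      *≡0⇒ʳ D≢0 (by₂ c a (solve 7 (λ a b c d x y z → (a :* d :+ b :* c) :* y :+ con false
          := c :* ((a :* x :+ b :* y :+ con false :* z) :+ con false)
          :+ a :* ((c :* x :+ d :* y :+ con false :* z) :+ con false)) refl a b c d x y z) eq eq′)
    from : x ≡ 0# × y ≡ 0# → Nucleus (matrixOf N · (x ∷ y ∷ z ∷ []))
    from (refl , refl) = solve 3 (λ a b z → a :* con false :+ b :* con false :+ con false :* z := con false)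
        refl a b z , solve 3 (λ a b z → a :* con false :+ b :* con false :+ con false :* z := con false)
        refl c d z

  Maps⇒on⇔ : ∀ N → det N ≢ 0# → ∀ {c c′} → Maps N c c′ → ∀ v → (Φ c′ (matrixOf N · v) ≡ 0#) ⇔ (Φ c v ≡ 0#)
  Maps⇒on⇔ N D≢0 m v = mk⇔ (λ eq → *≡0⇒ʳ D≢0 (trans (sym (Maps⇒Φ N m v)) eq))
                           (λ eq → trans (Maps⇒Φ N m v) (trans (cong (det N *_) eq) (zeroʳ _)))

-- Recognising a conic inside a union of conics

module Transfer {h : ℕ} (𝔽 : BinaryField h) (O : OddField 𝔽) where

  open BinaryField 𝔽
  open OddField O
  open OddFieldProperties 𝔽 O
  open Polynomials 𝔽 O
  open Geometry 𝔽 O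
  open ProjectivePlane 𝔽
  open MathonArcs 𝔽

  -- The mixed coefficients are the 2 by 2 minors of the first two rows of the matrix, the same for
  -- every target conic.
  substitute : ∀ α β l a b e c d f u v w x y z →
    α * ((a * x + b * y + e * z) * (a * x + b * y + e * z))
        + (a * x + b * y + e * z) * (c * x + d * y + f * z)
        + β * ((c * x + d * y + f * z) * (c * x + d * y + f * z))
        + l * ((u * x + v * y + w * z) * (u * x + v * y + w * z)) ≡
    (α * (a * a) + a * c + β * (c * c) + l * (u * u)) * (x * x)
        + (α * (b * b) + b * d + β * (d * d) + l * (v * v)) * (y * y)
        + (α * (e * e) + e * f + β * (f * f) + l * (w * w)) * (z * z) + (a * d + b * c) * (x * y)
        + (a * f + e * c) * (x * z) + (b * f + e * d) * (y * z)
  substitute = solve 15 (λ α β l a b e c d f u v w x y z →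
    α :* ((a :* x :+ b :* y :+ e :* z) :* (a :* x :+ b :* y :+ e :* z))
        :+ (a :* x :+ b :* y :+ e :* z) :* (c :* x :+ d :* y :+ f :* z)
        :+ β :* ((c :* x :+ d :* y :+ f :* z) :* (c :* x :+ d :* y :+ f :* z))
        :+ l :* ((u :* x :+ v :* y :+ w :* z) :* (u :* x :+ v :* y :+ w :* z)) :=
    (α :* (a :* a) :+ a :* c :+ β :* (c :* c) :+ l :* (u :* u)) :* (x :* x)
        :+ (α :* (b :* b) :+ b :* d :+ β :* (d :* d) :+ l :* (v :* v)) :* (y :* y)
        :+ (α :* (e :* e) :+ e :* f :+ β :* (f :* f) :+ l :* (w :* w)) :* (z :* z)
        :+ (a :* d :+ b :* c) :* (x :* y) :+ (a :* f :+ e :* c) :* (x :* z)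
        :+ (b :* f :+ e :* d) :* (y :* z)) refl

  -- quartic A B C D E G m p q lists the coefficients, in s, of the quadratic form
  -- A x² + B y² + C z² + D xy + E xz + G yz on the points
  -- (s² , 1 , m (p s² + s + q)) of the conic F (p²) (q²) (m⁻²).
  quartic : (A B C D E G m p q : Carrier) → Vec Carrier 5
  quartic A B C D E G m p q =
    B + C * (m * m) * (q * q) + G * m * q ∷
    G * m ∷
    C * (m * m) + D + E * m * q + G * m * p ∷
    E * m ∷
    A + C * (m * m) * (p * p) + E * m * p ∷ []

  eval-quartic : ∀ A B C D E G m p q s →
    A * (s * s * (s * s)) + B * (1# * 1#) + C * (m * (p * (s * s) + s + q) * (m * (p * (s * s) + s + q)))
        + D * (s * s * 1#) + E * (s * s * (m * (p * (s * s) + s + q)))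
        + G * (1# * (m * (p * (s * s) + s + q))) ≡
    (B + C * (m * m) * (q * q) + G * m * q)
        + s * (G * m + s * ((C * (m * m) + D + E * m * q + G * m * p)
        + s * (E * m + s * ((A + C * (m * m) * (p * p) + E * m * p) + s * 0#))))
  eval-quartic = solve 10 (λ A B C D E G m p q s →
    A :* (s :* s :* (s :* s)) :+ B :* (con true :* con true)
        :+ C :* (m :* (p :* (s :* s) :+ s :+ q) :* (m :* (p :* (s :* s) :+ s :+ q)))
        :+ D :* (s :* s :* con true) :+ E :* (s :* s :* (m :* (p :* (s :* s) :+ s :+ q)))
        :+ G :* (con true :* (m :* (p :* (s :* s) :+ s :+ q))) :=
    (B :+ C :* (m :* m) :* (q :* q) :+ G :* m :* q)
        :+ s :* (G :* m :+ s :* ((C :* (m :* m) :+ D :+ E :* m :* q :+ G :* m :* p)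
        :+ s :* (E :* m :+ s :* ((A :+ C :* (m :* m) :* (p :* p) :+ E :* m :* p) :+ s :* con false))))) refl

  eval-quadratic : ∀ a b e m p q s →
    a * (s * s) + b * 1# + e * (m * (p * (s * s) + s + q)) ≡
    (b + e * m * q) + s * (e * m + s * ((a + e * m * p) + s * 0#))
  eval-quadratic = solve 7 (λ a b e m p q s →
    a :* (s :* s) :+ b :* con true :+ e :* (m :* (p :* (s :* s) :+ s :+ q)) :=
    (b :+ e :* m :* q) :+ s :* (e :* m :+ s :* ((a :+ e :* m :* p) :+ s :* con false))) refl

  -- The two upper entries of the last column are dropped; `isShear` below records that they were
  -- zero.
  shearOf : Matrix → Shear
  shearOf ((a ∷ b ∷ _ ∷ []) ∷ (c ∷ d ∷ _ ∷ []) ∷ (u ∷ v ∷ w ∷ []) ∷ []) = shear a b c d u v w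

  record Image (N : Matrix) (c : Conic) (Ds : List Conic) : Set where
    constructor image
    field
      isShear : N ≡ matrixOf (shearOf N)
      det≢0   : det (shearOf N) ≢ 0#
      target  : Any (Maps (shearOf N) c) Ds

  private
    module _ (a b e c d f u v w : Carrier) (N⁻¹ : Matrix) where
      N : Matrix
      N = (a ∷ b ∷ e ∷ []) ∷ (c ∷ d ∷ f ∷ []) ∷ (u ∷ v ∷ w ∷ []) ∷ []

      module _ (N-inverseʳ : ∀ v → N · (N⁻¹ · v) ≡ v) where

        -- Cauchy-Binet: the first two rows of N times the first two columns of its inverse have
        -- determinant 1, which is a combination of the three minors assumed to vanish.
        rows-independent : a * d + b * c ≡ 0# → a * f + e * c ≡ 0# → b * f + e * d ≡ 0# → ⊥
        rows-independent D≡0 E≡0 G≡0 with N⁻¹ · (1# ∷ 0# ∷ 0# ∷ []) | N⁻¹ · (0# ∷ 1# ∷ 0# ∷ [])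
                                        | N-inverseʳ (1# ∷ 0# ∷ 0# ∷ []) | N-inverseʳ (0# ∷ 1# ∷ 0# ∷ [])
        ... | x ∷ y ∷ z ∷ [] | x′ ∷ y′ ∷ z′ ∷ [] | eq | eq′ = 0≢1 (sym (begin
          1# ≡⟨ solve 1 (λ x → con true := con true :* con true :+ x :* con false) refl 0# ⟩
          1# * 1# + 0# * 0# ≡⟨ cong₂ _+_ (cong₂ _*_ (row₁ eq) (row₂ eq′)) (cong₂ _*_ (row₁ eq′) (row₂ eq)) ⟨
          (a * x + b * y + e * z) * (c * x′ + d * y′ + f * z′)
              + (a * x′ + b * y′ + e * z′) * (c * x + d * y + f * z)
            ≡⟨ solve 12 (λ a b e c d f x y z x′ y′ z′
                → (a :* x :+ b :* y :+ e :* z) :* (c :* x′ :+ d :* y′ :+ f :* z′)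
                :+ (a :* x′ :+ b :* y′ :+ e :* z′) :* (c :* x :+ d :* y :+ f :* z)
                := (a :* d :+ b :* c) :* (x :* y′ :+ y :* x′) :+ (a :* f :+ e :* c) :* (x :* z′ :+ z :* x′)
                :+ (b :* f :+ e :* d) :* (y :* z′ :+ z :* y′)) refl
                 a b e c d f x y z x′ y′ z′ ⟩
          (a * d + b * c) * (x * y′ + y * x′) + (a * f + e * c) * (x * z′ + z * x′)
              + (b * f + e * d) * (y * z′ + z * y′)
            ≡⟨ cong₂ _+_ (cong₂ (λ D E → D * (x * y′ + y * x′) + E * (x * z′ + z * x′)) D≡0 E≡0)
                (cong (_* _) G≡0) ⟩
          0# * (x * y′ + y * x′) + 0# * (x * z′ + z * x′) + 0# * (y * z′ + z * y′)
            ≡⟨ solve 3 (λ p q r → con false :* p :+ con false :* q :+ con false :* r := con false) refl _ _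
                _ ⟩
          0# ∎))
          where
          open ≡-Reasoning
          row₁ : ∀ {v v′ : Vec₃} → v ≡ v′ → Vec.head v ≡ Vec.head v′
          row₁ = cong Vec.head
          row₂ : ∀ {v v′ : Vec₃} → v ≡ v′ → Vec.head (Vec.tail v) ≡ Vec.head (Vec.tail v′)
          row₂ = cong (Vec.head ∘ Vec.tail)

        row₁≢0 : a ≡ 0# → b ≡ 0# → e ≡ 0# → ⊥
        row₁≢0 refl refl refl = rows-independent
          (solve 2 (λ x y → con false :* x :+ con false :* y := con false) refl d c)
              (solve 2 (λ x y → con false :* x :+ con false :* y := con false) refl f c)
              (solve 2 (λ x y → con false :* x :+ con false :* y := con false) refl f d)

        module _ (α β l : Carrier) (l≢0 : l ≢ 0#) where
          p q m : Carrier
          p = √ α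
          q = √ β
          m = √ (l ⁻¹)

          m²l≡1 : m * m * l ≡ 1#
          m²l≡1 = trans (cong (_* l) (√-square (l ⁻¹))) (*-inverseˡ l l≢0)

          m≢0 : m ≢ 0#
          m≢0 = √≢0 (⁻¹≢0 l l≢0)

          -- With x = s² and y = 1 the equation reads l z² = (p s² + s + q)², so that z is a
          -- polynomial in s. All points of the conic with y ≠ 0 arise in this way.
          pt : Carrier → Vec₃
          pt s = s * s ∷ 1# ∷ m * (p * (s * s) + s + q) ∷ []

          pt∈conic : ∀ s → Φ (F α β l) (pt s) ≡ 0#
          pt∈conic s = by₃ (s * s * (s * s)) 1# (p * (s * s) * (p * (s * s)) + s * s + q * q)
            (solve 7 (λ α β l m p q s → (α :* (s :* s :* (s :* s)) :+ s :* s :* con true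
                :+ β :* (con true :* con true)
                :+ l :* (m :* (p :* (s :* s) :+ s :+ q) :* (m :* (p :* (s :* s) :+ s :+ q)))) :+ con false
                := s :* s :* (s :* s) :* (p :* p :+ α) :+ con true :* (q :* q :+ β)
                :+ (p :* (s :* s) :* (p :* (s :* s)) :+ s :* s :+ q :* q) :* (m :* m :* l :+ con true)) refl
                α β l m p q s)
            (√-square α) (√-square β) m²l≡1

          pullback : Conic → Vec Carrier 5
          pullback c′ = quartic (Φ c′ (a ∷ c ∷ u ∷ [])) (Φ c′ (b ∷ d ∷ v ∷ [])) (Φ c′ (e ∷ f ∷ w ∷ []))
                                (a * d + b * c) (a * f + e * c) (b * f + e * d) m p q

          eval-pullback : ∀ c′ s → Φ c′ (N · pt s) ≡ eval (pullback c′) s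
          eval-pullback (F α′ β′ l′) s =
            trans (substitute α′ β′ l′ a b e c d f u v w (s * s) 1# (m * (p * (s * s) + s + q)))
                  (eval-quartic _ _ _ _ _ _ m p q s)

          -- The first coordinate of `N · pt s`, by coefficients in s. Parameters whose points go to
          -- the nucleus are among its roots, so there are at most two of them.
          row₁ : Vec Carrier 3
          row₁ = b + e * m * q ∷ e * m ∷ a + e * m * p ∷ []

          row₁≢zero : ¬ AllZero row₁
          row₁≢zero (eq₀ VecAll.∷ eq₁ VecAll.∷ eq₂ VecAll.∷ VecAll.[]) = row₁≢0
            (by₂ 1# (m * p) (solve 4 (λ a e m p → a :+ con false
                := con true :* ((a :+ e :* m :* p) :+ con false) :+ m :* p :* (e :+ con false)) refl a e m
                p) eq₂ e≡0)
            (by₂ 1# (m * q) (solve 4 (λ b e m q → b :+ con false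
                := con true :* ((b :+ e :* m :* q) :+ con false) :+ m :* q :* (e :+ con false)) refl b e m
                q) eq₀ e≡0)
            e≡0
            where
            e≡0 = *≡0⇒ʳ m≢0 (trans (*-comm m e) eq₁)

          polys : List Conic → List Poly
          polys Ds = (2 , row₁) ∷ map (λ c′ → 4 , pullback c′) Ds

          degree-polys : ∀ Ds → sum (map proj₁ (polys Ds)) ≡ 2 ℕ.+ length Ds ℕ.* 4
          degree-polys Ds = cong (2 ℕ.+_) (go Ds)
            where
            go : ∀ Ds → sum (map proj₁ (map (λ c′ → 4 , pullback c′) Ds)) ≡ length Ds ℕ.* 4
            go []       = refl
            go (_ ∷ Ds) = cong (4 ℕ.+_) (go Ds)

          -- The odd coefficients kill the minors E and G, so D ≠ 0 by independence of the rows.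
          -- From D e = a G + b E and D f = c G + d E follows e = f = 0. The middle coefficient then
          -- reads C m² = D, and the outer ones give the equations for α and β.
          zero⇒maps : ∀ {c′} → AllZero (pullback c′) →
                      e ≡ 0# × f ≡ 0# × a * d + b * c ≢ 0# × Maps (shear a b c d u v w) (F α β l) c′
          zero⇒maps {F α′ β′ l′} (z₀ VecAll.∷ z₁ VecAll.∷ z₂ VecAll.∷ z₃ VecAll.∷ z₄ VecAll.∷ VecAll.[]) =
            e≡0 , f≡0 , D≢0 , maps
              (by₃ α 1# (C * (m * m)) (solve 7
                  (λ A C D E m p α → D :* α :+ A
                  := α :* ((C :* (m :* m) :+ D) :+ con false)
                  :+ con true :* ((A :+ C :* (m :* m) :* (p :* p) :+ E :* m :* p) :+ E :* m :* p)
                  :+ C :* (m :* m) :* (p :* p :+ α)) refl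
                (Φ (F α′ β′ l′) (a ∷ c ∷ u ∷ [])) C D E m p α)
                eqD (trans z₄ (sym (trans (cong (λ E → E * m * p) E≡0)
                    (solve 2 (λ m p → con false :* m :* p := con false) refl m p)))) (√-square α))
              (by₃ β 1# (C * (m * m)) (solve 7
                  (λ B C D G m q β → D :* β :+ B
                  := β :* ((C :* (m :* m) :+ D) :+ con false)
                  :+ con true :* ((B :+ C :* (m :* m) :* (q :* q) :+ G :* m :* q) :+ G :* m :* q)
                  :+ C :* (m :* m) :* (q :* q :+ β)) refl
                (Φ (F α′ β′ l′) (b ∷ d ∷ v ∷ [])) C D G m q β)
                eqD (trans z₀ (sym (trans (cong (λ G → G * m * q) G≡0)
                    (solve 2 (λ m q → con false :* m :* q := con false) refl m q)))) (√-square β))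
              (by₃ l C 1# (solve 5 (λ C D l m k → D :* l :+ k
                  := l :* ((C :* (m :* m) :+ D) :+ con false) :+ C :* (m :* m :* l :+ con true)
                  :+ con true :* (C :+ k)) refl C D l m (w * w * l′))
                eqD m²l≡1 (trans (cong₂ (λ e f → α′ * (e * e) + e * f + β′ * (f * f) + l′ * (w * w)) e≡0
                    f≡0)
                  (solve 4 (λ α β l w → α :* (con false :* con false) :+ con false :* con false
                      :+ β :* (con false :* con false) :+ l :* (w :* w) := w :* w :* l) refl α′ β′ l′ w)))
            where
            C = Φ (F α′ β′ l′) (e ∷ f ∷ w ∷ [])
            D = a * d + b * c
            E = a * f + e * c
            G = b * f + e * d
            E≡0 : E ≡ 0#
            E≡0 = *≡0⇒ʳ m≢0 (trans (*-comm m E) z₃)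
            G≡0 : G ≡ 0#
            G≡0 = *≡0⇒ʳ m≢0 (trans (*-comm m G) z₁)
            D≢0 : D ≢ 0#
            D≢0 D≡0 = rows-independent D≡0 E≡0 G≡0
            eqD : C * (m * m) + D ≡ 0#
            eqD = by₃ 1# (m * q) (m * p) (solve 7
                (λ C D E G m p q → C :* (m :* m) :+ D :+ con false
                := con true :* ((C :* (m :* m) :+ D :+ E :* m :* q :+ G :* m :* p) :+ con false)
                :+ m :* q :* (E :+ con false) :+ m :* p :* (G :+ con false)) refl C D E G m p q)
              z₂ E≡0 G≡0
            e≡0 : e ≡ 0#
            e≡0 = *≡0⇒ʳ D≢0 (by₂ a b (solve 6
                (λ a b c d e f → (a :* d :+ b :* c) :* e :+ con false
                := a :* ((b :* f :+ e :* d) :+ con false) :+ b :* ((a :* f :+ e :* c) :+ con false)) refl a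
                b c d e f) G≡0 E≡0)
            f≡0 : f ≡ 0#
            f≡0 = *≡0⇒ʳ D≢0 (by₂ c d (solve 6
                (λ a b c d e f → (a :* d :+ b :* c) :* f :+ con false
                := c :* ((b :* f :+ e :* d) :+ con false) :+ d :* ((a :* f :+ e :* c) :+ con false)) refl a
                b c d e f) G≡0 E≡0)

          transfer′ : ∀ Ds {xs : List Carrier} → Unique xs → 2 ℕ.+ length Ds ℕ.* 4 < length xs →
            (∀ s → Nucleus (N · pt s) ⊎ Any (λ c′ → Φ c′ (N · pt s) ≡ 0#) Ds) →
            Image N (F α β l) Ds
          transfer′ Ds {xs} uxs bound covered with coverByRoots (polys Ds) uxs
            (All.universal cover _) (subst (_< length xs) (sym (degree-polys Ds)) bound)
            where
            cover : ∀ s → Any (λ (_ , r) → Root r s) (polys Ds)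
            cover s with covered s
            ... | inj₁ (eq , _) = here (trans (sym (eval-quadratic a b e m p q s)) eq)
            ... | inj₂ on       = there (Any.map⁺
                (Any.map (λ {c′} eq → trans (sym (eval-pullback c′ s)) eq) on))
          ... | here zs = ⊥-elim (row₁≢zero zs)
          ... | there any = result (Any.map zero⇒maps (Any.map⁻ any))
            where
            result : Any (λ c′ → e ≡ 0# × f
                ≡ 0# × a * d + b * c ≢ 0# × Maps (shear a b c d u v w) (F α β l) c′) Ds →
                     Image N (F α β l) Ds
            result any′ with Any.satisfied any′
            ... | _ , refl , refl , D≢0 , _ = image refl D≢0 (Any.map (λ (_ , _ , _ , m) → m) any′)

  -- A conic with 33 points in a union of conics is one of them: on the quadratic
  -- parametrisation of the given conic each of the other equations has degree 4,
  -- so that one of them has too many zeros.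
  transfer : ∀ N N⁻¹ → (∀ v → N · (N⁻¹ · v) ≡ v) → ∀ c → Conic.l c ≢ 0# →
    ∀ Ds {xs : List Carrier} → Unique xs → 2 ℕ.+ length Ds ℕ.* 4 < length xs →
    (∀ v → v ≢ 0ᵥ → Φ c v ≡ 0# → Nucleus (N · v) ⊎ Any (λ c′ → Φ c′ (N · v) ≡ 0#) Ds) →
    Image N c Ds
  transfer ((a ∷ b ∷ e ∷ []) ∷ (c ∷ d ∷ f ∷ []) ∷ (u ∷ v ∷ w ∷ []) ∷ []) N⁻¹ inv (F α β l) l≢0 Ds uxs bound
      covered =
    transfer′ a b e c d f u v w N⁻¹ inv α β l l≢0 Ds uxs bound
      (λ s → covered _ (λ eq → 0≢1 (sym (cong (Vec.head ∘ Vec.tail) eq)))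
          (pt∈conic a b e c d f u v w N⁻¹ inv α β l l≢0 s))

-- The three-dimensional space of parameters λ

Bits : Set
Bits = Bool × Bool × Bool

0ᵇ : Bits
0ᵇ = false , false , false

infixl 6 _⊞_
_⊞_ : Bits → Bits → Bits
(a , b , c) ⊞ (a′ , b′ , c′) = a xor a′ , b xor b′ , c xor c′

xor≡false : ∀ a b → a xor b ≡ false → a ≡ b
xor≡false false b     eq = sym eq
xor≡false true  true  eq = refl

⊞≡0⇒≡ : ∀ b b′ → b ⊞ b′ ≡ 0ᵇ → b ≡ b′
⊞≡0⇒≡ (a , b , c) (a′ , b′ , c′) eq = cong₂ _,_ (xor≡false a a′ (cong proj₁ eq))
  (cong₂ _,_ (xor≡false b b′ (cong (proj₁ ∘ proj₂) eq)) (xor≡false c c′ (cong (proj₂ ∘ proj₂) eq)))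

infix 4 _≟ᵇ_
_≟ᵇ_ : DecidableEquality Bits
_≟ᵇ_ = ≡-dec Bool._≟_ (≡-dec Bool._≟_ Bool._≟_)

nonzeroBits : List Bits
nonzeroBits =
  (true , false , false) ∷ (false , true , false) ∷ (true , true , false) ∷ (false , false , true) ∷
  (true , false , true) ∷ (false , true , true) ∷ (true , true , true) ∷ []

nonzeroBits-unique : Unique nonzeroBits
nonzeroBits-unique = from-yes (unique? _≟ᵇ_ nonzeroBits)

∈-nonzeroBits : ∀ b → b ≢ 0ᵇ → b ∈ nonzeroBits
∈-nonzeroBits (false , false , false) b≢0 = ⊥-elim (b≢0 refl)
∈-nonzeroBits (true  , false , false) _   = here refl
∈-nonzeroBits (false , true  , false) _   = there (here refl)
∈-nonzeroBits (true  , true  , false) _   = there (there (here refl))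
∈-nonzeroBits (false , false , true)  _   = there (there (there (here refl)))
∈-nonzeroBits (true  , false , true)  _   = there (there (there (there (here refl))))
∈-nonzeroBits (false , true  , true)  _   = there (there (there (there (there (here refl)))))
∈-nonzeroBits (true  , true  , true)  _   = there (there (there (there (there (there (here refl))))))

nonzeroBits-≢0 : All (_≢ 0ᵇ) nonzeroBits
nonzeroBits-≢0 = (λ ()) ∷ (λ ()) ∷ (λ ()) ∷ (λ ()) ∷ (λ ()) ∷ (λ ()) ∷ (λ ()) ∷ []

module Span {h : ℕ} (𝔽 : BinaryField h) (O : OddField 𝔽) where

  open BinaryField 𝔽
  open OddField O
  open OddFieldProperties 𝔽 O

  Carrier³ : Set
  Carrier³ = Carrier × Carrier × Carrier

  comb : Carrier³ → Bits → Carrier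
  comb (e₁ , e₂ , e₃) (a , b , c) = ⟦ a ⟧₂ * e₁ + ⟦ b ⟧₂ * e₂ + ⟦ c ⟧₂ * e₃

  comb-⊞ : ∀ e b b′ → comb e (b ⊞ b′) ≡ comb e b + comb e b′
  comb-⊞ (e₁ , e₂ , e₃) (a , b , c) (a′ , b′ , c′) = trans
    (cong₂ _+_ (cong₂ (λ s t → s * e₁ + t * e₂) (⟦⟧₂-+ a a′) (⟦⟧₂-+ b b′)) (cong (_* e₃) (⟦⟧₂-+ c c′)))
    (solve 9 (λ e₁ e₂ e₃ a b c a′ b′ c′ → (a :+ a′) :* e₁ :+ (b :+ b′) :* e₂ :+ (c :+ c′) :* e₃
        := (a :* e₁ :+ b :* e₂ :+ c :* e₃) :+ (a′ :* e₁ :+ b′ :* e₂ :+ c′ :* e₃)) refl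
      e₁ e₂ e₃ ⟦ a ⟧₂ ⟦ b ⟧₂ ⟦ c ⟧₂ ⟦ a′ ⟧₂ ⟦ b′ ⟧₂ ⟦ c′ ⟧₂)

  Independent : Carrier³ → Set
  Independent e = ∀ b → b ≢ 0ᵇ → comb e b ≢ 0#

  comb-injective : ∀ {e} → Independent e → ∀ {b b′} → comb e b ≡ comb e b′ → b ≡ b′
  comb-injective {e} ind {b} {b′} eq with (b ⊞ b′) ≟ᵇ 0ᵇ
  ... | yes b⊞b′≡0 = ⊞≡0⇒≡ b b′ b⊞b′≡0
  ... | no  b⊞b′≢0 = ⊥-elim (ind _ b⊞b′≢0 (trans (comb-⊞ e b b′) (≡⇒+≡0 eq)))

  comb-≢0 : ∀ {e b} → comb e b ≢ 0# → b ≢ 0ᵇ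
  comb-≢0 {e₁ , e₂ , e₃} b≢0 refl
      = b≢0 (solve 3 (λ x y z → con false :* x :+ con false :* y :+ con false :* z := con false) refl e₁ e₂
      e₃)

  span∖0 : Carrier³ → List Carrier
  span∖0 e = map (comb e) nonzeroBits

  span∖0⁺ : ∀ e (P : Pred Carrier 0ℓ) {b} → b ≢ 0ᵇ → P (comb e b) → Any P (span∖0 e)
  span∖0⁺ e P {b} b≢0 Px = Any.map⁺ {f = comb e}
      (Any.map (λ eq → subst (P ∘ comb e) eq Px) (∈-nonzeroBits b b≢0))

  span∖0-All : ∀ e (P : Pred Carrier 0ℓ) → (∀ {b} → b ≢ 0ᵇ → P (comb e b)) → All P (span∖0 e)
  span∖0-All e P f = All.map⁺ {f = comb e} (All.map f nonzeroBits-≢0)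

  span∖0-unique : ∀ {e} → Independent e → Unique (span∖0 e)
  span∖0-unique ind = Unique.map⁺ (comb-injective ind) nonzeroBits-unique

  -- The polarisation of the quadratic form Tr (x³) is Tr (ε x y).
  ε : Carrier → Carrier → Carrier
  ε x y = x * x * y + x * (y * y)

  Isotropic : Carrier³ → Set
  Isotropic e = ∀ b b′ → Tr (ε (comb e b) (comb e b′)) ≡ 0#

  -- The monomials of degree 1, 2 and 4 are additive and cancel; the constant occurs three times and
  -- survives; x³ polarises to `ε x y` and x⁶ to its square.
  cubes-product : ∀ l₀ l₁ l₂ m₀ m₁ m₂ x y →
    (l₀ + l₁ * x + l₂ * (x * (x * x))) * (m₀ + m₁ * x + m₂ * (x * (x * x)))
        + (l₀ + l₁ * y + l₂ * (y * (y * y))) * (m₀ + m₁ * y + m₂ * (y * (y * y)))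
        + (l₀ + l₁ * (x + y) + l₂ * ((x + y) * ((x + y) * (x + y)))) * (m₀ + m₁ * (x + y)
        + m₂ * ((x + y) * ((x + y) * (x + y)))) ≡
    l₀ * m₀ + ((l₀ * m₂ + l₂ * m₀) * (x * x * y + x * (y * y))
        + l₂ * m₂ * ((x * x * y + x * (y * y)) * (x * x * y + x * (y * y))))
  cubes-product = solve 8 (λ l₀ l₁ l₂ m₀ m₁ m₂ x y →
    (l₀ :+ l₁ :* x :+ l₂ :* (x :* (x :* x))) :* (m₀ :+ m₁ :* x :+ m₂ :* (x :* (x :* x)))
        :+ (l₀ :+ l₁ :* y :+ l₂ :* (y :* (y :* y))) :* (m₀ :+ m₁ :* y :+ m₂ :* (y :* (y :* y)))
        :+ (l₀ :+ l₁ :* (x :+ y) :+ l₂ :* ((x :+ y) :* ((x :+ y) :* (x :+ y)))) :* (m₀ :+ m₁ :* (x :+ y)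
        :+ m₂ :* ((x :+ y) :* ((x :+ y) :* (x :+ y)))) :=
    l₀ :* m₀ :+ ((l₀ :* m₂ :+ l₂ :* m₀) :* (x :* x :* y :+ x :* (y :* y))
        :+ l₂ :* m₂ :* ((x :* x :* y :+ x :* (y :* y)) :* (x :* x :* y :+ x :* (y :* y))))) refl

-- Counting points

module Cardinality {h : ℕ} (𝔽 : BinaryField h) where

  open BinaryField 𝔽
  open ProjectivePlane 𝔽

  card-cong : ∀ {P Q : Pred Point 0ℓ} {n} → (∀ p → Q p ⇔ P p) → HasCardinality P n → HasCardinality Q n
  card-cong eq (ps , len , u , mem) = ps , len , u , λ p → mem p ⇔-∘ eq p

  card-⊎ : ∀ {P Q : Pred Point 0ℓ} {m n} → HasCardinality P m → HasCardinality Q n →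
           (∀ p → P p → ¬ Q p) → HasCardinality (P ∪ Q) (m ℕ.+ n)
  card-⊎ (ps , refl , u , mem) (qs , refl , u′ , mem′) disjoint =
    ps ++ qs , length-++ ps ,
    SetoidUniqueProperties.++⁺ pointSetoid u u′ (λ {v} (v∈ps , v∈qs) →
      disjoint v (Equivalence.from (mem v) v∈ps) (Equivalence.from (mem′ v) v∈qs)) ,
    λ p → mk⇔
      (λ { (inj₁ x) → Any.++⁺ˡ (Equivalence.to (mem p) x) ; (inj₂ y)
          → Any.++⁺ʳ ps (Equivalence.to (mem′ p) y) })
      (λ p∈ → Sum.map (Equivalence.from (mem p)) (Equivalence.from (mem′ p)) (Any.++⁻ ps p∈))

  card-0 : ∀ {P : Pred Point 0ℓ} → (∀ p → ¬ P p) → HasCardinality P 0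
  card-0 ¬P = [] , refl , [] , λ p → mk⇔ (λ x → ⊥-elim (¬P p x)) (λ ())

  card-1 : ∀ {P : Pred Point 0ℓ} q → (∀ p → P p ⇔ p ≈ₚ q) → HasCardinality P 1
  card-1 q eq = q ∷ [] , refl , [] ∷ [] ,
    λ p → mk⇔ (λ x → here (Equivalence.to (eq p) x))
        (λ { (here e) → Equivalence.from (eq p) e ; (there ()) })

  card-⋃ : ∀ {I : Set} {P : I → Pred Point 0ℓ} {n : I → ℕ} {is} → Unique is →
           All (λ i → HasCardinality (P i) (n i)) is → (∀ {i j} p → i ≢ j → P i p → ¬ P j p) →
           HasCardinality (λ p → Any (λ i → P i p) is) (sum (map n is))
  card-⋃ []         []         disjoint = card-0 (λ _ ())
  card-⋃ (i∉ ∷ uis) (ci ∷ cis) disjoint = card-cong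
    (λ p → mk⇔ Any.toSum Any.fromSum)
    (card-⊎ ci (card-⋃ uis cis disjoint)
      (λ p pi → All.All¬⇒¬Any (All.map (λ i≢j → disjoint p i≢j pi) i∉)))

-- Isotropic parameter spaces give maximal arcs of degree 8

module CubicArcs {h : ℕ} (𝔽 : BinaryField h) (O : OddField 𝔽) where

  open BinaryField 𝔽
  open OddField O
  open OddFieldProperties 𝔽 O
  open ProjectivePlane 𝔽
  open MathonArcs 𝔽
  open Geometry 𝔽 O
  open Span 𝔽 O
  open Cardinality 𝔽

  cubic : Carrier → Conic
  cubic x = F (1# + x * (x * x)) 1# x

  -- The composition of `cubic x` and `cubic y` is `cubic (x + y)`, because x · x³ is additive. The
  -- three traces add up to 3 Tr 1 + Tr (ε x y), and Tr 1 = 1.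
  cubics-disjoint : ∀ {x y} → x ≢ y → Tr (ε x y) ≡ 0# → ∀ v → v ≢ 0ᵥ →
                    Φ (cubic x) v ≡ 0# → Φ (cubic y) v ≢ 0#
  cubics-disjoint {x} {y} x≢y iso = conics-disjoint x≢y
    (solve 2 (λ x y → (x :+ y) :* (con true :+ (x :+ y) :* ((x :+ y) :* (x :+ y)))
        := (con true :+ x :* (x :* x)) :* x :+ (con true :+ y :* (y :* y)) :* y) refl x y)
    (solve 2 (λ x y → (x :+ y) :* con true := con true :* x :+ con true :* y) refl x y)
    (begin
      Tr p + Tr q + Tr r                ≡⟨ Tr-+₃ p q r ⟨
      Tr (p + q + r)                    ≡⟨ cong Tr
          (solve 2 (λ x y → ((con true :+ x :* (x :* x)) :* con true
          :+ (con true :+ y :* (y :* y)) :* con true)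
          :+ (con true :+ (x :+ y) :* ((x :+ y) :* (x :+ y))) :* con true
          := con true :+ (x :* x :* y :+ x :* (y :* y))) refl x y) ⟩
      Tr (1# + ε x y)                   ≡⟨ Tr-+ 1# (ε x y) ⟩
      Tr 1# + Tr (ε x y)                ≡⟨ cong₂ _+_ Tr-1 iso ⟩
      1# + 0#                           ≡⟨ +-identityʳ 1# ⟩
      1#                                ∎)
    where
    open ≡-Reasoning
    p = (1# + x * (x * x)) * 1#
    q = (1# + y * (y * y)) * 1#
    r = (1# + (x + y) * ((x + y) * (x + y))) * 1#

  _≟0,0 : ∀ v → Dec (Nucleus v)
  (x ∷ y ∷ z ∷ []) ≟0,0 = (x ≟ 0#) ×-dec (y ≟ 0#)

  Φ-≈ : ∀ c p q → p ≈ₚ q → Φ c (coords q) ≡ 0# ⇔ Φ c (coords p) ≡ 0#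
  Φ-≈ c p q (k , k≢0 , refl) = mk⇔
    (λ eq → *≡0⇒ʳ (*≢0 k k k≢0 k≢0) (trans (sym (Φ-• c k (coords p))) eq))
    (λ eq → trans (Φ-• c k (coords p)) (trans (cong (k * k *_) eq) (zeroʳ _)))

  Nucleus-≈ : ∀ p q → p ≈ₚ q → Nucleus (coords p) → Nucleus (coords q)
  Nucleus-≈ (point (x ∷ y ∷ z ∷ []) _) q (k , k≢0 , refl) (refl , refl) = zeroʳ k , zeroʳ k

  module Arc (e : Carrier³) (independent : Independent e) (isotropic : Isotropic e) where

    InArc : Pred Point 0ℓ
    InArc p = Nucleus (coords p) ⊎ Any (λ x → Φ (cubic x) (coords p) ≡ 0#) (span∖0 e)

    arc : PointSet
    arc = record
      { _∋_       = InArc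
      ; respects  = λ {p} {q} p≈q → Sum.map (Nucleus-≈ p q p≈q)
          (Any.map (λ {x} → Equivalence.from (Φ-≈ (cubic x) p q p≈q)))
      ; decidable = λ p → (coords p ≟0,0) ⊎-dec Any.any? (λ x → Φ (cubic x) (coords p) ≟ 0#) (span∖0 e)
      }

    disjoint : ∀ {b b′} p → b ≢ b′ → Φ (cubic (comb e b)) (coords p) ≡ 0#
        → Φ (cubic (comb e b′)) (coords p) ≢ 0#
    disjoint {b} {b′} p b≢b′ = cubics-disjoint (b≢b′ ∘ comb-injective independent) (isotropic b b′)
        (coords p) (nonzero p)

    proportional : ∀ {a b x y} → ¬ (x ≡ 0# × y ≡ 0#) → ¬ (a ≡ 0# × b ≡ 0#) → a * x + b * y ≡ 0# →
                   ∃[ k ] k ≢ 0# × b ≡ k * x × a ≡ k * y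
    proportional {a} {b} {x} {y} xy≢0 ab≢0 eq with x ≟ 0#
    ... | no x≢0 = b * x ⁻¹ , *≢0 _ _ b≢0 (⁻¹≢0 x x≢0) ,
      by₁ b (solve 3 (λ b x i → b :+ b :* i :* x := b :* (x :* i :+ con true)) refl b x _) inv ,
      by₂ a (x ⁻¹) (solve 5 (λ a b x y i → a :+ b :* i :* y
          := a :* (x :* i :+ con true) :+ i :* ((a :* x :+ b :* y) :+ con false)) refl a b x y _) inv eq
      where
      inv = *-inverseʳ x x≢0
      b≢0 : b ≢ 0#
      b≢0 refl = ab≢0 (*≡0⇒ʳ x≢0 (trans (solve 3 (λ a x y → x :* a := a :* x :+ con false :* y) refl a x y)
          eq) , refl)
    ... | yes refl = a * y ⁻¹ , *≢0 _ _ a≢0 (⁻¹≢0 y y≢0) ,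
      trans b≡0 (sym (zeroʳ _)) ,
      by₁ a (solve 3 (λ a y i → a :+ a :* i :* y := a :* (y :* i :+ con true)) refl a y _)
          (*-inverseʳ y y≢0)
      where
      y≢0 : y ≢ 0#
      y≢0 y≡0 = xy≢0 (refl , y≡0)
      b≡0 : b ≡ 0#
      b≡0 = *≡0⇒ʳ y≢0 (trans (solve 3 (λ a b y → y :* b := a :* con false :+ b :* y) refl a b y) eq)
      a≢0 : a ≢ 0#
      a≢0 a≡0 = ab≢0 (a≡0 , b≡0)

    -- F₀ is the nucleus of all seven conics, so a line through it is tangent to each of them and
    -- carries 1 + 7 points.
    module LineThroughF₀ (a b : Carrier) (ab≢0 : ¬ (a ≡ 0# × b ≡ 0#)) where

      Q : Carrier → Carrier
      Q x = (1# + x * (x * x)) * (b * b) + b * a + 1# * (a * a)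

      pt : Carrier → Point
      pt x = point (b ∷ a ∷ √ (Q x * x ⁻¹) ∷ [])
                   (λ eq → ab≢0 (cong (Vec.head ∘ Vec.tail) eq , cong Vec.head eq))

      pt∈ : ∀ {x} → x ≢ 0# → Φ (cubic x) (coords (pt x)) ≡ 0#
      pt∈ {x} x≢0 = by₂ x (Q x) (solve 4
          (λ x i Q z → (Q :+ x :* (z :* z)) :+ con false
          := x :* (z :* z :+ Q :* i) :+ Q :* (x :* i :+ con true)) refl x _ (Q x) _)
        (√-square (Q x * x ⁻¹)) (*-inverseʳ x x≢0)

      line : Pred Point 0ℓ
      line p = (a ∷ b ∷ 0# ∷ []) ∙ coords p ≡ 0#

      pt∈line : ∀ x → line (pt x)
      pt∈line x = solve 3 (λ a b z → a :* b :+ b :* a :+ con false :* z := con false) refl a b _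

      line-≈ : ∀ p q → p ≈ₚ q → line q → line p
      line-≈ (point (x ∷ y ∷ z ∷ []) _) q (k , k≢0 , refl) eq = *≡0⇒ʳ k≢0
        (trans (solve 6 (λ a b k x y z → k :* (a :* x :+ b :* y :+ con false :* z)
            := a :* (k :* x) :+ b :* (k :* y) :+ con false :* (k :* z)) refl a b k x y z) eq)

      unique-point : ∀ x → x ≢ 0# → ∀ p → (Φ (cubic x) (coords p) ≡ 0# × line p) ⇔ p ≈ₚ pt x
      unique-point x x≢0 p@(point (px ∷ py ∷ pz ∷ []) p≢0) = mk⇔ to
        (λ p≈ → Equivalence.to (Φ-≈ (cubic x) p (pt x) p≈) (pt∈ x≢0) , line-≈ p (pt x) p≈ (pt∈line x))
        where
        to : Φ (cubic x) (px ∷ py ∷ pz ∷ []) ≡ 0# × line p → p ≈ₚ pt x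
        to (on , on-line) with proportional (λ nuc → F₀∉conic (cubic x) _ p≢0 nuc x≢0 on) ab≢0
          (trans (solve 5 (λ a b x y z → a :* x :+ b :* y := a :* x :+ b :* y :+ con false :* z) refl a b px
              py pz) on-line)
        ... | k , k≢0 , b≡ , a≡ = k , k≢0 , ∷³ b≡ a≡ (square-injective (*-cancelˡ x x≢0 (by₂ 1# (k * k)
          (solve 8 (λ x a b z k px py pz → x :* (z :* z) :+ x :* (k :* pz :* (k :* pz))
              := con true :* (((con true :+ x :* (x :* x)) :* (b :* b) :+ b :* a :+ con true :* (a :* a)
              :+ x :* (z :* z)) :+ ((con true :+ x :* (x :* x)) :* (b :* b) :+ b :* a
              :+ con true :* (a :* a) :+ (con true :+ x :* (x :* x)) :* (k :* px :* (k :* px))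
              :+ k :* px :* (k :* py) :+ con true :* (k :* py :* (k :* py))))
              :+ k :* k :* (((con true :+ x :* (x :* x)) :* (px :* px) :+ px :* py :+ con true :* (py :* py)
              :+ x :* (pz :* pz)) :+ con false)) refl
            x a b _ k px py pz)
          (trans (pt∈ x≢0) (sym (trans
            (cong₂ (λ b a → (1# + x * (x * x)) * (b * b) + b * a + 1# * (a * a)
                + (1# + x * (x * x)) * (k * px * (k * px)) + k * px * (k * py) + 1# * (k * py * (k * py)))
                b≡ a≡)
            (solve 3 (λ x p q → (con true :+ x :* (x :* x)) :* (p :* p) :+ p :* q :+ con true :* (q :* q)
                :+ (con true :+ x :* (x :* x)) :* (p :* p) :+ p :* q :+ con true :* (q :* q) := con false)
                refl x (k * px) (k * py)))))
          on)))

      card : HasCardinality (InArc ∩ line) 8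
      card = card-cong
        (λ p → mk⇔
          (λ { (inj₁ nuc , on) → inj₁ (Equivalence.from (≈F₀⇔Nucleus p) nuc)
             ; (inj₂ any , on) → inj₂ (Any.map (_, on) (Any.map⁻ any)) })
          (λ { (inj₁ p≈) → inj₁ (Equivalence.to (≈F₀⇔Nucleus p) p≈) , line-≈ p F₀ p≈
              (solve 2 (λ a b → a :* con false :+ b :* con false :+ con false :* con true := con false) refl
              a b)
             ; (inj₂ any) → inj₂ (Any.map⁺ (Any.map proj₁ any)) , proj₂ (proj₂ (Any.satisfied any)) }))
        (card-⊎ (card-1 F₀ (λ p → mk⇔ (λ x → x) (λ x → x)))
          (card-⋃ {P = λ b p → Φ (cubic (comb e b)) (coords p) ≡ 0# × line p} {n = λ _ → 1}
              nonzeroBits-unique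
            (All.map (λ {b} b≢0 → card-1 (pt (comb e b)) (unique-point (comb e b) (independent b b≢0)))
                nonzeroBits-≢0)
            (λ p b≢b′ (on , _) (on′ , _) → disjoint p b≢b′ on on′))
          (λ p p≈ any → let (b , b≢0 , on , _) = lookupWith p any in
             F₀∉conic (cubic (comb e b)) (coords p) (nonzero p) (Equivalence.to (≈F₀⇔Nucleus p) p≈)
                 (independent b b≢0) on))
        where
        lookupWith : ∀ p → Any (λ b → Φ (cubic (comb e b)) (coords p) ≡ 0# × line p) nonzeroBits →
                     ∃[ b ] b ≢ 0ᵇ × Φ (cubic (comb e b)) (coords p) ≡ 0# × line p
        lookupWith p any = _ , All.lookupAny nonzeroBits-≢0 any

    -- A conic meets such a line in 0 or 2 points, according to the trace `f` of the restricted
    -- binary form. By isotropy 1 + `f` is additive on the parameter space, so `f` is either 1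
    -- throughout or vanishes at exactly 4 of the 7 nonzero parameters. This gives 0 or 8 points.
    module LineMissingF₀ (a b c : Carrier) (c≢0 : c ≢ 0#) where

      line : Pred Point 0ℓ
      line p = (a ∷ b ∷ c ∷ []) ∙ coords p ≡ 0#

      u v : Carrier
      u = a * c ⁻¹
      v = b * c ⁻¹

      Line′ : Vec₃ → Set
      Line′ (x ∷ y ∷ z ∷ []) = z ≡ u * x + v * y

      line⇔ : ∀ p → line p ⇔ Line′ (coords p)
      line⇔ (point (x ∷ y ∷ z ∷ []) _) = mk⇔
        (λ eq → by₂ (c ⁻¹) z (solve 7 (λ a b c i x y z → z :+ (a :* i :* x :+ b :* i :* y)
            := i :* ((a :* x :+ b :* y :+ c :* z) :+ con false) :+ z :* (c :* i :+ con true)) refl a b c _ x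
            y z)
                  eq inv)
        (λ eq → by₂ c (a * x + b * y) (solve 7
            (λ a b c i x y z → (a :* x :+ b :* y :+ c :* z) :+ con false
            := c :* (z :+ (a :* i :* x :+ b :* i :* y)) :+ (a :* x :+ b :* y) :* (c :* i :+ con true)) refl
            a b c _ x y z)
                  eq inv)
        where inv = *-inverseʳ c c≢0

      -- The explicit factors `1#` and `0#` make these instances of `cubes-product`, with
      -- coefficients (1, u², 1) and (1, v², 0).
      α′ β′ f : Carrier → Carrier
      α′ x = 1# + u * u * x + 1# * (x * (x * x))
      β′ x = 1# + v * v * x + 0# * (x * (x * x))
      f x = Tr (α′ x * β′ x)

      restrict : ∀ x {px py pz} → Line′ (px ∷ py ∷ pz ∷ []) →
                 Φ (cubic x) (px ∷ py ∷ pz ∷ []) ≡ α′ x * (px * px) + px * py + β′ x * (py * py)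
      restrict x {px} {py} refl = solve 5
          (λ u v x p q → (con true :+ x :* (x :* x)) :* (p :* p) :+ p :* q :+ con true :* (q :* q)
          :+ x :* ((u :* p :+ v :* q) :* (u :* p :+ v :* q))
          := (con true :+ u :* u :* x :+ con true :* (x :* (x :* x))) :* (p :* p) :+ p :* q
          :+ (con true :+ v :* v :* x :+ con false :* (x :* (x :* x))) :* (q :* q)) refl u v x px py

      f-sum : ∀ x y → Tr (ε x y) ≡ 0# → f x + f y + f (x + y) ≡ 1#
      f-sum x y iso = begin
        f x + f y + f (x + y)
          ≡⟨ Tr-+₃ (α′ x * β′ x) (α′ y * β′ y) (α′ (x + y) * β′ (x + y)) ⟨
        Tr (α′ x * β′ x + α′ y * β′ y + α′ (x + y) * β′ (x + y))
          ≡⟨ cong Tr (cubes-product 1# (u * u) 1# 1# (v * v) 0# x y) ⟩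
        Tr (1# * 1# + ((1# * 0# + 1# * 1#) * ε x y + 1# * 0# * (ε x y * ε x y)))
          ≡⟨ cong Tr (solve 1 (λ e → con true :* con true
              :+ ((con true :* con false :+ con true :* con true) :* e :+ con true :* con false :* (e :* e))
              := con true :+ e) refl (ε x y)) ⟩
        Tr (1# + ε x y)            ≡⟨ Tr-+ 1# (ε x y) ⟩
        Tr 1# + Tr (ε x y)         ≡⟨ cong₂ _+_ Tr-1 iso ⟩
        1# + 0#                    ≡⟨ +-identityʳ 1# ⟩
        1#                         ∎
        where open ≡-Reasoning

      On : Carrier → Pred Point 0ℓ
      On x p = Φ (cubic x) (coords p) ≡ 0# × Line′ (coords p)

      no-points : ∀ x → f x ≡ 1# → HasCardinality (On x) 0
      no-points x f≡1 = card-0 λ { (point (px ∷ py ∷ pz ∷ []) p≢0) (on , on-line) →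
        let (px≡0 , py≡0) = anisotropic {α′ x} {β′ x} f≡1 (trans (sym (restrict x on-line)) on)
        in p≢0 (∷³ px≡0 py≡0 (trans on-line
            (trans (cong₂ (λ p q → u * p + v * q) px≡0 py≡0)
            (solve 2 (λ u v → u :* con false :+ v :* con false := con false) refl u v)))) }

      linePoint : ∀ r s → ¬ (r ≡ 0# × s ≡ 0#) → Point
      linePoint r s rs≢0 = point (s ∷ r ∷ u * s + v * r ∷ [])
        (λ eq → rs≢0 (cong (Vec.head ∘ Vec.tail) eq , cong Vec.head eq))

      ≈linePoint : ∀ r s rs≢0 p → (r * Vec.head (coords p) + s * Vec.head (Vec.tail (coords p))
          ≡ 0# × Line′ (coords p))
                   ⇔ p ≈ₚ linePoint r s rs≢0
      ≈linePoint r s rs≢0 (point (x ∷ y ∷ z ∷ []) p≢0) = mk⇔ to from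
        where
        to : r * x + s * y ≡ 0# × Line′ (x ∷ y ∷ z ∷ []) → point (x ∷ y ∷ z ∷ []) p≢0 ≈ₚ linePoint r s rs≢0
        to (eq , refl) with proportional
            (λ { (refl , refl) → p≢0 (cong (λ z → 0# ∷ 0# ∷ z ∷ [])
            (solve 2 (λ u v → u :* con false :+ v :* con false := con false) refl u v)) }) rs≢0 eq
        ... | k , k≢0 , refl , refl = k , k≢0 , ∷³ refl refl
            (solve 5 (λ u v k x y → u :* (k :* x) :+ v :* (k :* y) := k :* (u :* x :+ v :* y)) refl u v k x
            y)
        from : point (x ∷ y ∷ z ∷ []) p≢0 ≈ₚ linePoint r s rs≢0 → r * x + s * y
            ≡ 0# × Line′ (x ∷ y ∷ z ∷ [])
        from (k , k≢0 , eq) =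
          trans (cong₂ (λ r s → r * x + s * y) (cong (Vec.head ∘ Vec.tail) eq) (cong Vec.head eq))
              (solve 3 (λ k x y → k :* y :* x :+ k :* x :* y := con false) refl k x y) ,
          *-cancelˡ k k≢0 (trans (sym (cong (Vec.head ∘ Vec.tail ∘ Vec.tail) eq))
            (trans (cong₂ (λ r s → u * s + v * r) (cong (Vec.head ∘ Vec.tail) eq) (cong Vec.head eq))
              (solve 5 (λ u v k x y → u :* (k :* x) :+ v :* (k :* y) := k :* (u :* x :+ v :* y)) refl u v k
                  x y)))

      two-points : ∀ x κ r s r′ s′ → κ ≢ 0# → r * s′ + r′ * s ≢ 0# →
        (∀ px py → κ * (α′ x * (px * px) + px * py + β′ x * (py * py))
            ≡ (r * px + s * py) * (r′ * px + s′ * py)) →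
        HasCardinality (On x) 2
      two-points x κ r s r′ s′ κ≢0 Δ≢0 factor = card-cong on⇔
        (card-⊎ (card-1 (linePoint r s rs≢0) (≈linePoint r s rs≢0))
            (card-1 (linePoint r′ s′ rs′≢0) (≈linePoint r′ s′ rs′≢0)) apart)
        where
        rs≢0 : ¬ (r ≡ 0# × s ≡ 0#)
        rs≢0 (refl , refl) = Δ≢0 (solve 2 (λ p q → con false :* p :+ q :* con false := con false) refl s′
            r′)
        rs′≢0 : ¬ (r′ ≡ 0# × s′ ≡ 0#)
        rs′≢0 (refl , refl) = Δ≢0 (solve 2 (λ p q → p :* con false :+ con false :* q := con false) refl r s)
        L L′ : Pred Point 0ℓ
        L p = r * Vec.head (coords p) + s * Vec.head (Vec.tail (coords p)) ≡ 0# × Line′ (coords p)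
        L′ p = r′ * Vec.head (coords p) + s′ * Vec.head (Vec.tail (coords p)) ≡ 0# × Line′ (coords p)
        apart : ∀ p → L p → ¬ L′ p
        apart (point (px ∷ py ∷ pz ∷ []) p≢0) (eq , refl) (eq′ , _) = p≢0 (∷³ px≡0 py≡0
          (trans (cong₂ (λ p q → u * p + v * q) px≡0 py≡0)
              (solve 2 (λ u v → u :* con false :+ v :* con false := con false) refl u v)))
          where
          px≡0 = *≡0⇒ʳ Δ≢0 (by₂ s′ s (solve 6
              (λ r s r′ s′ p q → (r :* s′ :+ r′ :* s) :* p :+ con false
              := s′ :* ((r :* p :+ s :* q) :+ con false) :+ s :* ((r′ :* p :+ s′ :* q) :+ con false)) refl r
              s r′ s′ px py) eq eq′)
          py≡0 = *≡0⇒ʳ Δ≢0 (by₂ r′ r (solve 6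
              (λ r s r′ s′ p q → (r :* s′ :+ r′ :* s) :* q :+ con false
              := r′ :* ((r :* p :+ s :* q) :+ con false) :+ r :* ((r′ :* p :+ s′ :* q) :+ con false)) refl r
              s r′ s′ px py) eq eq′)
        on⇔ : ∀ p → On x p ⇔ (L p ⊎ L′ p)
        on⇔ (point (px ∷ py ∷ pz ∷ []) p≢0) = mk⇔ to from
          where
          to : On x (point (px ∷ py ∷ pz ∷ []) p≢0) → L (point (px ∷ py ∷ pz ∷ []) p≢0)
              ⊎ L′ (point (px ∷ py ∷ pz ∷ []) p≢0)
          to (on , on-line) with (r * px + s * py) ≟ 0#
          ... | yes eq = inj₁ (eq , on-line)
          ... | no  ≢0 = inj₂ (*≡0⇒ʳ ≢0 (trans (sym (factor px py))
            (trans (cong (κ *_) (trans (sym (restrict x on-line)) on)) (zeroʳ κ))) , on-line)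
          from : L (point (px ∷ py ∷ pz ∷ []) p≢0) ⊎ L′ (point (px ∷ py ∷ pz ∷ []) p≢0)
              → On x (point (px ∷ py ∷ pz ∷ []) p≢0)
          from (inj₁ (eq , on-line)) = trans (restrict x on-line) (*≡0⇒ʳ κ≢0 (trans (factor px py)
            (trans (cong (_* (r′ * px + s′ * py)) eq) (zeroˡ _)))) , on-line
          from (inj₂ (eq , on-line)) = trans (restrict x on-line) (*≡0⇒ʳ κ≢0 (trans (factor px py)
            (trans (cong ((r * px + s * py) *_) eq) (zeroʳ _)))) , on-line

      -- With w² + w = α′β′, α′ times the restricted form splits as (α′X + wY)(α′X + (w + 1)Y). For
      -- α′ = 0 the form itself is Y(X + β′Y).
      points : ∀ x → f x ≡ 0# → HasCardinality (On x) 2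
      points x f≡0 with α′ x ≟ 0# | artinSchreier (α′ x * β′ x) f≡0
      ... | yes α≡0 | _ = two-points x 1# 0# 1# 1# (β′ x) (0≢1 ∘ sym)
        (λ eq → 0≢1 (sym (trans (solve 1 (λ b → con true := con false :* b :+ con true :* con true) refl
            (β′ x)) eq)))
        (λ p q → by₁ (p * p) (solve 4 (λ α β p q
            → con true :* (α :* (p :* p) :+ p :* q :+ β :* (q :* q))
            :+ (con false :* p :+ con true :* q) :* (con true :* p :+ β :* q) := p :* p :* (α :+ con false))
            refl
                   (α′ x) (β′ x) p q) α≡0)
      ... | no α≢0 | w , w²+w = two-points x (α′ x) (α′ x) w (α′ x) (w + 1#) α≢0
        (λ eq → α≢0 (trans (solve 2 (λ α w → α := α :* (w :+ con true) :+ α :* w) refl (α′ x) w) eq))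
        (λ p q → by₁ (q * q) (solve 5 (λ α β w p q
            → α :* (α :* (p :* p) :+ p :* q :+ β :* (q :* q))
            :+ (α :* p :+ w :* q) :* (α :* p :+ (w :+ con true) :* q) := q :* q :* (w :* w :+ w :+ α :* β))
            refl
                   (α′ x) (β′ x) w p q) w²+w)

      ν : Bool → ℕ
      ν true  = 0
      ν false = 2

      card-On : ∀ t x → f x ≡ ⟦ t ⟧₂ → HasCardinality (On x) (ν t)
      card-On true  = no-points
      card-On false = points

      bit : ∀ x → ∃[ t ] f x ≡ ⟦ t ⟧₂
      bit x with Tr-0⊎1 (α′ x * β′ x)
      ... | inj₁ eq = false , eq
      ... | inj₂ eq = true  , eq

      affine : ∀ {b b′ t t′} → f (comb e b) ≡ ⟦ t ⟧₂ → f (comb e b′) ≡ ⟦ t′ ⟧₂ →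
               f (comb e (b ⊞ b′)) ≡ ⟦ not (t xor t′) ⟧₂
      affine {b} {b′} {t} {t′} eq eq′ = begin
        f (comb e (b ⊞ b′))      ≡⟨ cong f (comb-⊞ e b b′) ⟩
        f (comb e b + comb e b′) ≡⟨ by₁ 1#
            (solve 3 (λ p q r → r :+ (con true :+ (p :+ q)) := con true :* ((p :+ q :+ r) :+ con true)) refl
            (f (comb e b)) (f (comb e b′)) (f (comb e b + comb e b′)))
                                      (f-sum (comb e b) (comb e b′) (isotropic b b′)) ⟩
        1# + (f (comb e b) + f (comb e b′)) ≡⟨ cong (1# +_) (cong₂ _+_ eq eq′) ⟩
        1# + (⟦ t ⟧₂ + ⟦ t′ ⟧₂)  ≡⟨ cong (1# +_) (⟦⟧₂-+ t t′) ⟨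
        1# + ⟦ t xor t′ ⟧₂       ≡⟨ ⟦⟧₂-+ true (t xor t′) ⟨
        ⟦ not (t xor t′) ⟧₂      ∎
        where open ≡-Reasoning

      -- The affine extension of the three basis values with value 1 at the zero vector, which
      -- `affine` forces upon the values of `f`.
      traces : Bool → Bool → Bool → Bits → Bool
      traces t₁ t₂ t₃ (false , false , false) = true
      traces t₁ t₂ t₃ (true  , false , false) = t₁
      traces t₁ t₂ t₃ (false , true  , false) = t₂
      traces t₁ t₂ t₃ (true  , true  , false) = not (t₁ xor t₂)
      traces t₁ t₂ t₃ (false , false , true)  = t₃
      traces t₁ t₂ t₃ (true  , false , true)  = not (t₁ xor t₃)
      traces t₁ t₂ t₃ (false , true  , true)  = not (t₂ xor t₃)
      traces t₁ t₂ t₃ (true  , true  , true)  = not (not (t₁ xor t₂) xor t₃)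

      total : ∀ t₁ t₂ t₃ → sum (map (ν ∘ traces t₁ t₂ t₃) nonzeroBits) ≡ 0 ⊎
                           sum (map (ν ∘ traces t₁ t₂ t₃) nonzeroBits) ≡ 8
      total true  true  true  = inj₁ refl
      total true  true  false = inj₂ refl
      total true  false true  = inj₂ refl
      total true  false false = inj₂ refl
      total false true  true  = inj₂ refl
      total false true  false = inj₂ refl
      total false false true  = inj₂ refl
      total false false false = inj₂ refl

      card : HasCardinality (InArc ∩ line) 0 ⊎ HasCardinality (InArc ∩ line) 8
      card with bit (comb e (true , false , false)) | bit (comb e (false , true , false)) | bit
          (comb e (false , false , true))
      ... | t₁ , eq₁ | t₂ , eq₂ | t₃ , eq₃ =
        Sum.map (λ eq → subst (HasCardinality (InArc ∩ line)) eq counted)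
            (λ eq → subst (HasCardinality (InArc ∩ line)) eq counted) (total t₁ t₂ t₃)
        where
        eq₁₂ : f (comb e (true , true , false)) ≡ ⟦ not (t₁ xor t₂) ⟧₂
        eq₁₂ = affine {true , false , false} {false , true , false} {t₁} {t₂} eq₁ eq₂
        cards : All (λ b → HasCardinality (On (comb e b)) (ν (traces t₁ t₂ t₃ b))) nonzeroBits
        cards =
          card-On t₁ _ eq₁ ∷ card-On t₂ _ eq₂ ∷
          card-On _ _ eq₁₂ ∷
          card-On t₃ _ eq₃ ∷
          card-On _ _ (affine {true , false , false} {false , false , true} {t₁} {t₃} eq₁ eq₃) ∷
          card-On _ _ (affine {false , true , false} {false , false , true} {t₂} {t₃} eq₂ eq₃) ∷
          card-On _ _ (affine {true , true , false} {false , false , true} {not (t₁ xor t₂)} {t₃} eq₁₂ eq₃)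
              ∷ []
        counted : HasCardinality (InArc ∩ line) (sum (map (ν ∘ traces t₁ t₂ t₃) nonzeroBits))
        counted = card-cong
          (λ p → mk⇔
            (λ { (inj₁ nuc , on) → ⊥-elim (F₀∉line p nuc on)
               ; (inj₂ any , on) → Any.map (_, Equivalence.to (line⇔ p) on) (Any.map⁻ any) })
            (λ any → inj₂ (Any.map⁺ (Any.map proj₁ any)) , Equivalence.from (line⇔ p)
                (proj₂ (proj₂ (Any.satisfied any)))))
          (card-⋃ {P = λ b p → On (comb e b) p} nonzeroBits-unique cards
            (λ p b≢b′ (on , _) (on′ , _) → disjoint p b≢b′ on on′))
          where
          F₀∉line : ∀ p → Nucleus (coords p) → ¬ line p
          F₀∉line (point (x ∷ y ∷ z ∷ []) p≢0) (refl , refl) on = p≢0 (cong (λ z → 0# ∷ 0# ∷ z ∷ [])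
            (*≡0⇒ʳ c≢0 (trans (solve 4 (λ a b c z → c :* z := a :* con false :+ b :* con false :+ c :* z)
                refl a b c z) on)))

    meets-lines : ∀ ℓ → HasCardinality (InArc ∩ OnLine ℓ) 0 ⊎ HasCardinality (InArc ∩ OnLine ℓ) 8
    meets-lines (point (a ∷ b ∷ c ∷ []) ℓ≢0) with c ≟ 0#
    ... | yes refl = inj₂ (LineThroughF₀.card a b (λ { (refl , refl) → ℓ≢0 refl }))
    ... | no  c≢0  = LineMissingF₀.card a b c c≢0

    maximalArc : IsMaximalArc 8 arc
    maximalArc = (F₀ , inj₁ (refl , refl)) ,
      -- At (0, 1, 0) each of the forms takes the value β = 1.
      (point (0# ∷ 1# ∷ 0# ∷ []) (λ eq → 0≢1 (sym (cong (Vec.head ∘ Vec.tail) eq))) ,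
       λ { (inj₁ (_ , eq)) → 0≢1 (sym eq)
         ; (inj₂ any) → let (x , on) = Any.satisfied any in
             0≢1 (sym (trans (solve 1 (λ x → con true
                 := (con true :+ x :* (x :* x)) :* (con false :* con false) :+ con false :* con true
                 :+ con true :* (con true :* con true) :+ x :* (con false :* con false)) refl x) on)) }) ,
      meets-lines

-- Field automorphisms acting on conics

module Semilinear {h : ℕ} (𝔽 : BinaryField h) (O : OddField 𝔽) where

  open BinaryField 𝔽
  open OddField O
  open OddFieldProperties 𝔽 O
  open ProjectivePlane 𝔽
  open MathonArcs 𝔽
  open Geometry 𝔽 O
  open CubicArcs 𝔽 O
  open Span 𝔽 O

  module _ (s : FieldAutomorphism) where

    open FieldAutomorphism s using () renaming (to to σ; isRingIsomorphism to iso)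
    open IsRingIsomorphism iso using (+-homo; *-homo; 0#-homo; 1#-homo; injective; surjective)

    σ-square : ∀ a x → σ (a * (x * x)) ≡ σ a * (σ x * σ x)
    σ-square a x = trans (*-homo a (x * x)) (cong (σ a *_) (*-homo x x))

    σ-Φ : ∀ α β l v → σ (Φ (F α β l) v) ≡ Φ (F (σ α) (σ β) (σ l)) (Vec.map σ v)
    σ-Φ α β l (x ∷ y ∷ z ∷ []) = begin
      σ (α * (x * x) + x * y + β * (y * y) + l * (z * z))
        ≡⟨ +-homo (α * (x * x) + x * y + β * (y * y)) (l * (z * z)) ⟩
      σ (α * (x * x) + x * y + β * (y * y)) + σ (l * (z * z))
        ≡⟨ cong₂ _+_ (+-homo (α * (x * x) + x * y) (β * (y * y))) (σ-square l z) ⟩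
      σ (α * (x * x) + x * y) + σ (β * (y * y)) + σ l * (σ z * σ z)
        ≡⟨ cong (_+ σ l * (σ z * σ z)) (cong₂ _+_ (+-homo (α * (x * x)) (x * y)) (σ-square β y)) ⟩
      σ (α * (x * x)) + σ (x * y) + σ β * (σ y * σ y) + σ l * (σ z * σ z)
        ≡⟨ cong (λ t → t + σ β * (σ y * σ y) + σ l * (σ z * σ z)) (cong₂ _+_ (σ-square α x) (*-homo x y)) ⟩
      σ α * (σ x * σ x) + σ x * σ y + σ β * (σ y * σ y) + σ l * (σ z * σ z) ∎
      where open ≡-Reasoning

    -- The coefficients of `cubic x` are polynomials in x over GF(2), so that σ acts on the
    -- parameter alone.
    σ-cubic : ∀ x v → σ (Φ (cubic x) v) ≡ Φ (cubic (σ x)) (Vec.map σ v)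
    σ-cubic x v = trans (σ-Φ (1# + x * (x * x)) 1# x v) (cong₂ (λ α β → Φ (F α β (σ x)) (Vec.map σ v))
      (trans (+-homo 1# (x * (x * x))) (cong₂ _+_ 1#-homo (σ-square x x))) 1#-homo)

    σ-≢0 : ∀ {x} → x ≢ 0# → σ x ≢ 0#
    σ-≢0 x≢0 eq = x≢0 (injective (trans eq (sym 0#-homo)))

    σ-surjective : (w : Vec₃) → ∃[ v ] Vec.map σ v ≡ w
    σ-surjective (x ∷ y ∷ z ∷ []) with surjective x | surjective y | surjective z
    ... | x′ , x≡ | y′ , y≡ | z′ , z≡ = x′ ∷ y′ ∷ z′ ∷ [] , ∷³ (x≡ refl) (y≡ refl) (z≡ refl)

    σ-⟦⟧₂ : ∀ b → σ ⟦ b ⟧₂ ≡ ⟦ b ⟧₂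
    σ-⟦⟧₂ false = 0#-homo
    σ-⟦⟧₂ true  = 1#-homo

    σ-comb : ∀ x y z b → σ (comb (x , y , z) b) ≡ comb (σ x , σ y , σ z) b
    σ-comb x y z (a , b , c) = begin
      σ (⟦ a ⟧₂ * x + ⟦ b ⟧₂ * y + ⟦ c ⟧₂ * z)           ≡⟨ +-homo _ _ ⟩
      σ (⟦ a ⟧₂ * x + ⟦ b ⟧₂ * y) + σ (⟦ c ⟧₂ * z)       ≡⟨ cong₂ _+_ (+-homo _ _) (scaled c z) ⟩
      σ (⟦ a ⟧₂ * x) + σ (⟦ b ⟧₂ * y)
          + ⟦ c ⟧₂ * σ z     ≡⟨ cong (_+ ⟦ c ⟧₂ * σ z) (cong₂ _+_ (scaled a x) (scaled b y)) ⟩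
      ⟦ a ⟧₂ * σ x + ⟦ b ⟧₂ * σ y + ⟦ c ⟧₂ * σ z         ∎
      where
      open ≡-Reasoning
      scaled : ∀ b x → σ (⟦ b ⟧₂ * x) ≡ ⟦ b ⟧₂ * σ x
      scaled b x = trans (*-homo ⟦ b ⟧₂ x) (cong (_* σ x) (σ-⟦⟧₂ b))

    σ-∙ : ∀ r v → σ (r ∙ v) ≡ Vec.map σ r ∙ Vec.map σ v
    σ-∙ (a ∷ b ∷ c ∷ []) (x ∷ y ∷ z ∷ []) = trans (+-homo (a * x + b * y) (c * z))
      (cong₂ _+_ (trans (+-homo (a * x) (b * y)) (cong₂ _+_ (*-homo a x) (*-homo b y))) (*-homo c z))

    σ-matrix : Matrix → Matrix
    σ-matrix = Vec.map (Vec.map σ)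

    σ-· : ∀ M v → σ-matrix M · Vec.map σ v ≡ Vec.map σ (M · v)
    σ-· (r ∷ s ∷ t ∷ []) v = ∷³ (sym (σ-∙ r v)) (sym (σ-∙ s v)) (sym (σ-∙ t v))

    σ-inverse : ∀ M N → (∀ v → N · (M · v) ≡ v) → ∀ w → σ-matrix N · (σ-matrix M · w) ≡ w
    σ-inverse M N inv w = let (v , σv≡w) = σ-surjective w in
      subst (λ w → σ-matrix N · (σ-matrix M · w) ≡ w) σv≡w
        (trans (cong (σ-matrix N ·_) (σ-· M v)) (trans (σ-· N (M · v)) (cong (Vec.map σ) (inv v))))

    σ-GL : GL₃ → GL₃
    σ-GL g = record
      { matrix = σ-matrix matrix ; inverse = σ-matrix inverse
      ; inverseˡ = σ-inverse matrix inverse inverseˡ ; inverseʳ = σ-inverse inverse matrix inverseʳ }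
      where open GL₃ g

    σ-Nucleus : ∀ v → Nucleus v ⇔ Nucleus (Vec.map σ v)
    σ-Nucleus (x ∷ y ∷ z ∷ []) = mk⇔ (λ { (refl , refl) → 0#-homo , 0#-homo })
      (λ (x≡0 , y≡0) → injective (trans x≡0 (sym 0#-homo)) , injective (trans y≡0 (sym 0#-homo)))

    σ-on-cubic : ∀ x v → (Φ (cubic x) v ≡ 0#) ⇔ (Φ (cubic (σ x)) (Vec.map σ v) ≡ 0#)
    σ-on-cubic x v = mk⇔ (λ eq → trans (sym (σ-cubic x v)) (trans (cong σ eq) 0#-homo))
                         (λ eq → injective (trans (trans (σ-cubic x v) eq) (sym 0#-homo)))

  frobenius : ℕ → FieldAutomorphism
  frobenius k = record
    { to = power k
    ; isRingIsomorphism = record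
      { isRingMonomorphism = record
        { isRingHomomorphism = record
          { isSemiringHomomorphism = record
            { isNearSemiringHomomorphism = record
              { +-isMonoidHomomorphism = record
                { isMagmaHomomorphism = record
                  { isRelHomomorphism = record { cong = cong (power k) }
                  ; homo = power-+ k }
                ; ε-homo = power-idempotent k (zeroˡ 0#) }
              ; *-homo = power-* k }
            ; 1#-homo = power-idempotent k (*-identityˡ 1#) }
          ; -‿homo = λ x → trans (cong (power k) (-‿identity x)) (sym (-‿identity _)) }
        ; injective = power-injective k }
      ; surjective = λ y → let (x , eq) = power-surjective k y in x , λ { refl → eq } } }
    where
    power : ℕ → Carrier → Carrier
    power zero    x = x
    power (suc k) x = power k (x * x)
    power-+ : ∀ k x y → power k (x + y) ≡ power k x + power k y
    power-+ zero    x y = refl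
    power-+ (suc k) x y = trans (cong (power k)
        (solve 2 (λ x y → (x :+ y) :* (x :+ y) := x :* x :+ y :* y) refl x y)) (power-+ k (x * x) (y * y))
    power-* : ∀ k x y → power k (x * y) ≡ power k x * power k y
    power-* zero    x y = refl
    power-* (suc k) x y = trans (cong (power k)
        (solve 2 (λ x y → (x :* y) :* (x :* y) := x :* x :* (y :* y)) refl x y)) (power-* k (x * x) (y * y))
    power-idempotent : ∀ k {x} → x * x ≡ x → power k x ≡ x
    power-idempotent zero    eq = refl
    power-idempotent (suc k) eq = trans (cong (power k) eq) (power-idempotent k eq)
    power-injective : ∀ k {x y} → power k x ≡ power k y → x ≡ y
    power-injective zero    eq = eq
    power-injective (suc k) eq = square-injective (power-injective k eq)
    power-surjective : ∀ k y → ∃[ x ] power k x ≡ y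
    power-surjective zero    y = y , refl
    power-surjective (suc k) y = let (x , eq) = power-surjective k y in √ x , trans (cong (power k) (√-square x)) eq

-- Rigidity: collineations between arcs, and the exclusion of Denniston type

module Rigidity {h : ℕ} (𝔽 : BinaryField h) (O : OddField 𝔽)
  (elements : List (BinaryField.Carrier 𝔽)) (elements-unique : Unique elements)
  -- 30 = 2 + 7 · 4 is the bound that `transfer` requires for seven target conics.
  (30<elements : 30 < length elements) where

  open BinaryField 𝔽
  open OddField O
  open OddFieldProperties 𝔽 O
  open Polynomials 𝔽 O
  open ProjectivePlane 𝔽
  open MathonArcs 𝔽
  open Geometry 𝔽 O
  open Transfer 𝔽 O
  open Span 𝔽 O
  open CubicArcs 𝔽 O
  open Semilinear 𝔽 O

  inverseGL : GL₃ → GL₃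
  inverseGL g = record { matrix = inverse ; inverse = matrix ; inverseˡ = inverseʳ ; inverseʳ = inverseˡ }
    where open GL₃ g

  projectivity-injective : ∀ g p q → projectivity g p ≈ₚ projectivity g q → p ≈ₚ q
  projectivity-injective g p q (k , k≢0 , eq) = k , k≢0 , (begin
    coords q                              ≡⟨ inverseˡ (coords q) ⟨
    inverse · (matrix · coords q)         ≡⟨ cong (inverse ·_) eq ⟩
    inverse · (k • (matrix · coords p))   ≡⟨ ·-• inverse k _ ⟩
    k • (inverse · (matrix · coords p))   ≡⟨ cong (k •_) (inverseˡ (coords p)) ⟩
    k • coords p                          ∎)
    where
    open GL₃ g
    open ≡-Reasoning

  -- Expanded in x the equation is r²x³ + t²x + (r² + rs + s² + K) = 0. With four roots this cubic
  -- is zero, and its leading coefficient gives r = 0.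
  column : ∀ K r s t {xs} → Unique xs → 4 ≤ length xs →
           All (λ x → K ≡ Φ (cubic x) (r ∷ s ∷ t ∷ [])) xs → r ≡ 0# × K ≡ s * s
  column K r s t uxs bound eqs = conclude (roots⇒zero coefficients uxs (All.map root eqs) bound)
    where
    coefficients : Vec Carrier 4
    coefficients = r * r + r * s + s * s + K ∷ t * t ∷ 0# ∷ r * r ∷ []
    root : ∀ {x} → K ≡ Φ (cubic x) (r ∷ s ∷ t ∷ []) → Root coefficients x
    root {x} eq = by₁ 1# (solve 5 (λ K r s t x
        → ((r :* r :+ r :* s :+ s :* s :+ K)
        :+ x :* (t :* t :+ x :* (con false :+ x :* (r :* r :+ x :* con false)))) :+ con false
        := con true :* (K :+ ((con true :+ x :* (x :* x)) :* (r :* r) :+ r :* s :+ con true :* (s :* s)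
        :+ x :* (t :* t)))) refl K r s t x) eq
    conclude : AllZero coefficients → r ≡ 0# × K ≡ s * s
    conclude (eq₀ VecAll.∷ _ VecAll.∷ _ VecAll.∷ eq₃ VecAll.∷ VecAll.[]) = r≡0 ,
      by₂ 1# (r + s) (solve 3 (λ K r s → K :+ s :* s
          := con true :* ((r :* r :+ r :* s :+ s :* s :+ K) :+ con false) :+ (r :+ s) :* (r :+ con false))
          refl K r s) eq₀ r≡0
      where
      r≡0 : r ≡ 0#
      r≡0 = square≡0 eq₃

  module _ (e : Carrier³) (independent : Independent e) (isotropic : Isotropic e) where

    open Arc e independent isotropic

    ∋-transfer : ∀ N N⁻¹ → (∀ v → N · (N⁻¹ · v) ≡ v) → ∀ c → Conic.l c ≢ 0# →
      (∀ v → v ≢ 0ᵥ → Φ c v ≡ 0# → Nucleus (N · v) ⊎ Any (λ x → Φ (cubic x) (N · v) ≡ 0#) (span∖0 e)) →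
      N ≡ matrixOf (shearOf N) × det (shearOf N) ≢ 0# ×
      Any (λ b → Maps (shearOf N) c (cubic (comb e b))) nonzeroBits
    ∋-transfer N N⁻¹ inv c l≢0 covered
        = isShear , det≢0 , Any.map⁻ {f = comb e} (Any.map⁻ {f = cubic} target)
      where
      open Image (transfer N N⁻¹ inv c l≢0 (map cubic (span∖0 e)) elements-unique 30<elements
        (λ v v≢0 on → Sum.map₂ Any.map⁺ (covered v v≢0 on)))

    module _ (a : Carrier) (A : Pred Carrier 0ℓ) (g : GL₃)
             (eq : ∀ p → InArc p ⇔ ConicUnion (DennistonConics a A) (projectivity g p)) where

      open GL₃ g

      pencil-conic : ∀ l → A l → l ≢ 0# →
        inverse ≡ matrixOf (shearOf inverse) × det (shearOf inverse) ≢ 0# ×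
        Any (λ b → Maps (shearOf inverse) (F a 1# l) (cubic (comb e b))) nonzeroBits
      pencil-conic l Al l≢0 = ∋-transfer inverse matrix inverseˡ (F a 1# l) l≢0
        (λ v v≢0 on → Equivalence.from (eq (projectivity (inverseGL g) (point v v≢0)))
          (inj₂ (F a 1# l , (l , Al , l≢0 , refl) ,
             Equivalence.from (OnConic⇔Φ (F a 1# l) _) (trans (cong (Φ (F a 1# l)) (inverseʳ v)) on))))

      -- Two different points of `cubic x`: at most one of them can be sent to F₀, so the other one
      -- is sent to a conic of the pencil.
      Q₁ Q₂ : Carrier → Point
      Q₁ x = point (1# ∷ 0# ∷ √ ((1# + x * (x * x)) * x ⁻¹) ∷ []) (λ eq → 0≢1 (sym (cong Vec.head eq)))
      Q₂ x = point (0# ∷ 1# ∷ √ (x ⁻¹) ∷ []) (λ eq → 0≢1 (sym (cong (Vec.head ∘ Vec.tail) eq)))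

      Q₁∈ : ∀ {x} → x ≢ 0# → Φ (cubic x) (coords (Q₁ x)) ≡ 0#
      Q₁∈ {x} x≢0 = by₂ x (1# + x * (x * x))
        (solve 3 (λ x i z → ((con true :+ x :* (x :* x)) :* (con true :* con true) :+ con true :* con false
            :+ con true :* (con false :* con false) :+ x :* (z :* z)) :+ con false
            := x :* (z :* z :+ (con true :+ x :* (x :* x)) :* i)
            :+ (con true :+ x :* (x :* x)) :* (x :* i :+ con true)) refl x _ _) (√-square _)
            (*-inverseʳ x x≢0)

      Q₂∈ : ∀ {x} → x ≢ 0# → Φ (cubic x) (coords (Q₂ x)) ≡ 0#
      Q₂∈ {x} x≢0 = by₂ x 1#
        (solve 3 (λ x i z → ((con true :+ x :* (x :* x)) :* (con false :* con false)
            :+ con false :* con true :+ con true :* (con true :* con true) :+ x :* (z :* z)) :+ con false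
            := x :* (z :* z :+ i) :+ con true :* (x :* i :+ con true)) refl x _ _) (√-square _)
            (*-inverseʳ x x≢0)

      Hit : Bits → Set
      Hit b = ∃[ l ] det (shearOf inverse) ≢ 0# × Maps (shearOf inverse) (F a 1# l) (cubic (comb e b))

      -- `transfer` takes each conic of the pencil to some conic of the arc; wanted is that every
      -- conic of the arc is reached. The pencil conic through the image of `q` is taken back to an
      -- arc conic through `q`, which is the given one because the arc conics are disjoint.
      hit-by : ∀ b q → Φ (cubic (comb e b)) (coords q) ≡ 0# →
               (∃[ c ] DennistonConics a A c × OnConic c (projectivity g q)) → Hit b
      hit-by b q q∈ (_ , (l , Al , l≢0 , refl) , on) with pencil-conic l Al l≢0
      ... | isShear , det≢0 , any with Any.satisfied any
      ...   | b′ , m with b ≟ᵇ b′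
      ...     | yes refl = l , det≢0 , m
      ...     | no  b≢b′ = ⊥-elim (disjoint q b≢b′ q∈ (begin
        Φ (cubic (comb e b′)) (coords q)
          ≡⟨ cong (Φ (cubic (comb e b′)))
              (trans (cong (_· (matrix · coords q)) (sym isShear)) (inverseˡ (coords q))) ⟨
        Φ (cubic (comb e b′)) (matrixOf (shearOf inverse) · (matrix · coords q))
          ≡⟨ Maps⇒Φ (shearOf inverse) m (matrix · coords q) ⟩
        det (shearOf inverse) * Φ (F a 1# l) (matrix · coords q)
          ≡⟨ cong (det (shearOf inverse) *_) (Equivalence.to (OnConic⇔Φ (F a 1# l) (projectivity g q)) on) ⟩
        det (shearOf inverse) * 0#
          ≡⟨ zeroʳ _ ⟩
        0# ∎))
        where open ≡-Reasoning

      apart : ∀ x → projectivity g (Q₁ x) ≈ₚ F₀ → projectivity g (Q₂ x) ≈ₚ F₀ → ⊥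
      apart x ≈F₀ ≈F₀′ = 0≢1 (begin
        0#               ≡⟨ zeroʳ _ ⟨
        proj₁ Q₂≈Q₁ * 0# ≡⟨ cong Vec.head (proj₂ (proj₂ Q₂≈Q₁)) ⟨
        1#               ∎)
        where
        open ≡-Reasoning
        open Setoid pointSetoid using () renaming (sym to ≈-sym; trans to ≈-trans)
        Q₂≈Q₁ : Q₂ x ≈ₚ Q₁ x
        Q₂≈Q₁ = projectivity-injective g (Q₂ x) (Q₁ x)
          (≈-trans {projectivity g (Q₂ x)} {F₀} {projectivity g (Q₁ x)} ≈F₀′
              (≈-sym {projectivity g (Q₁ x)} {F₀} ≈F₀))

      hit : ∀ {b} → b ≢ 0ᵇ → Hit b
      hit {b} b≢0 = cases (image-of (Q₁ x) (Q₁∈ x≢0)) (image-of (Q₂ x) (Q₂∈ x≢0))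
        where
        x = comb e b
        x≢0 = independent b b≢0
        image-of : ∀ q → Φ (cubic x) (coords q) ≡ 0# → ConicUnion (DennistonConics a A) (projectivity g q)
        image-of q q∈ = Equivalence.to (eq q) (inj₂ (span∖0⁺ e (λ x → Φ (cubic x) (coords q) ≡ 0#) b≢0 q∈))
        cases : ConicUnion (DennistonConics a A) (projectivity g (Q₁ x)) →
                ConicUnion (DennistonConics a A) (projectivity g (Q₂ x)) → Hit b
        cases (inj₂ on)  _           = hit-by b (Q₁ x) (Q₁∈ x≢0) on
        cases (inj₁ _)   (inj₂ on)   = hit-by b (Q₂ x) (Q₂∈ x≢0) on
        cases (inj₁ ≈F₀) (inj₁ ≈F₀′) = ⊥-elim (apart x ≈F₀ ≈F₀′)

      -- In a Denniston pencil α and β stay constant while λ varies, so `column` applies to the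
      -- first two columns with seven parameters. It annihilates the first row of the block and with
      -- it `det S`.
      absurd : ⊥
      absurd = D≢0 (trans (cong₂ (λ a b → a * Shear.d S + b * Shear.c S) (proj₁ col₁) (proj₁ col₂))
                          (solve 2 (λ x y → con false :* x :+ con false :* y := con false) refl (Shear.d S)
                              (Shear.c S)))
        where
        S = shearOf inverse
        D≢0 : det S ≢ 0#
        D≢0 = proj₁ (proj₂ (hit {true , false , false} (λ ())))
        col₁ = column (det S * a) (Shear.a S) (Shear.c S) (Shear.u S) (span∖0-unique independent)
            (s≤s (s≤s (s≤s (s≤s z≤n))))
          (span∖0-All e (λ x → det S * a ≡ Φ (cubic x) (Shear.a S ∷ Shear.c S ∷ Shear.u S ∷ []))
              (λ b≢0 → Maps.α-eq (proj₂ (proj₂ (hit b≢0)))))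
        col₂ = column (det S * 1#) (Shear.b S) (Shear.d S) (Shear.v S) (span∖0-unique independent)
            (s≤s (s≤s (s≤s (s≤s z≤n))))
          (span∖0-All e (λ x → det S * 1# ≡ Φ (cubic x) (Shear.b S ∷ Shear.d S ∷ Shear.v S ∷ []))
              (λ b≢0 → Maps.β-eq (proj₂ (proj₂ (hit b≢0)))))

    notDenniston : ¬ IsDennistonType arc
    notDenniston (a , A , _ , _ , _ , g , eq) = absurd a A g eq

  module _ (e e′ : Carrier³) (ind : Independent e) (iso : Isotropic e) (ind′ : Independent e′)
      (iso′ : Isotropic e′) where

    open Arc using (arc)

    -- After σ the isomorphism multiplies the parameters by k = D/w². The second column gives b = 0
    -- and D = d², and D = ad then yields a = d. The coefficient of y³ in the first column gives D =
    -- k³a². Hence k³ = 1 and k = 1.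
    ≅⇒σ : ((g , _) : arc e ind iso ≅ arc e′ ind′ iso′) → ∀ b → b ≢ 0ᵇ → ΓL₃.σ g (comb e b) ∈ span∖0 e′
    ≅⇒σ (g , eq) i i≢0 = subst (_∈ span∖0 e′)
        (trans (scaled i≢0) (trans (cong (_* y i) k≡1) (*-identityˡ _)))
                           (Any.map⁺ {f = comb e′} (Any.map (cong (comb e′))
                               (proj₁ (proj₂ (proj₂ (hits i≢0))))))
      where
      open ΓL₃ g
      y : Bits → Carrier
      y b = σ (comb e b)
      S = shearOf matrix
      open Shear S

      covered : ∀ {b} → b ≢ 0ᵇ → ∀ v → v ≢ 0ᵥ → Φ (cubic (y b)) v ≡ 0# →
                Nucleus (matrix · v) ⊎ Any (λ x → Φ (cubic x) (matrix · v) ≡ 0#) (span∖0 e′)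
      covered {b} b≢0 w w≢0 on = subst Q σp≡w
          (Equivalence.to (eq (point p p≢0)) (inj₂ (span∖0⁺ e (λ x → Φ (cubic x) p ≡ 0#) b≢0
          (Equivalence.from (σ-on-cubic automorphism (comb e b) p)
              (subst (λ w → Φ (cubic (y b)) w ≡ 0#) (sym σp≡w) on)))))
        where
        Q : Vec₃ → Set
        Q r = Nucleus (matrix · r) ⊎ Any (λ x → Φ (cubic x) (matrix · r) ≡ 0#) (span∖0 e′)
        p = proj₁ (σ-surjective automorphism w)
        σp≡w : Vec.map σ p ≡ w
        σp≡w = proj₂ (σ-surjective automorphism w)
        p≢0 : p ≢ 0ᵥ
        p≢0 p≡0 = w≢0 (trans (sym σp≡w) (trans (cong (Vec.map σ) p≡0) (∷³ 0#-homo 0#-homo 0#-homo)))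

      transferred : ∀ {b} → b ≢ 0ᵇ → matrix ≡ matrixOf S × det S ≢ 0# ×
                    Any (λ b′ → Maps S (cubic (y b)) (cubic (comb e′ b′))) nonzeroBits
      transferred {b} b≢0 = ∋-transfer e′ ind′ iso′ matrix inverse inverseʳ (cubic (y b))
          (σ-≢0 automorphism (ind b b≢0)) (covered b≢0)

      hits : ∀ {b} → b ≢ 0ᵇ → ∃[ b′ ] det S ≢ 0# × b′ ∈ nonzeroBits
          × Maps S (cubic (y b)) (cubic (comb e′ b′))
      hits b≢0 with transferred b≢0
      ... | _ , D≢0 , any = let (b′ , b′∈ , m) = find any in b′ , D≢0 , b′∈ , m

      x′ : ∀ {b} → b ≢ 0ᵇ → Carrier
      x′ b≢0 = comb e′ (proj₁ (hits b≢0))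
      maps-to : ∀ {b} (b≢0 : b ≢ 0ᵇ) → Maps S (cubic (y b)) (cubic (x′ b≢0))
      maps-to b≢0 = proj₂ (proj₂ (proj₂ (hits b≢0)))

      b₀≢0 : (true , false , false) ≢ 0ᵇ
      b₀≢0 ()
      D = det S
      D≢0 : D ≢ 0#
      D≢0 = proj₁ (proj₂ (hits b₀≢0))
      w²≢0 : w * w ≢ 0#
      w²≢0 w²≡0 = *≢0 D _ D≢0 (σ-≢0 automorphism (ind _ b₀≢0))
          (trans (Maps.l-eq (maps-to b₀≢0)) (trans (cong (_* x′ b₀≢0) w²≡0) (zeroˡ _)))
      k = D * (w * w) ⁻¹
      k≢0 : k ≢ 0#
      k≢0 = *≢0 _ _ D≢0 (⁻¹≢0 _ w²≢0)

      scaled : ∀ {b} (b≢0 : b ≢ 0ᵇ) → x′ b≢0 ≡ k * y b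
      scaled {b} b≢0 = by₂ ((w * w) ⁻¹) (x′ b≢0)
          (solve 5 (λ D i w x y → x :+ D :* i :* y
          := i :* (D :* y :+ w :* w :* x) :+ x :* (w :* w :* i :+ con true)) refl D ((w * w) ⁻¹) w (x′ b≢0)
          (y b))
        (Maps.l-eq (maps-to b≢0)) (*-inverseʳ _ w²≢0)

      y-unique : Unique (map y nonzeroBits)
      y-unique = Unique.map⁺ (comb-injective ind ∘ injective) nonzeroBits-unique

      ky-unique : Unique (map (λ b → k * y b) nonzeroBits)
      ky-unique = Unique.map⁺ (comb-injective ind ∘ injective ∘ *-cancelˡ k k≢0) nonzeroBits-unique

      4≤7 : 4 ≤ 7
      4≤7 = s≤s (s≤s (s≤s (s≤s z≤n)))

      column₂ : b ≡ 0# × D * 1# ≡ d * d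
      column₂ = column (D * 1#) b d v ky-unique 4≤7 (All.map⁺ {f = λ b → k * y b} (All.map
        (λ b≢0 → trans (Maps.β-eq (maps-to b≢0)) (cong (λ x → Φ (cubic x) (b ∷ d ∷ v ∷ [])) (scaled b≢0)))
            nonzeroBits-≢0))

      -- The α-equation of `Maps` between the parameters y and ky, by coefficients in y.
      cubic₁ : Vec Carrier 4
      cubic₁ = D + (a * a + a * c + c * c) ∷ k * (u * u) ∷ 0# ∷ D + k * (k * k) * (a * a) ∷ []

      cubic₁-root : ∀ {b} → b ≢ 0ᵇ → Root cubic₁ (y b)
      cubic₁-root {b′} b≢0 = by₁ 1# (solve 6
          (λ D k a c u y → ((D :+ (a :* a :+ a :* c :+ c :* c))
          :+ y :* (k :* (u :* u) :+ y :* (con false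
          :+ y :* ((D :+ k :* (k :* k) :* (a :* a)) :+ y :* con false)))) :+ con false
          := con true :* (D :* (con true :+ y :* (y :* y))
          :+ ((con true :+ k :* y :* (k :* y :* (k :* y))) :* (a :* a) :+ a :* c :+ con true :* (c :* c)
          :+ k :* y :* (u :* u)))) refl
        D k a c u (y b′))
        (trans (Maps.α-eq (maps-to b≢0)) (cong (λ x → Φ (cubic x) (a ∷ c ∷ u ∷ [])) (scaled b≢0)))

      column₁ : D ≡ k * (k * k) * (a * a)
      column₁ = conclude (roots⇒zero cubic₁ y-unique (All.map⁺ {f = y} (All.map cubic₁-root nonzeroBits-≢0))
          4≤7)
        where
        conclude : AllZero cubic₁ → D ≡ k * (k * k) * (a * a)
        conclude (_ VecAll.∷ _ VecAll.∷ _ VecAll.∷ eq VecAll.∷ VecAll.[]) = +≡0⇒≡ eq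

      k≡1 : k ≡ 1#
      k≡1 = cube≡1 k (*-cancelˡ (a * a) (*≢0 a a a≢0 a≢0) (begin
        a * a * (k * (k * k)) ≡⟨ *-comm _ _ ⟩
        k * (k * k) * (a * a) ≡⟨ column₁ ⟨
        D                     ≡⟨ D≡ad ⟩
        a * d                 ≡⟨ cong (a *_) a≡d ⟨
        a * a                 ≡⟨ *-identityʳ _ ⟨
        a * a * 1#            ∎))
        where
        open ≡-Reasoning
        D≡ad : D ≡ a * d
        D≡ad = by₁ c (solve 4 (λ a b c d → (a :* d :+ b :* c) :+ a :* d := c :* (b :+ con false)) refl a b c
            d) (proj₁ column₂)
        a≢0 : a ≢ 0#
        a≢0 a≡0 = D≢0 (trans D≡ad (trans (cong (_* d) a≡0) (zeroˡ d)))
        d≢0 : d ≢ 0#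
        d≢0 d≡0 = D≢0 (trans D≡ad (trans (cong (a *_) d≡0) (zeroʳ a)))
        a≡d : a ≡ d
        a≡d = *-cancelˡ d d≢0 (trans (*-comm d a)
            (trans (sym D≡ad) (trans (sym (*-identityʳ D)) (proj₂ column₂))))

-- Interpolation, trace conditions and reduction to normal form

module NormalForm {h : ℕ} (𝔽 : BinaryField h) (O : OddField 𝔽) where

  open BinaryField 𝔽
  open OddField O
  open OddFieldProperties 𝔽 O
  open ProjectivePlane 𝔽
  open MathonArcs 𝔽
  open Geometry 𝔽 O
  open Span 𝔽 O
  open CubicArcs 𝔽 O

  pattern b₁ = true , false , false
  pattern b₂ = false , true , false
  pattern b₃ = false , false , true

  Indexed : (Bits → Set) → Set
  Indexed P = ∃[ b ] b ≢ 0ᵇ × P b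

  module _ (e : Carrier³) where
    private
      e₁ = proj₁ e
      e₂ = proj₁ (proj₂ e)
      e₃ = proj₂ (proj₂ e)

    comb-b₁ : comb e b₁ ≡ e₁
    comb-b₁ = solve 3 (λ x y z → con true :* x :+ con false :* y :+ con false :* z := x) refl e₁ e₂ e₃

    comb-b₂ : comb e b₂ ≡ e₂
    comb-b₂ = solve 3 (λ x y z → con false :* x :+ con true :* y :+ con false :* z := y) refl e₁ e₂ e₃

    comb-b₃ : comb e b₃ ≡ e₃
    comb-b₃ = solve 3 (λ x y z → con false :* x :+ con false :* y :+ con true :* z := z) refl e₁ e₂ e₃

  scale³ : Carrier → Carrier³ → Carrier³
  scale³ k (x , y , z) = k * x , k * y , k * z

  comb-scale : ∀ k e b → comb (scale³ k e) b ≡ k * comb e b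
  comb-scale k (x , y , z) (a , b , c) =
    (solve 7 (λ k x y z a b c → a :* (k :* x) :+ b :* (k :* y) :+ c :* (k :* z)
        := k :* (a :* x :+ b :* y :+ c :* z)) refl) k x y z ⟦ a ⟧₂ ⟦ b ⟧₂ ⟦ c ⟧₂

  -- The linearised polynomials of degree at most 4.
  additive : Carrier³ → Carrier → Carrier
  additive (l₀ , l₁ , l₂) x = l₀ * x + l₁ * (x * x) + l₂ * (x * x * (x * x))

  additive-bit : ∀ l b x → additive l (⟦ b ⟧₂ * x) ≡ ⟦ b ⟧₂ * additive l x
  additive-bit (l₀ , l₁ , l₂) false x
      = solve 4 (λ l₀ l₁ l₂ x → l₀ :* (con false :* x) :+ l₁ :* (con false :* x :* (con false :* x))
      :+ l₂ :* (con false :* x :* (con false :* x) :* (con false :* x :* (con false :* x)))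
      := con false :* (l₀ :* x :+ l₁ :* (x :* x) :+ l₂ :* (x :* x :* (x :* x)))) refl l₀ l₁ l₂ x
  additive-bit (l₀ , l₁ , l₂) true x
      = solve 4 (λ l₀ l₁ l₂ x → l₀ :* (con true :* x) :+ l₁ :* (con true :* x :* (con true :* x))
      :+ l₂ :* (con true :* x :* (con true :* x) :* (con true :* x :* (con true :* x)))
      := con true :* (l₀ :* x :+ l₁ :* (x :* x) :+ l₂ :* (x :* x :* (x :* x)))) refl l₀ l₁ l₂ x

  additive-comb : ∀ l x y z b → additive l (comb (x , y , z) b)
      ≡ comb (additive l x , additive l y , additive l z) b
  additive-comb l@(l₀ , l₁ , l₂) x y z (a , b , c) = trans
    (solve 6 (λ l₀ l₁ l₂ x y z → l₀ :* (x :+ y :+ z) :+ l₁ :* ((x :+ y :+ z) :* (x :+ y :+ z))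
        :+ l₂ :* ((x :+ y :+ z) :* (x :+ y :+ z) :* ((x :+ y :+ z) :* (x :+ y :+ z)))
        := (l₀ :* x :+ l₁ :* (x :* x) :+ l₂ :* (x :* x :* (x :* x)))
        :+ (l₀ :* y :+ l₁ :* (y :* y) :+ l₂ :* (y :* y :* (y :* y)))
        :+ (l₀ :* z :+ l₁ :* (z :* z) :+ l₂ :* (z :* z :* (z :* z)))) refl l₀ l₁ l₂ (⟦ a ⟧₂ * x)
        (⟦ b ⟧₂ * y) (⟦ c ⟧₂ * z))
    (cong₂ _+_ (cong₂ _+_ (additive-bit l a x) (additive-bit l b y)) (additive-bit l c z))

  -- Newton interpolation with subspace polynomials: `P₁` vanishes exactly on the span of e₁ and
  -- `P₂` on the span of e₁ and e₂, so their values at the next basis vector are nonzero by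
  -- independence.
  interpolation : ∀ e → Independent e → ∀ a → ∃[ l ] ∀ b → additive l (comb e b) ≡ comb a b
  interpolation (e₁ , e₂ , e₃) ind (a₁ , a₂ , a₃) = l , λ b → trans (additive-comb l e₁ e₂ e₃ b)
    (cong (λ a → comb a b) (cong₂ _,_ value₁ (cong₂ _,_ value₂ value₃)))
    where
    e = e₁ , e₂ , e₃
    P₁ : Carrier → Carrier
    P₁ x = x * x + e₁ * x
    q = P₁ e₂
    P₂ : Carrier → Carrier
    P₂ x = P₁ x * P₁ x + q * P₁ x

    ≢0 : ∀ {x} b → b ≢ 0ᵇ → comb e b ≡ x → x ≢ 0#
    ≢0 b b≢0 eq x≡0 = ind b b≢0 (trans eq x≡0)

    e₁≢0 : e₁ ≢ 0#
    e₁≢0 = ≢0 b₁ (λ ()) (comb-b₁ e)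
    q≢0 : q ≢ 0#
    q≢0 eq = *≢0 e₂ (e₁ + e₂) (≢0 b₂ (λ ()) (comb-b₂ e))
      (≢0 (true , true , false) (λ ())
          (solve 3 (λ x y z → con true :* x :+ con true :* y :+ con false :* z := x :+ y) refl e₁ e₂ e₃))
      (trans (solve 2 (λ x y → y :* (x :+ y) := y :* y :+ x :* y) refl e₁ e₂) eq)
    P₂≢0 : P₂ e₃ ≢ 0#
    P₂≢0 eq = *≢0 (e₃ * (e₁ + e₃)) ((e₂ + e₃) * (e₁ + e₂ + e₃))
      (*≢0 _ _ (≢0 b₃ (λ ()) (comb-b₃ e))
          (≢0 (true , false , true) (λ ())
          (solve 3 (λ x y z → con true :* x :+ con false :* y :+ con true :* z := x :+ z) refl e₁ e₂ e₃)))
      (*≢0 _ _ (≢0 (false , true , true) (λ ())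
          (solve 3 (λ x y z → con false :* x :+ con true :* y :+ con true :* z := y :+ z) refl e₁ e₂ e₃))
               (≢0 (true , true , true) (λ ())
                   (solve 3 (λ x y z → con true :* x :+ con true :* y :+ con true :* z := x :+ y :+ z) refl
                   e₁ e₂ e₃)))
      (trans (solve 3 (λ x y z → z :* (x :+ z) :* ((y :+ z) :* (x :+ y :+ z))
          := (z :* z :+ x :* z) :* (z :* z :+ x :* z) :+ (y :* y :+ x :* y) :* (z :* z :+ x :* z)) refl e₁
          e₂ e₃) eq)

    -- Each Newton coefficient corrects the value at one more basis vector; `l` collects the terms
    -- of A₀x + A₁P₁(x) + A₂P₂(x) by x, x² and x⁴.
    A₀ A₁ A₂ : Carrier
    A₀ = a₁ * e₁ ⁻¹
    A₁ = (a₂ + A₀ * e₂) * q ⁻¹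
    A₂ = (a₃ + A₀ * e₃ + A₁ * P₁ e₃) * P₂ e₃ ⁻¹
    l : Carrier³
    l = A₀ + A₁ * e₁ + A₂ * (q * e₁) , A₁ + A₂ * (e₁ * e₁ + q) , A₂

    newton : ∀ x → additive l x ≡ A₀ * x + A₁ * P₁ x + A₂ * P₂ x
    newton x = solve 6 (λ A₀ A₁ A₂ e q x
        → (A₀ :+ A₁ :* e :+ A₂ :* (q :* e)) :* x :+ (A₁ :+ A₂ :* (e :* e :+ q)) :* (x :* x)
        :+ A₂ :* (x :* x :* (x :* x)) := A₀ :* x :+ A₁ :* (x :* x :+ e :* x)
        :+ A₂ :* ((x :* x :+ e :* x) :* (x :* x :+ e :* x) :+ q :* (x :* x :+ e :* x))) refl A₀ A₁ A₂ e₁ q x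

    value₁ : additive l e₁ ≡ a₁
    value₁ = trans (newton e₁) (by₁ a₁
      (solve 6 (λ a i e A₁ A₂ q → a :* i :* e :+ A₁ :* (e :* e :+ e :* e)
          :+ A₂ :* ((e :* e :+ e :* e) :* (e :* e :+ e :* e) :+ q :* (e :* e :+ e :* e)) :+ a
          := a :* (e :* i :+ con true)) refl
        a₁ (e₁ ⁻¹) e₁ A₁ A₂ q) (*-inverseʳ e₁ e₁≢0))
    value₂ : additive l e₂ ≡ a₂
    value₂ = trans (newton e₂) (by₁ (a₂ + A₀ * e₂)
      (solve 6 (λ a i e A₀ A₂ q → A₀ :* e :+ (a :+ A₀ :* e) :* i :* q :+ A₂ :* (q :* q :+ q :* q) :+ a
          := (a :+ A₀ :* e) :* (q :* i :+ con true)) refl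
        a₂ (q ⁻¹) e₂ A₀ A₂ q) (*-inverseʳ q q≢0))
    value₃ : additive l e₃ ≡ a₃
    value₃ = trans (newton e₃) (by₁ (a₃ + A₀ * e₃ + A₁ * P₁ e₃)
      (solve 7 (λ a i e A₀ A₁ p P → A₀ :* e :+ A₁ :* p :+ (a :+ A₀ :* e :+ A₁ :* p) :* i :* P :+ a
          := (a :+ A₀ :* e :+ A₁ :* p) :* (P :* i :+ con true)) refl
        a₃ (P₂ e₃ ⁻¹) e₃ A₀ A₁ (P₁ e₃) (P₂ e₃)) (*-inverseʳ _ P₂≢0))

  coefficient : Carrier³ → Carrier → Carrier
  coefficient (l₀ , l₁ , l₂) x = l₀ + l₁ * x + l₂ * (x * (x * x))

  coefficient-additive : ∀ l x → coefficient l x * x ≡ additive l x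
  coefficient-additive (l₀ , l₁ , l₂) x
      = solve 4 (λ l₀ l₁ l₂ x → (l₀ :+ l₁ :* x :+ l₂ :* (x :* (x :* x))) :* x
      := l₀ :* x :+ l₁ :* (x :* x) :+ l₂ :* (x :* x :* (x :* x))) refl l₀ l₁ l₂ x

  family : Carrier³ → Carrier³ → Carrier → Conic
  family l m x = F (coefficient l x) (coefficient m x) x

  -- The part of `cubes-product` that depends on ε. It is additive in t because squaring is.
  polarForm : Carrier³ → Carrier³ → Carrier → Carrier
  polarForm (l₀ , l₁ , l₂) (m₀ , m₁ , m₂) t = (l₀ * m₂ + l₂ * m₀) * t + l₂ * m₂ * (t * t)

  ε-additive : ∀ x y z →
    x * x * (y + z) + x * ((y + z) * (y + z)) ≡
    (x * x * y + x * (y * y)) + (x * x * z + x * (z * z))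
  ε-additive = solve 3 (λ x y z →
    x :* x :* (y :+ z) :+ x :* ((y :+ z) :* (y :+ z)) :=
    (x :* x :* y :+ x :* (y :* y)) :+ (x :* x :* z :+ x :* (z :* z))) refl

  module Traces (e : Carrier³) (ind : Independent e) (l m : Carrier³)
                (traces : ∀ b → b ≢ 0ᵇ → Tr (coefficient l (comb e b) * coefficient m (comb e b)) ≡ 1#)
                    where
    private
      l₀ = proj₁ l
      m₀ = proj₁ m
      Z : Carrier → Carrier
      Z t = Tr (polarForm l m t)
      T = Tr (l₀ * m₀)

    Z-+ : ∀ s t → Z (s + t) ≡ Z s + Z t
    Z-+ s t = trans (cong Tr (solve 6
        (λ l₀ l₂ m₀ m₂ s t → (l₀ :* m₂ :+ l₂ :* m₀) :* (s :+ t) :+ l₂ :* m₂ :* ((s :+ t) :* (s :+ t))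
        := ((l₀ :* m₂ :+ l₂ :* m₀) :* s :+ l₂ :* m₂ :* (s :* s))
        :+ ((l₀ :* m₂ :+ l₂ :* m₀) :* t :+ l₂ :* m₂ :* (t :* t))) refl l₀ (proj₂ (proj₂ l)) m₀
        (proj₂ (proj₂ m)) s t))
      (Tr-+ _ _)

    -- `cubes-product` evaluates the sum of the three traces at x, y and x + y, each of which is 1.
    sum≡1 : ∀ b b′ → b ≢ 0ᵇ → b′ ≢ 0ᵇ → b ⊞ b′ ≢ 0ᵇ → T + Z (ε (comb e b) (comb e b′)) ≡ 1#
    sum≡1 b b′ b≢0 b′≢0 s≢0 = begin
      T + Z (ε x y)
        ≡⟨ Tr-+ (l₀ * m₀) (polarForm l m (ε x y)) ⟨
      Tr (l₀ * m₀ + polarForm l m (ε x y))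
        ≡⟨ cong Tr (cubes-product l₀ (proj₁ (proj₂ l)) (proj₂ (proj₂ l)) m₀ (proj₁ (proj₂ m))
            (proj₂ (proj₂ m)) x y) ⟨
      Tr (p x + p y + p (x + y))
        ≡⟨ Tr-+₃ (p x) (p y) (p (x + y)) ⟩
      Tr (p x) + Tr (p y) + Tr (p (x + y))
        ≡⟨ cong₂ _+_ (cong₂ _+_ (traces b b≢0) (traces b′ b′≢0))
            (trans (cong (λ s → Tr (p s)) (sym (comb-⊞ e b b′))) (traces (b ⊞ b′) s≢0)) ⟩
      1# + 1# + 1#
        ≡⟨ trans (cong (_+ 1#) (x+x≡0 1#)) (+-identityˡ 1#) ⟩
      1# ∎
      where
      open ≡-Reasoning
      x = comb e b
      y = comb e b′
      p : Carrier → Carrier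
      p x = coefficient l x * coefficient m x

    -- The left-hand sides of sum≡1 for the pairs (b₁ , b₂), (b₁ , b₃) and
    -- (b₁ , b₂ ⊞ b₃) add up to 3 T.
    T≡1 : T ≡ 1#
    T≡1 = by₃ 1# 1# 1# (solve 3 (λ T Z Z′ → T :+ con true
        := con true :* ((T :+ Z) :+ con true) :+ con true :* ((T :+ Z′) :+ con true)
        :+ con true :* ((T :+ (Z :+ Z′)) :+ con true)) refl
        T (Z (ε x y)) (Z (ε x z)))
      (sum≡1 b₁ b₂ (λ ()) (λ ()) (λ ())) (sum≡1 b₁ b₃ (λ ()) (λ ()) (λ ()))
      (trans (cong (T +_) (sym (trans (cong (λ s → Z (ε x s)) (comb-⊞ e b₂ b₃))
          (trans (cong Z (ε-additive x y z)) (Z-+ (ε x y) (ε x z))))))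
             (sum≡1 b₁ (b₂ ⊞ b₃) (λ ()) (λ ()) (λ ())))
      where
      x = comb e b₁
      y = comb e b₂
      z = comb e b₃

    Z-0 : ∀ {t} → t ≡ 0# → Z t ≡ 0#
    Z-0 refl = trans (cong Tr (solve 2
        (λ p q → p :* con false :+ q :* (con false :* con false) := con false) refl
        (l₀ * proj₂ (proj₂ m) + proj₂ (proj₂ l) * m₀) (proj₂ (proj₂ l) * proj₂ (proj₂ m)))) Tr-0

    comb-0 : ∀ {b} → b ≡ 0ᵇ → comb e b ≡ 0#
    comb-0 refl = solve 3 (λ x y z → con false :* x :+ con false :* y :+ con false :* z := con false) refl
        (proj₁ e) (proj₁ (proj₂ e)) (proj₂ (proj₂ e))

    -- `sum≡1` covers the pairs of distinct nonzero vectors; in all other cases ε itself vanishes.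
    Z≡0 : ∀ b b′ → Z (ε (comb e b) (comb e b′)) ≡ 0#
    Z≡0 b b′ with b ≟ᵇ 0ᵇ | b′ ≟ᵇ 0ᵇ | b ≟ᵇ b′
    ... | yes b≡0 | _ | _ = Z-0 (trans (cong (λ x → ε x (comb e b′)) (comb-0 b≡0))
        (solve 1 (λ y → con false :* con false :* y :+ con false :* (y :* y) := con false) refl
        (comb e b′)))
    ... | no _ | yes b′≡0 | _ = Z-0
        (trans (cong (ε (comb e b)) (comb-0 b′≡0))
        (solve 1 (λ x → x :* x :* con false :+ x :* (con false :* con false) := con false) refl (comb e b)))
    ... | no _ | no _ | yes refl = Z-0
        (solve 1 (λ x → x :* x :* x :+ x :* (x :* x) := con false) refl (comb e b))
    ... | no b≢0 | no b′≢0 | no b≢b′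
        = by₂ 1# 1# (solve 2 (λ T Z → Z :+ con false
        := con true :* ((T :+ Z) :+ con true) :+ con true :* (T :+ con true)) refl T
        (Z (ε (comb e b) (comb e b′))))
      (sum≡1 b b′ b≢0 b′≢0 (b≢b′ ∘ ⊞≡0⇒≡ b b′)) T≡1

  -- Scaling the parameters by k multiplies ε by k³, so `polar` turns the vanishing of the traces of
  -- `polarForm` into isotropy of the scaled space.
  record Normalisation (l m : Carrier³) : Set where
    field
      N      : Shear
      k      : Carrier
      det≢0  : det N ≢ 0#
      w≢0    : Shear.w N ≢ 0#
      k≢0    : k ≢ 0#
      maps-x : ∀ x → Maps N (family l m x) (cubic (k * x))
      polar  : ∀ t → Tr (k * (k * k) * t) ≡ Tr (polarForm l m t)

  -- The substitution x ↦ x + t y with t² = m₂ / l₂ removes the cubic term of the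
  -- second coefficient; the remaining binary form is then brought into the shape
  -- X² + XY + Y² by an Artin–Schreier substitution.
  normalise : ∀ l m → proj₂ (proj₂ l) ≢ 0# → Tr (proj₁ l * proj₁ m) ≡ 1# → Normalisation l m
  normalise (l₀ , l₁ , l₂) (m₀ , m₁ , m₂) l₂≢0 tr = record
    { N = shear 1# t s (s * t + D) u v w
    ; k = k
    ; det≢0 = λ eq → D≢0 (trans (solve 3 (λ s t D → D := con true :* (s :* t :+ D) :+ t :* s) refl s t D)
        eq)
    ; w≢0 = √≢0 (*≢0 _ _ D≢0 (⁻¹≢0 k k≢0))
    ; k≢0 = k≢0
    ; maps-x = λ x → maps (α-eq x) (β-eq x) (l-eq x)
    ; polar = polar
    }
    where
    t = √ (m₂ * l₂ ⁻¹)
    -- D is the value of l₀x² + xy + m₀y² at (t, 1) and becomes the determinant. The cube root k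
    -- makes the coefficient of λ³ equal to 1, u and v absorb the terms linear in λ, and w rescales
    -- z so that λ turns into kλ.
    D = m₀ + t + t * t * l₀
    k = ∛ (D * l₂)
    w = √ (D * k ⁻¹)
    u = √ (D * l₁ * k ⁻¹)
    v = √ (D * m₁ * k ⁻¹)

    t² : t * t * l₂ ≡ m₂
    t² = by₂ l₂ m₂ (solve 4 (λ t m l i → t :* t :* l :+ m
        := l :* (t :* t :+ m :* i) :+ m :* (l :* i :+ con true)) refl t m₂ l₂ (l₂ ⁻¹))
      (√-square (m₂ * l₂ ⁻¹)) (*-inverseʳ l₂ l₂≢0)

    tr′ : Tr (l₀ * D) ≡ 1#
    tr′ = begin
      Tr (l₀ * D)
        ≡⟨ cong Tr (solve 3 (λ l₀ m₀ t → l₀ :* (m₀ :+ t :+ t :* t :* l₀)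
            := l₀ :* m₀ :+ l₀ :* t :+ l₀ :* t :* (l₀ :* t)) refl l₀ m₀ t) ⟩
      Tr (l₀ * m₀ + l₀ * t + l₀ * t * (l₀ * t))
        ≡⟨ Tr-+₃ (l₀ * m₀) (l₀ * t) (l₀ * t * (l₀ * t)) ⟩
      Tr (l₀ * m₀) + Tr (l₀ * t) + Tr (l₀ * t * (l₀ * t))
        ≡⟨ cong₂ (λ p q → p + Tr (l₀ * t) + q) tr (Tr-square (l₀ * t)) ⟩
      1# + Tr (l₀ * t) + Tr (l₀ * t)
        ≡⟨ solve 1 (λ x → con true :+ x :+ x := con true) refl (Tr (l₀ * t)) ⟩
      1# ∎
      where open ≡-Reasoning

    D≢0 : D ≢ 0#
    D≢0 D≡0 = 0≢1 (trans (sym Tr-0) (trans (cong Tr (trans (sym (zeroʳ l₀)) (cong (l₀ *_) (sym D≡0)))) tr′))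

    k³ : k * (k * k) ≡ D * l₂
    k³ = ∛-cube (D * l₂)

    k≢0 : k ≢ 0#
    k≢0 k≡0 = *≢0 D l₂ D≢0 l₂≢0 (trans (sym k³) (trans (cong (_* (k * k)) k≡0) (zeroˡ _)))

    inv = *-inverseʳ k k≢0

    ku² : k * (u * u) ≡ D * l₁
    ku² = by₂ k (D * l₁) (solve 4 (λ k u p i → k :* (u :* u) :+ p
        := k :* (u :* u :+ p :* i) :+ p :* (k :* i :+ con true)) refl k u (D * l₁) (k ⁻¹))
      (√-square (D * l₁ * k ⁻¹)) inv

    kv² : k * (v * v) ≡ D * m₁
    kv² = by₂ k (D * m₁) (solve 4 (λ k u p i → k :* (u :* u) :+ p
        := k :* (u :* u :+ p :* i) :+ p :* (k :* i :+ con true)) refl k v (D * m₁) (k ⁻¹))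
      (√-square (D * m₁ * k ⁻¹)) inv

    w²k : w * w * k ≡ D
    w²k = by₂ k D (solve 4 (λ k u p i → u :* u :* k :+ p
        := k :* (u :* u :+ p :* i) :+ p :* (k :* i :+ con true)) refl k w D (k ⁻¹))
      (√-square (D * k ⁻¹)) inv

    AS : ∃[ s ] s * s + s ≡ l₀ * D + 1#
    AS = artinSchreier (l₀ * D + 1#) (trans (Tr-+ (l₀ * D) 1#) (≡⇒+≡0 (trans tr′ (sym Tr-1))))
    s = proj₁ AS
    s²+s : s * s + s ≡ l₀ * D + 1#
    s²+s = proj₂ AS

    α-eq : ∀ x → (1# * (s * t + D) + t * s) * (l₀ + l₁ * x + l₂ * (x * (x * x))) ≡
                 (1# + k * x * (k * x * (k * x))) * (1# * 1#) + 1# * s + 1# * (s * s) + k * x * (u * u)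
    α-eq x = by₃ (x * (x * x)) 1# x
      (solve 9 (λ D l₀ l₁ l₂ k s t u x
          → (con true :* (s :* t :+ D) :+ t :* s) :* (l₀ :+ l₁ :* x :+ l₂ :* (x :* (x :* x)))
          :+ ((con true :+ k :* x :* (k :* x :* (k :* x))) :* (con true :* con true) :+ con true :* s
          :+ con true :* (s :* s) :+ k :* x :* (u :* u))
          := x :* (x :* x) :* (k :* (k :* k) :+ D :* l₂)
          :+ con true :* (s :* s :+ s :+ (l₀ :* D :+ con true)) :+ x :* (k :* (u :* u) :+ D :* l₁)) refl D
          l₀ l₁ l₂ k s t u x)
      k³ s²+s ku²

    β-eq : ∀ x → (1# * (s * t + D) + t * s) * (m₀ + m₁ * x + m₂ * (x * (x * x))) ≡
                 (1# + k * x * (k * x * (k * x))) * (t * t) + t * (s * t + D)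
                     + 1# * ((s * t + D) * (s * t + D)) + k * x * (v * v)
    β-eq x = by₃ (x * (x * x)) (t * t) x
      (solve 9 (λ m₀ m₁ m₂ l₀ k s t v x
          → (con true :* (s :* t :+ (m₀ :+ t :+ t :* t :* l₀)) :+ t :* s) :* (m₀ :+ m₁ :* x
          :+ m₂ :* (x :* (x :* x))) :+ ((con true :+ k :* x :* (k :* x :* (k :* x))) :* (t :* t)
          :+ t :* (s :* t :+ (m₀ :+ t :+ t :* t :* l₀))
          :+ con true :* ((s :* t :+ (m₀ :+ t :+ t :* t :* l₀)) :* (s :* t :+ (m₀ :+ t :+ t :* t :* l₀)))
          :+ k :* x :* (v :* v)) := x :* (x :* x) :* (t :* t :* (k :* (k :* k))
          :+ (m₀ :+ t :+ t :* t :* l₀) :* m₂)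
          :+ t :* t :* (s :* s :+ s :+ (l₀ :* (m₀ :+ t :+ t :* t :* l₀) :+ con true))
          :+ x :* (k :* (v :* v) :+ (m₀ :+ t :+ t :* t :* l₀) :* m₁)) refl m₀ m₁ m₂ l₀ k s t v x)
      (by₂ (t * t) D (solve 5 (λ t k D l m → t :* t :* (k :* (k :* k)) :+ D :* m
          := t :* t :* (k :* (k :* k) :+ D :* l) :+ D :* (t :* t :* l :+ m)) refl t k D l₂ m₂) k³ t²)
      s²+s kv²

    l-eq : ∀ x → (1# * (s * t + D) + t * s) * x ≡ w * w * (k * x)
    l-eq x = by₁ x (solve 6 (λ s t D w k x
        → (con true :* (s :* t :+ D) :+ t :* s) :* x :+ w :* w :* (k :* x) := x :* (w :* w :* k :+ D)) refl
        s t D w k x) w²k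

    -- k³e = D l₂ e consists of the mixed part and l₂ t e. The square of the latter is l₂ m₂ e²,
    -- because t² l₂ = m₂, and the trace does not distinguish an element from its square.
    polar : ∀ e → Tr (k * (k * k) * e) ≡ Tr ((l₀ * m₂ + l₂ * m₀) * e + l₂ * m₂ * (e * e))
    polar e = begin
      Tr (k * (k * k) * e)
        ≡⟨ cong Tr (by₂ e (l₀ * e) (solve 7
            (λ l₀ l₂ m₀ m₂ t k e → k :* (k :* k) :* e :+ ((l₀ :* m₂ :+ l₂ :* m₀) :* e :+ l₂ :* t :* e)
            := e :* (k :* (k :* k) :+ (m₀ :+ t :+ t :* t :* l₀) :* l₂) :+ l₀ :* e :* (t :* t :* l₂ :+ m₂))
            refl l₀ l₂ m₀ m₂ t k e) k³ t²) ⟩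
      Tr ((l₀ * m₂ + l₂ * m₀) * e + l₂ * t * e)
        ≡⟨ Tr-+ _ _ ⟩
      Tr ((l₀ * m₂ + l₂ * m₀) * e) + Tr (l₂ * t * e)
        ≡⟨ cong (Tr ((l₀ * m₂ + l₂ * m₀) * e) +_) (Tr-square (l₂ * t * e)) ⟨
      Tr ((l₀ * m₂ + l₂ * m₀) * e) + Tr (l₂ * t * e * (l₂ * t * e))
        ≡⟨ cong (λ q → Tr ((l₀ * m₂ + l₂ * m₀) * e) + Tr q)
             (by₁ (l₂ * (e * e)) (solve 4 (λ l₂ m₂ t e
                 → l₂ :* t :* e :* (l₂ :* t :* e) :+ l₂ :* m₂ :* (e :* e)
                 := l₂ :* (e :* e) :* (t :* t :* l₂ :+ m₂)) refl l₂ m₂ t e) t²) ⟩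
      Tr ((l₀ * m₂ + l₂ * m₀) * e) + Tr (l₂ * m₂ * (e * e))
        ≡⟨ Tr-+ ((l₀ * m₂ + l₂ * m₀) * e) (l₂ * m₂ * (e * e)) ⟨
      Tr ((l₀ * m₂ + l₂ * m₀) * e + l₂ * m₂ * (e * e)) ∎
      where open ≡-Reasoning

  -- Interchanging x and y interchanges α and β, hence the columns of the block. This settles the
  -- case l₂ = 0, m₂ ≠ 0.
  swap : ∀ {l m} → Normalisation m l → Normalisation l m
  swap {l₀ , l₁ , l₂} {m₀ , m₁ , m₂} n = record
    { N = shear b a d c v u w
    ; k = k
    ; det≢0 = λ eq → det≢0 (trans det-swap eq)
    ; w≢0 = w≢0
    ; k≢0 = k≢0
    ; maps-x = λ x → maps
        (trans (cong (_* coefficient (l₀ , l₁ , l₂) x) (sym det-swap)) (Maps.β-eq (maps-x x)))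
        (trans (cong (_* coefficient (m₀ , m₁ , m₂) x) (sym det-swap)) (Maps.α-eq (maps-x x)))
        (trans (cong (_* x) (sym det-swap)) (Maps.l-eq (maps-x x)))
    ; polar = λ t → trans (polar t)
        (cong Tr (solve 5 (λ l₀ l₂ m₀ m₂ t → (m₀ :* l₂ :+ m₂ :* l₀) :* t :+ m₂ :* l₂ :* (t :* t)
        := (l₀ :* m₂ :+ l₂ :* m₀) :* t :+ l₂ :* m₂ :* (t :* t)) refl l₀ l₂ m₀ m₂ t))
    }
    where
    open Normalisation n
    open Shear N
    det-swap : a * d + b * c ≡ b * c + a * d
    det-swap = solve 2 (λ p q → p :+ q := q :+ p) refl (a * d) (b * c)

-- The degree determines the number of conics

module _ (A : Setoid 0ℓ 0ℓ) where

  open Setoid A using (_≈_) renaming (sym to ≈-sym)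
  open SetoidUnique A using () renaming (Unique to Unique′)
  open SetoidMembership A using () renaming (_∈_ to _∈′_)

  lookup-injective : ∀ {xs} → Unique′ xs → ∀ i j → List.lookup xs i ≈ List.lookup xs j → i ≡ j
  lookup-injective (x∉ ∷ u) zero    zero    eq = refl
  lookup-injective (x∉ ∷ u) zero    (suc j) eq = ⊥-elim (All.lookup x∉ (∈-lookup j) eq)
  lookup-injective (x∉ ∷ u) (suc i) zero    eq = ⊥-elim (All.lookup x∉ (∈-lookup i) (≈-sym eq))
  lookup-injective (x∉ ∷ u) (suc i) (suc j) eq = cong suc (lookup-injective u i j eq)

  -- Positions in `ys` give an injection of finite sets. It is stated for setoids because equality
  -- of points is proportionality.
  unique-⊆⇒length≤ : ∀ {xs ys} → Unique′ xs → All (_∈′ ys) xs → length xs ≤ length ys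
  unique-⊆⇒length≤ {xs} {ys} u xs⊆ys = Fin.injective⇒≤ {f = position} (λ {i} {j} eq →
    lookup-injective u i j (SetoidMembershipProperties.index-injective A (member i) (member j) eq))
    where
    member : ∀ i → List.lookup xs i ∈′ ys
    member i = All.lookup xs⊆ys (∈-lookup i)
    position : Fin (length xs) → Fin (length ys)
    position i = Any.index (member i)

All-⊎ : ∀ {A B : Set} {P : Pred A 0ℓ} {xs} → All (λ x → P x ⊎ B) xs → All P xs ⊎ B
All-⊎ []            = inj₁ []
All-⊎ (inj₂ y ∷ _)  = inj₂ y
All-⊎ (inj₁ x ∷ xs) = Sum.map₁ (x ∷_) (All-⊎ xs)

module Extraction {h : ℕ} (𝔽 : BinaryField h) (O : OddField 𝔽) where

  open BinaryField 𝔽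
  open OddField O
  open OddFieldProperties 𝔽 O
  open ProjectivePlane 𝔽
  open MathonArcs 𝔽
  open Geometry 𝔽 O
  open Span 𝔽 O
  open CubicArcs 𝔽 O using (Φ-≈)
  open NormalForm 𝔽 O

  private
    module ≈ₚ = Setoid pointSetoid
  open SetoidMembership pointSetoid using () renaming (_∈_ to _∈ₚ_)
  open SetoidUnique pointSetoid using () renaming (Unique to Uniqueₚ)

  F-cong : ∀ {α β l α′ β′ l′} → α ≡ α′ → β ≡ β′ → l ≡ l′ → F α β l ≡ F α′ β′ l′
  F-cong refl refl refl = refl

  _≟ᶜ_ : (c d : Conic) → Dec (c ≡ d)
  F α β l ≟ᶜ F α′ β′ l′ = map′
    (λ (eqα , eqβ , eql) → F-cong eqα eqβ eql) (λ { refl → refl , refl , refl })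
    ((α ≟ α′) ×-dec (β ≟ β′) ×-dec (l ≟ l′))

  ·-row₂ : ∀ M v → Vec.head (Vec.tail (M · v)) ≡ Vec.head (Vec.tail M) ∙ v
  ·-row₂ (_ ∷ _ ∷ _ ∷ []) v = refl

  module _ (S : PointSet) (max : IsMaximalArc 8 S) (C : Pred Conic 0ℓ) (closed : IsClosed C)
           (g : GL₃) (arises : ∀ p → (S ∋ p) ⇔ ConicUnion C (projectivity g p)) where

    open IsClosed closed
    open GL₃ g

    g⁻¹ : Point → Point
    g⁻¹ = projectivity (record { matrix = inverse ; inverse = matrix ; inverseˡ = inverseʳ ; inverseʳ
        = inverseˡ })

    gg⁻¹ : ∀ p → coords (projectivity g (g⁻¹ p)) ≡ coords p
    gg⁻¹ (point v _) = inverseʳ v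

    g⁻¹g : ∀ p → coords (g⁻¹ (projectivity g p)) ≡ coords p
    g⁻¹g (point v _) = inverseˡ v

    y-coordinate : Point → Carrier
    y-coordinate p = Vec.head (Vec.tail (coords p))

    -- The preimage of the line y = 0, which passes through F₀ and is tangent to every conic of C.
    -- Its 8 points in the arc are thus the preimage of F₀ and one point for each conic.
    ℓ : Line
    ℓ = point (Vec.head (Vec.tail matrix)) (λ eq → 0≢1 (begin
      0#                                        ≡⟨ 0ᵥ∙ (inverse · e₂) ⟨
      0ᵥ ∙ (inverse · e₂)                       ≡⟨ cong (_∙ (inverse · e₂)) eq ⟨
      Vec.head (Vec.tail matrix) ∙ (inverse · e₂) ≡⟨ ·-row₂ matrix (inverse · e₂) ⟨
      Vec.head (Vec.tail (matrix · (inverse · e₂))) ≡⟨ cong (Vec.head ∘ Vec.tail) (inverseʳ e₂) ⟩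
      1#                                        ∎))
      where
      open ≡-Reasoning
      e₂ : Vec₃
      e₂ = 0# ∷ 1# ∷ 0# ∷ []
      0ᵥ∙ : ∀ v → 0ᵥ ∙ v ≡ 0#
      0ᵥ∙ (x ∷ y ∷ z ∷ []) = solve 3
          (λ x y z → con false :* x :+ con false :* y :+ con false :* z := con false) refl x y z

    onLine : ∀ p → OnLine ℓ p ≡ (y-coordinate (projectivity g p) ≡ 0#)
    onLine (point v _) = cong (_≡ 0#) (sym (·-row₂ matrix v))

    Z : Conic → Point
    Z (F α β l) = point (1# ∷ 0# ∷ √ (α * l ⁻¹) ∷ []) (λ eq → 0≢1 (sym (cong Vec.head eq)))

    Z∈ : ∀ c → Conic.l c ≢ 0# → Φ c (coords (Z c)) ≡ 0#
    Z∈ (F α β l) l≢0 = by₂ l α (solve 5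
        (λ α β l i z → (α :* (con true :* con true) :+ con true :* con false
        :+ β :* (con false :* con false) :+ l :* (z :* z)) :+ con false
        := l :* (z :* z :+ α :* i) :+ α :* (l :* i :+ con true)) refl α β l (l ⁻¹) (√ (α * l ⁻¹)))
        (√-square (α * l ⁻¹)) (*-inverseʳ l l≢0)

    ≈Z : ∀ c → Conic.l c ≢ 0# → ∀ p → y-coordinate p ≡ 0# → Φ c (coords p) ≡ 0# → p ≈ₚ Z c
    ≈Z (F α β l) l≢0 (point (x ∷ y ∷ z ∷ []) p≢0) refl on = x ⁻¹ , ⁻¹≢0 x x≢0 ,
      ∷³ (sym (*-inverseˡ x x≢0)) (sym (zeroʳ _)) (square-injective (*-cancelˡ l l≢0
        (by₃ l α (x ⁻¹ * x ⁻¹) (solve 8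
            (λ α β l i j x z w → l :* (w :* w) :+ l :* (j :* z :* (j :* z))
            := l :* (w :* w :+ α :* i) :+ α :* (l :* i :+ con true :+ (j :* j :* (x :* x) :+ con true)
            :+ con false) :+ j :* j :* ((α :* (x :* x) :+ x :* con false :+ β :* (con false :* con false)
            :+ l :* (z :* z)) :+ con false)) refl
          α β l (l ⁻¹) (x ⁻¹) x z (√ (α * l ⁻¹)))
          (√-square (α * l ⁻¹))
          (trans (cong₂ _+_ (≡⇒+≡0 (*-inverseʳ l l≢0)) (≡⇒+≡0 j²x²)) (+-identityˡ 0#))
          on)))
      where
      x≢0 : x ≢ 0#
      x≢0 refl = p≢0 (cong (λ z → 0# ∷ 0# ∷ z ∷ []) (square≡0 (*≡0⇒ʳ l≢0
        (trans (solve 4 (λ α β l z → l :* (z :* z)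
            := α :* (con false :* con false) :+ con false :* con false :+ β :* (con false :* con false)
            :+ l :* (z :* z)) refl α β l z) on))))
      j²x² : x ⁻¹ * x ⁻¹ * (x * x) ≡ 1#
      j²x² = by₁ (x * x ⁻¹ + 1#) (solve 2
          (λ x j → j :* j :* (x :* x) :+ con true := (x :* j :+ con true) :* (x :* j :+ con true)) refl x
          (x ⁻¹)) (*-inverseʳ x x≢0)

    conics-apart : ∀ {c d} → C c → C d → c ≢ d → ∀ p → Φ c (coords p) ≡ 0# → Φ d (coords p) ≢ 0#
    conics-apart {c@(F α β l)} {d@(F α′ β′ l′)} Cc Cd c≢d p = conics-disjoint l≢l′
      (quotient (α * l + α′ * l′)) (quotient (β * l + β′ * l′))
      (trans (cong₂ _+_ (cong₂ _+_ (trace-one Cc) (trace-one Cd)) (trace-one (⊕-closed Cc Cd c≢d)))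
        (trans (cong (_+ 1#) (x+x≡0 1#)) (+-identityˡ 1#)))
      (coords p) (nonzero p)
      where
      l≢l′ = l-distinct Cc Cd c≢d
      quotient : ∀ q → (l + l′) * (q * (l + l′) ⁻¹) ≡ q
      quotient q = by₁ q (solve 3 (λ s q i → s :* (q :* i) :+ q := q :* (s :* i :+ con true)) refl (l + l′)
          q ((l + l′) ⁻¹)) (*-inverseʳ _ (l≢l′ ∘ +≡0⇒≡))

    Z-injective : ∀ {c d} → C c → C d → Z c ≈ₚ Z d → c ≡ d
    Z-injective {c} {d} Cc Cd Zc≈Zd with c ≟ᶜ d
    ... | yes c≡d = c≡d
    ... | no  c≢d = ⊥-elim (conics-apart Cc Cd c≢d (Z c) (Z∈ c (l-nonzero Cc))
                      (Equivalence.to (Φ-≈ d (Z c) (Z d) Zc≈Zd) (Z∈ d (l-nonzero Cd))))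

    F₀≉Z : ∀ c → ¬ F₀ ≈ₚ Z c
    F₀≉Z (F _ _ _) (k , _ , eq) = 0≢1 (trans (sym (zeroʳ k)) (sym (cong Vec.head eq)))

    meets : HasCardinality ((S ∋_) ∩ OnLine ℓ) 8
    meets = Sum.[ (λ card → ⊥-elim (empty card (g⁻¹ F₀) F₀∈)) , (λ card → card) ]′ (proj₂ (proj₂ max) ℓ)
      where
      empty : HasCardinality ((S ∋_) ∩ OnLine ℓ) 0 → ∀ p → ¬ ((S ∋_) ∩ OnLine ℓ) p
      empty ([] , _ , _ , mem) p p∈ with Equivalence.to (mem p) p∈
      ... | ()
      F₀∈ : ((S ∋_) ∩ OnLine ℓ) (g⁻¹ F₀)
      F₀∈ = Equivalence.from (arises (g⁻¹ F₀))
          (inj₁ (Equivalence.from (≈F₀⇔Nucleus (projectivity g (g⁻¹ F₀)))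
          (subst Nucleus (sym (gg⁻¹ F₀)) (refl , refl)))) ,
            subst (λ A → A) (sym (onLine (g⁻¹ F₀))) (cong (Vec.head ∘ Vec.tail) (gg⁻¹ F₀))

    points : List Point
    points = proj₁ meets

    -- Distinct conics of C are disjoint, so their points on ℓ differ from each other and from the
    -- preimage of F₀.
    at-most-7 : ∀ {cs} → Unique cs → All C cs → length cs ≤ 7
    at-most-7 {cs} u Ccs = ℕ.s≤s⁻¹ (subst₂ _≤_ (cong suc (length-map (g⁻¹ ∘ Z) cs)) (proj₁ (proj₂ meets))
      (unique-⊆⇒length≤ pointSetoid unique inside))
      where
      image : Conic → Point
      image c = g⁻¹ (Z c)

      g⁻¹-injective : ∀ p q → g⁻¹ p ≈ₚ g⁻¹ q → p ≈ₚ q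
      g⁻¹-injective p q (k , k≢0 , eq) = k , k≢0 ,
        trans (sym (gg⁻¹ q)) (trans (cong (matrix ·_) eq) (trans (·-• matrix k _) (cong (k •_) (gg⁻¹ p))))

      go : ∀ {cs} → Unique cs → All C cs → Uniqueₚ (map image cs)
      go []       []         = []
      go {c ∷ _} (c∉ ∷ u) (Cc ∷ Ccs)
          = All.map⁺ (All.zipWith (λ {d} (c≢d , Cd) e
          → c≢d (Z-injective Cc Cd (g⁻¹-injective (Z c) (Z d) e))) (c∉ , Ccs)) ∷ go u Ccs

      unique : Uniqueₚ (g⁻¹ F₀ ∷ map image cs)
      unique = All.map⁺ (All.universal (λ c e → F₀≉Z c (g⁻¹-injective F₀ (Z c) e)) cs) ∷ go u Ccs

      mem : ∀ p → ConicUnion C p → y-coordinate p ≡ 0# → g⁻¹ p ∈ₚ points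
      mem p p∈ y≡0 = Equivalence.to (proj₂ (proj₂ (proj₂ meets)) (g⁻¹ p))
        (Equivalence.from (arises (g⁻¹ p)) (∈-resp p∈) ,
         subst (λ A → A) (sym (onLine (g⁻¹ p))) (trans (cong (Vec.head ∘ Vec.tail) (gg⁻¹ p)) y≡0))
        where
        ∈-resp : ConicUnion C p → ConicUnion C (projectivity g (g⁻¹ p))
        ∈-resp (inj₁ ≈F₀) = inj₁ (Equivalence.from (≈F₀⇔Nucleus (projectivity g (g⁻¹ p)))
            (subst Nucleus (sym (gg⁻¹ p)) (Equivalence.to (≈F₀⇔Nucleus p) ≈F₀)))
        ∈-resp (inj₂ (c , Cc , on)) = inj₂ (c , Cc , Equivalence.from (OnConic⇔Φ c (projectivity g (g⁻¹ p)))
          (trans (cong (Φ c) (gg⁻¹ p)) (Equivalence.to (OnConic⇔Φ c p) on)))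

      inside : All (_∈ₚ points) (g⁻¹ F₀ ∷ map image cs)
      inside = mem F₀ (inj₁ (≈ₚ.refl {F₀})) refl ∷ All.map⁺ (All.map (λ {c} Cc → mem (Z c)
        (inj₂ (c , Cc , Equivalence.from (OnConic⇔Φ c (Z c)) (Z∈ c (l-nonzero Cc)))) (Z-y c)) Ccs)
        where
        Z-y : ∀ c → y-coordinate (Z c) ≡ 0#
        Z-y (F _ _ _) = refl

    -- The search runs through the eight points of the arc on ℓ, since C is only a predicate. If all
    -- of them came from F₀ and the conics in `ks`, there would be at most 7.
    another : ∀ ks → length ks < 7 → ∃[ c ] C c × ¬ (c ∈ ks)
    another ks bound = Sum.[ (λ all → ⊥-elim (ℕ.<⇒≱ bound (ℕ.s≤s⁻¹ (subst₂ _≤_ (proj₁ (proj₂ meets))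
        (cong suc (length-map (g⁻¹ ∘ Z) ks))
            (unique-⊆⇒length≤ pointSetoid (proj₁ (proj₂ (proj₂ meets))) all)))))
      , (λ found → found) ]′ (All-⊎ (All.tabulateₛ pointSetoid (λ {p} → step p)))
      where
      New : Set
      New = ∃[ c ] C c × ¬ (c ∈ ks)

      pull-back : ∀ p q → projectivity g p ≈ₚ q → p ≈ₚ g⁻¹ q
      pull-back p q (k , k≢0 , eq) = k , k≢0 , trans (cong (inverse ·_) eq)
          (trans (·-• inverse k _) (cong (k •_) (g⁻¹g p)))

      cases : ∀ p → y-coordinate (projectivity g p) ≡ 0# → ConicUnion C (projectivity g p) →
              p ∈ₚ (g⁻¹ F₀ ∷ map (g⁻¹ ∘ Z) ks) ⊎ New
      cases p y≡0 (inj₁ ≈F₀) = inj₁ (here (pull-back p F₀ ≈F₀))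
      cases p y≡0 (inj₂ (c , Cc , on)) with Any.any? (c ≟ᶜ_) ks
      ... | yes c∈ = inj₁ (there (Any.map⁺ (Any.map (λ { refl →
              pull-back p (Z c) (≈Z c (l-nonzero Cc) (projectivity g p) y≡0
                  (Equivalence.to (OnConic⇔Φ c (projectivity g p)) on)) }) c∈)))
      ... | no  c∉ = inj₂ (c , Cc , c∉)

      step : ∀ p → p ∈ₚ points → p ∈ₚ (g⁻¹ F₀ ∷ map (g⁻¹ ∘ Z) ks) ⊎ New
      step p p∈ = cases p (subst (λ A → A) (onLine p) (proj₂ Sp)) (Equivalence.to (arises p) (proj₁ Sp))
        where
        Sp : ((S ∋_) ∩ OnLine ℓ) p
        Sp = Equivalence.from (proj₂ (proj₂ (proj₂ meets)) p) p∈

-- Closed sets of seven conics as families over a parameter space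

module ClosedSets {h : ℕ} (𝔽 : BinaryField h) (O : OddField 𝔽) where

  open BinaryField 𝔽
  open OddField O
  open OddFieldProperties 𝔽 O
  open ProjectivePlane 𝔽
  open MathonArcs 𝔽
  open Geometry 𝔽 O
  open Span 𝔽 O
  open CubicArcs 𝔽 O
  open NormalForm 𝔽 O
  open Extraction 𝔽 O

  record IsFamily (C : Pred Conic 0ℓ) : Set where
    field
      e l m       : Carrier³
      independent : Independent e
      family-⊆    : ∀ {b} → b ≢ 0ᵇ → C (family l m (comb e b))
      ⊆-family    : ∀ {c} → C c → Indexed (λ b → c ≡ family l m (comb e b))

  module _ (C : Pred Conic 0ℓ) (closed : IsClosed C)
           (at-most-7 : ∀ {cs} → Unique cs → All C cs → length cs ≤ 7)
           (another : ∀ ks → length ks < 7 → ∃[ c ] C c × ¬ (c ∈ ks)) where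

    open IsClosed closed

    -- Composition adds the triples (λ, αλ, βλ), so αλ and βλ are recorded instead of α and β.
    record Member (e p q : Carrier³) (b : Bits) (conic : Conic) : Set where
      constructor member
      field
        ∈C    : C conic
        l≡    : Conic.l conic ≡ comb e b
        αl≡   : Conic.α conic * Conic.l conic ≡ comb p b
        βl≡   : Conic.β conic * Conic.l conic ≡ comb q b

    open Member

    ⊕-member : ∀ e p q {b b′ c c′} → Member e p q b c → Member e p q b′ c′ → comb e b ≢ comb e b′ →
               Member e p q (b ⊞ b′) (c ⊕ c′)
    ⊕-member e p q {b} {b′} {c@(F α β l)} {c′@(F α′ β′ l′)} (member Cc refl αl βl) (member Cc′ refl αl′ βl′)
        l≢l′ =
      member (⊕-closed Cc Cc′ (l≢l′ ∘ cong Conic.l)) (sym (comb-⊞ e b b′))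
        (quotient αl αl′ (sym (comb-⊞ p b b′))) (quotient βl βl′ (sym (comb-⊞ q b b′)))
      where
      quotient : ∀ {x y z t s} → x ≡ z → y ≡ t → z + t ≡ s → (x + y) * (l + l′) ⁻¹ * (l + l′) ≡ s
      quotient {x} {y} refl refl refl
          = by₁ (x + y) (solve 4 (λ x y s i → (x :+ y) :* i :* s :+ (x :+ y)
          := (x :+ y) :* (s :* i :+ con true)) refl x y (l + l′) ((l + l′) ⁻¹))
        (*-inverseʳ _ (l≢l′ ∘ +≡0⇒≡))

    record Basis : Set where
      field
        e p q       : Carrier³
        independent : Independent e
        members     : ∀ {b} → b ≢ 0ᵇ → ∃[ c ] Member e p q b c

    basis-of : ∀ c₁ c₂ c₃ → C c₁ → C c₂ → C c₃ → (c₁≢c₂ : c₁ ≢ c₂) → ¬ (c₃ ∈ c₁ ∷ c₂ ∷ c₁ ⊕ c₂ ∷ []) → Basis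
    basis-of c₁@(F α₁ β₁ l₁) c₂@(F α₂ β₂ l₂) c₃@(F α₃ β₃ l₃) C₁ C₂ C₃ c₁≢c₂ c₃∉ = record
      { e = e ; p = p ; q = q
      -- Every nonzero combination is the parameter λ of a member of C, hence nonzero.
      ; independent = λ b b≢0 eq → l-nonzero (∈C (proj₂ (members b≢0)))
          (trans (l≡ (proj₂ (members b≢0))) eq)
      ; members = members }
      where
      e = l₁ , l₂ , l₃
      p = α₁ * l₁ , α₂ * l₂ , α₃ * l₃
      q = β₁ * l₁ , β₂ * l₂ , β₃ * l₃
      M : Bits → Conic → Set
      M = Member e p q
      m₁ : M b₁ c₁
      m₁ = member C₁ (sym (comb-b₁ e)) (sym (comb-b₁ p)) (sym (comb-b₁ q))
      m₂ : M b₂ c₂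
      m₂ = member C₂ (sym (comb-b₂ e)) (sym (comb-b₂ p)) (sym (comb-b₂ q))
      m₃ : M b₃ c₃
      m₃ = member C₃ (sym (comb-b₃ e)) (sym (comb-b₃ p)) (sym (comb-b₃ q))
      apart : ∀ {b b′ c c′} → M b c → M b′ c′ → c ≢ c′ → comb e b ≢ comb e b′
      apart m m′ c≢c′ eq = l-distinct (∈C m) (∈C m′) c≢c′ (trans (l≡ m) (trans eq (sym (l≡ m′))))
      1≢2 : comb e b₁ ≢ comb e b₂
      1≢2 = apart m₁ m₂ c₁≢c₂
      1≢3 : comb e b₁ ≢ comb e b₃
      1≢3 = apart m₁ m₃ (λ eq → c₃∉ (here (sym eq)))
      2≢3 : comb e b₂ ≢ comb e b₃
      2≢3 = apart m₂ m₃ (λ eq → c₃∉ (there (here (sym eq))))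
      m₁₂ : M (b₁ ⊞ b₂) (c₁ ⊕ c₂)
      m₁₂ = ⊕-member e p q m₁ m₂ 1≢2
      12≢3 : comb e (b₁ ⊞ b₂) ≢ comb e b₃
      12≢3 = apart m₁₂ m₃ (λ eq → c₃∉ (there (there (here (sym eq)))))
      members : ∀ {b} → b ≢ 0ᵇ → ∃[ c ] M b c
      members {false , false , false} b≢0 = ⊥-elim (b≢0 refl)
      members {true  , false , false} _   = _ , m₁
      members {false , true  , false} _   = _ , m₂
      members {true  , true  , false} _   = _ , m₁₂
      members {false , false , true}  _   = _ , m₃
      members {true  , false , true}  _   = _ , ⊕-member e p q m₁ m₃ 1≢3
      members {false , true  , true}  _   = _ , ⊕-member e p q m₂ m₃ 2≢3
      members {true  , true  , true}  _   = _ , ⊕-member e p q m₁₂ m₃ 12≢3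

    basis : Basis
    basis = step₁ (another [] (s≤s z≤n))
      where
      step₃ : ∀ c₁ c₂ → C c₁ → C c₂ → c₁ ≢ c₂ → ∃[ c ] C c × ¬ (c ∈ c₁ ∷ c₂ ∷ c₁ ⊕ c₂ ∷ []) → Basis
      step₃ c₁ c₂ C₁ C₂ c₁≢c₂ (c₃ , C₃ , c₃∉) = basis-of c₁ c₂ c₃ C₁ C₂ C₃ c₁≢c₂ c₃∉
      step₂ : ∀ c₁ → C c₁ → ∃[ c ] C c × ¬ (c ∈ c₁ ∷ []) → Basis
      step₂ c₁ C₁ (c₂ , C₂ , c₂∉) = step₃ c₁ c₂ C₁ C₂ (λ eq → c₂∉ (here (sym eq)))
        (another (c₁ ∷ c₂ ∷ c₁ ⊕ c₂ ∷ []) (s≤s (s≤s (s≤s (s≤s z≤n)))))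
      step₁ : ∃[ c ] C c × ¬ (c ∈ []) → Basis
      step₁ (c₁ , C₁ , _) = step₂ c₁ C₁ (another (c₁ ∷ []) (s≤s (s≤s z≤n)))

    open Basis basis

    collect : ∀ {bs} → Unique bs → All (_≢ 0ᵇ) bs →
              ∃[ cs ] length cs ≡ length bs × Unique cs × All C cs
                  × All (λ c → Any (λ b → Conic.l c ≡ comb e b) bs) cs
    collect []       []            = [] , refl , [] , [] , []
    collect (b∉ ∷ u) (b≢0 ∷ bs≢0) with collect u bs≢0 | members b≢0
    ... | cs , len , ucs , Ccs , ls | c , member Cc lc _ _ =
      c ∷ cs , cong suc len ,
      All.map (λ {d} ld c≡d → All.All¬⇒¬Any (All.map (λ b≢b′ ld≡ → b≢b′ (comb-injective independent
        (trans (sym lc) (trans (cong Conic.l c≡d) ld≡)))) b∉) ld) ls ∷ ucs ,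
      Cc ∷ Ccs , here lc ∷ All.map there ls

    -- A conic with its parameter outside the span would be an eighth one, next to the seven found
    -- by `collect`.
    l∈span : ∀ {c} → C c → Any (λ b → Conic.l c ≡ comb e b) nonzeroBits
    l∈span {c} Cc = decide (Any.any? (λ b → Conic.l c ≟ comb e b) nonzeroBits)
        (collect nonzeroBits-unique nonzeroBits-≢0)
      where
      decide : Dec (Any (λ b → Conic.l c ≡ comb e b) nonzeroBits) →
        ∃[ cs ] length cs ≡ 7 × Unique cs × All C cs
            × All (λ c → Any (λ b → Conic.l c ≡ comb e b) nonzeroBits) cs →
        Any (λ b → Conic.l c ≡ comb e b) nonzeroBits
      decide (yes l∈) _ = l∈
      decide (no  l∉) (cs , len , ucs , Ccs , ls) = ⊥-elim (ℕ.1+n≰n (subst (λ n → suc n ≤ 7) len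
        (at-most-7 (All.map (λ {d} ld c≡d
            → l∉ (subst (λ c → Any (λ b → Conic.l c ≡ comb e b) nonzeroBits) (sym c≡d) ld)) ls ∷ ucs)
            (Cc ∷ Ccs))))

    ⊆members : ∀ {c} → C c → Indexed (λ b → ∃[ b≢0 ] c ≡ proj₁ (members {b} b≢0))
    ⊆members {c} Cc = let (b , b∈ , lc) = find (l∈span Cc) in
      b , All.lookup nonzeroBits-≢0 b∈ , All.lookup nonzeroBits-≢0 b∈ ,
      equal (members (All.lookup nonzeroBits-≢0 b∈)) lc
      where
      equal : ∀ {b} ((d , _) : ∃[ d ] Member e p q b d) → Conic.l c ≡ comb e b → c ≡ d
      equal (d , m) lc with c ≟ᶜ d
      ... | yes c≡ = c≡
      ... | no  c≢ = ⊥-elim (l-distinct Cc (∈C m) c≢ (trans lc (sym (l≡ m))))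

    L : ∃[ l ] ∀ b → additive l (comb e b) ≡ comb p b
    L = interpolation e independent p

    M : ∃[ m ] ∀ b → additive m (comb e b) ≡ comb q b
    M = interpolation e independent q

    conic≡family : ∀ {b c} → Member e p q b c → c ≡ family (proj₁ L) (proj₁ M) (comb e b)
    conic≡family {b} {F α β l} (member Cc refl αl βl)
        = F-cong (cancel (proj₁ L) (trans αl (sym (proj₂ L b))))
        (cancel (proj₁ M) (trans βl (sym (proj₂ M b)))) refl
      where
      cancel : ∀ {α} l → α * comb e b ≡ additive l (comb e b) → α ≡ coefficient l (comb e b)
      cancel {α} l eq = *-cancelˡ (comb e b) (l-nonzero Cc)
          (trans (*-comm _ α) (trans eq (trans (sym (coefficient-additive l (comb e b)))
          (*-comm _ (comb e b)))))

    isFamily : IsFamily C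
    isFamily = record
      { e = e ; l = proj₁ L ; m = proj₁ M
      ; independent = independent
      ; family-⊆ = λ b≢0 → subst C (conic≡family (proj₂ (members b≢0))) (∈C (proj₂ (members b≢0)))
      ; ⊆-family = λ Cc → let (b , b≢0 , b≢0′ , eq) = ⊆members Cc in b , b≢0 , trans eq (conic≡family (proj₂ (members b≢0′)))
      }

-- Every proper Mathon arc of degree 8 has a normal form

module Classification {h : ℕ} (𝔽 : BinaryField h) (O : OddField 𝔽) where

  open BinaryField 𝔽
  open OddField O
  open OddFieldProperties 𝔽 O
  open ProjectivePlane 𝔽
  open MathonArcs 𝔽
  open Geometry 𝔽 O
  open Span 𝔽 O
  open CubicArcs 𝔽 O
  open NormalForm 𝔽 O
  open Extraction 𝔽 O
  open ClosedSets 𝔽 O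

  rowTimes : Vec₃ → Matrix → Vec₃
  rowTimes (x ∷ y ∷ z ∷ []) ((a ∷ b ∷ c ∷ []) ∷ (a′ ∷ b′ ∷ c′ ∷ []) ∷ (a″ ∷ b″ ∷ c″ ∷ []) ∷ []) =
    (x * a + y * a′ + z * a″) ∷ (x * b + y * b′ + z * b″) ∷ (x * c + y * c′ + z * c″) ∷ []

  infixl 7 _⊛_
  _⊛_ : Matrix → Matrix → Matrix
  M ⊛ N = Vec.map (λ r → rowTimes r N) M

  ⊛-· : ∀ M N v → (M ⊛ N) · v ≡ M · (N · v)
  ⊛-· (r ∷ s ∷ t ∷ []) ((a ∷ b ∷ c ∷ []) ∷ (a′ ∷ b′ ∷ c′ ∷ []) ∷ (a″ ∷ b″ ∷ c″ ∷ []) ∷ []) (x ∷ y ∷ z ∷ [])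
      =
    ∷³ (eq r) (eq s) (eq t)
    where
    N = (a ∷ b ∷ c ∷ []) ∷ (a′ ∷ b′ ∷ c′ ∷ []) ∷ (a″ ∷ b″ ∷ c″ ∷ []) ∷ []
    eq : ∀ r → rowTimes r N ∙ (x ∷ y ∷ z ∷ []) ≡ r ∙ (N · (x ∷ y ∷ z ∷ []))
    eq (p ∷ q ∷ r ∷ []) = solve 15
        (λ p q r a b c a′ b′ c′ a″ b″ c″ x y z
        → (p :* a :+ q :* a′ :+ r :* a″) :* x :+ (p :* b :+ q :* b′ :+ r :* b″) :* y
        :+ (p :* c :+ q :* c′ :+ r :* c″) :* z
        := p :* (a :* x :+ b :* y :+ c :* z) :+ q :* (a′ :* x :+ b′ :* y :+ c′ :* z)
        :+ r :* (a″ :* x :+ b″ :* y :+ c″ :* z)) refl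
      p q r a b c a′ b′ c′ a″ b″ c″ x y z

  compose : GL₃ → GL₃ → GL₃
  compose M N = record
    { matrix   = M.matrix ⊛ N.matrix
    ; inverse  = N.inverse ⊛ M.inverse
    ; inverseˡ = λ v → trans (⊛-· N.inverse M.inverse _)
        (trans (cong (λ w → N.inverse · (M.inverse · w)) (⊛-· M.matrix N.matrix v))
                   (trans (cong (N.inverse ·_) (M.inverseˡ (N.matrix · v))) (N.inverseˡ v)))
    ; inverseʳ = λ v → trans (⊛-· M.matrix N.matrix _)
        (trans (cong (λ w → M.matrix · (N.matrix · w)) (⊛-· N.inverse M.inverse v))
                   (trans (cong (M.matrix ·_) (N.inverseʳ (M.inverse · v))) (M.inverseʳ v)))
    }
    where
    module M = GL₃ M
    module N = GL₃ N

  module _ (S : PointSet) (C : Pred Conic 0ℓ) (g : GL₃)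
      (arises : ∀ p → (S ∋ p) ⇔ ConicUnion C (projectivity g p))
           (e l m : Carrier³) (family-⊆ : ∀ {b} → b ≢ 0ᵇ → C (family l m (comb e b)))
           (⊆-family : ∀ {c} → C c → Indexed (λ b → c ≡ family l m (comb e b))) where

    open GL₃ g

    change-coordinates : ∀ N (D≢0 : det N ≢ 0#) (w≢0 : Shear.w N ≢ 0#) (c : Carrier → Conic) →
      (∀ x → Maps N (family l m x) (c x)) → ∀ p →
      (S ∋ p) ⇔ (Nucleus (coords (projectivity (compose (shearGL N D≢0 w≢0) g) p)) ⊎
                 Indexed (λ b → Φ (c (comb e b)) (coords (projectivity (compose (shearGL N D≢0 w≢0) g) p))
                     ≡ 0#))
    change-coordinates N D≢0 w≢0 c N-maps p@(point v _) = mk⇔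
      (λ p∈ → subst Q (sym (⊛-· (matrixOf N) matrix v)) (to (Equivalence.to (arises p) p∈)))
      (λ q → Equivalence.from (arises p) (from (subst Q (⊛-· (matrixOf N) matrix v) q)))
      where
      Q : Vec₃ → Set
      Q v = Nucleus v ⊎ Indexed (λ b → Φ (c (comb e b)) v ≡ 0#)
      gp = projectivity g p
      to : ConicUnion C gp → Q (matrixOf N · (matrix · v))
      to (inj₁ ≈F₀) = inj₁ (Equivalence.from (Nucleus-shear N D≢0 _) (Equivalence.to (≈F₀⇔Nucleus gp) ≈F₀))
      to (inj₂ (d , Cd , on)) with ⊆-family Cd
      ... | b , b≢0 , refl = inj₂ (b , b≢0 , Equivalence.from
          (Maps⇒on⇔ N D≢0 (N-maps (comb e b)) (matrix · v)) (Equivalence.to (OnConic⇔Φ d gp) on))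
      from : Q (matrixOf N · (matrix · v)) → ConicUnion C gp
      from (inj₁ nuc) = inj₁ (Equivalence.from (≈F₀⇔Nucleus gp)
          (Equivalence.to (Nucleus-shear N D≢0 (matrix · v)) nuc))
      from (inj₂ (b , b≢0 , on)) = inj₂ (_ , family-⊆ b≢0 ,
        Equivalence.from (OnConic⇔Φ _ gp)
            (Equivalence.to (Maps⇒on⇔ N D≢0 (N-maps (comb e b)) (matrix · v)) on))

  combs : Carrier³ → Pred Carrier 0ℓ
  combs e x = ∃[ b ] x ≡ comb e b

  combs? : ∀ e → Decidable (combs e)
  combs? e x = map′ Any.satisfied found (Any.any? (λ b → x ≟ comb e b) (0ᵇ ∷ nonzeroBits))
    where
    found : combs e x → Any (λ b → x ≡ comb e b) (0ᵇ ∷ nonzeroBits)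
    found (b , eq) with b ≟ᵇ 0ᵇ
    ... | yes refl = here eq
    ... | no  b≢0  = there (lose (∈-nonzeroBits b b≢0) eq)

  combs-subgroup : ∀ e → IsAdditiveSubgroup (combs e)
  combs-subgroup e@(x , y , z) = record
    { 0∈       = 0ᵇ , sym (solve 3
        (λ x y z → con false :* x :+ con false :* y :+ con false :* z := con false) refl x y z)
    ; +-closed = λ { (b , refl) (b′ , refl) → b ⊞ b′ , sym (comb-⊞ e b b′) }
    ; -‿closed = λ { (b , refl) → b , -‿identity _ }
    }

  pencil-shear : Carrier³ → Carrier³ → Shear
  pencil-shear (l₀ , l₁ , l₂) (m₀ , m₁ , m₂) = shear 1# 0# 0# m₀ (√ (m₀ * l₁)) (√ (m₀ * m₁)) (√ m₀)

  -- Without cubic terms, u and v absorb all dependence on λ, and scaling y by m₀ turns the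
  -- constants l₀, m₀ into l₀m₀, 1. Since l₀m₀ has trace 1 by `T≡1`, this becomes a Denniston
  -- pencil.
  pencil-maps : ∀ l m → proj₂ (proj₂ l) ≡ 0# → proj₂ (proj₂ m) ≡ 0# →
                ∀ x → Maps (pencil-shear l m) (family l m x) (F (proj₁ l * proj₁ m) 1# x)
  pencil-maps (l₀ , l₁ , l₂) (m₀ , m₁ , m₂) refl refl x = maps
    (by₁ x (solve 5 (λ l₀ l₁ m₀ x u
        → (con true :* m₀ :+ con false :* con false) :* (l₀ :+ l₁ :* x :+ con false :* (x :* (x :* x)))
        :+ (l₀ :* m₀ :* (con true :* con true) :+ con true :* con false
        :+ con true :* (con false :* con false) :+ x :* (u :* u)) := x :* (u :* u :+ m₀ :* l₁)) refl l₀ l₁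
        m₀ x (√ (m₀ * l₁))) (√-square (m₀ * l₁)))
    (by₁ x (solve 5 (λ l₀ m₀ m₁ x v
        → (con true :* m₀ :+ con false :* con false) :* (m₀ :+ m₁ :* x :+ con false :* (x :* (x :* x)))
        :+ (l₀ :* m₀ :* (con false :* con false) :+ con false :* m₀ :+ con true :* (m₀ :* m₀)
        :+ x :* (v :* v)) := x :* (v :* v :+ m₀ :* m₁)) refl l₀ m₀ m₁ x (√ (m₀ * m₁))) (√-square (m₀ * m₁)))
    (by₁ x (solve 3 (λ m₀ x w → (con true :* m₀ :+ con false :* con false) :* x :+ w :* w :* x
        := x :* (w :* w :+ m₀)) refl m₀ x (√ m₀)) (√-square m₀))

  record NormalArc (S : PointSet) : Set where
    field
      e           : Carrier³
      independent : Independent e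
      isotropic   : Isotropic e
      G           : GL₃
      ∋⇔          : ∀ p → (S ∋ p) ⇔ Arc.InArc e independent isotropic (projectivity G p)

  module _ (S : PointSet) (C : Pred Conic 0ℓ) (closed : IsClosed C) (fam : IsFamily C)
           (g : GL₃) (∋C : ∀ p → (S ∋ p) ⇔ ConicUnion C (projectivity g p))
               (¬denniston : ¬ IsDennistonType S) where

    open IsFamily fam renaming (independent to ind)
    open Traces e ind l m (λ b b≢0 → IsClosed.trace-one closed (family-⊆ b≢0))

    change : ∀ N (D≢0 : det N ≢ 0#) (w≢0 : Shear.w N ≢ 0#) (c : Carrier → Conic) →
      (∀ x → Maps N (family l m x) (c x)) → ∀ p →
      (S ∋ p) ⇔ (Nucleus (coords (projectivity (compose (shearGL N D≢0 w≢0) g) p)) ⊎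
                 Indexed (λ b → Φ (c (comb e b)) (coords (projectivity (compose (shearGL N D≢0 w≢0) g) p))
                     ≡ 0#))
    change = change-coordinates S C g ∋C e l m family-⊆ ⊆-family

    not-pencil : proj₂ (proj₂ l) ≡ 0# → proj₂ (proj₂ m) ≡ 0# → ⊥
    not-pencil l₂≡0 m₂≡0 = ¬denniston (l₀ * m₀ , combs e , T≡1 , combs? e , combs-subgroup e , G , λ p → mk⇔
      (λ p∈ → to p (Equivalence.to (∋⇔ p) p∈)) (λ q → Equivalence.from (∋⇔ p) (from p q)))
      where
      l₀ = proj₁ l
      m₀ = proj₁ m
      m₀≢0 : m₀ ≢ 0#
      m₀≢0 eq = 0≢1 (trans (sym Tr-0) (trans (cong Tr (sym (trans (cong (l₀ *_) eq) (zeroʳ l₀)))) T≡1))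
      N = pencil-shear l m
      D≢0 : det N ≢ 0#
      D≢0 eq = m₀≢0 (trans (solve 1 (λ x → x := con true :* x :+ con false :* con false) refl m₀) eq)
      G = compose (shearGL N D≢0 (√≢0 m₀≢0)) g
      c : Carrier → Conic
      c x = F (l₀ * m₀) 1# x
      ∋⇔ : ∀ p → (S ∋ p) ⇔ (Nucleus (coords (projectivity G p))
          ⊎ Indexed (λ b → Φ (c (comb e b)) (coords (projectivity G p)) ≡ 0#))
      ∋⇔ = change N D≢0 (√≢0 m₀≢0) c (pencil-maps l m l₂≡0 m₂≡0)
      to : ∀ p → Nucleus (coords (projectivity G p))
          ⊎ Indexed (λ b → Φ (c (comb e b)) (coords (projectivity G p)) ≡ 0#) →
           ConicUnion (DennistonConics (l₀ * m₀) (combs e)) (projectivity G p)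
      to p (inj₁ nuc) = inj₁ (Equivalence.from (≈F₀⇔Nucleus (projectivity G p)) nuc)
      to p (inj₂ (b , b≢0 , on)) = inj₂ (c (comb e b) , (comb e b , (b , refl) , ind b b≢0 , refl) ,
        Equivalence.from (OnConic⇔Φ (c (comb e b)) (projectivity G p)) on)
      from : ∀ p → ConicUnion (DennistonConics (l₀ * m₀) (combs e)) (projectivity G p) →
             Nucleus (coords (projectivity G p))
                 ⊎ Indexed (λ b → Φ (c (comb e b)) (coords (projectivity G p)) ≡ 0#)
      from p (inj₁ ≈F₀) = inj₁ (Equivalence.to (≈F₀⇔Nucleus (projectivity G p)) ≈F₀)
      from p (inj₂ (_ , (_ , (b , refl) , x≢0 , refl) , on)) =
        inj₂ (b , comb-≢0 {e} x≢0 , Equivalence.to (OnConic⇔Φ (c (comb e b)) (projectivity G p)) on)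

    normalised : Normalisation l m
    normalised = decide (proj₂ (proj₂ l) ≟ 0#) (proj₂ (proj₂ m) ≟ 0#)
      where
      decide : Dec (proj₂ (proj₂ l) ≡ 0#) → Dec (proj₂ (proj₂ m) ≡ 0#) → Normalisation l m
      decide (no l₂≢0)  _          = normalise l m l₂≢0 T≡1
      decide (yes _)    (no m₂≢0)  = swap {l} {m}
          (normalise m l m₂≢0 (trans (cong Tr (*-comm (proj₁ m) (proj₁ l))) T≡1))
      decide (yes l₂≡0) (yes m₂≡0) = ⊥-elim (not-pencil l₂≡0 m₂≡0)

    normalArc′ : NormalArc S
    normalArc′ = record
      { e = e′ ; independent = ind′ ; isotropic = iso′
      ; G = G
      ; ∋⇔ = λ p → mk⇔ (λ p∈ → Sum.map₂ (to p) (Equivalence.to (∋⇔ p) p∈))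
          (λ q → Equivalence.from (∋⇔ p) (Sum.map₂ (from p) q))
      }
      where
      open Normalisation normalised
      e′ = scale³ k e
      ind′ : Independent e′
      ind′ b b≢0 eq = ind b b≢0 (*≡0⇒ʳ k≢0 (trans (sym (comb-scale k e b)) eq))
      iso′ : Isotropic e′
      -- Scaling both arguments by k multiplies ε by k³, which brings in `polar`.
      iso′ b b′ = begin
        Tr (ε (comb e′ b) (comb e′ b′))
          ≡⟨ cong₂ (λ x y → Tr (ε x y)) (comb-scale k e b) (comb-scale k e b′) ⟩
        Tr (ε (k * comb e b) (k * comb e b′))
          ≡⟨ cong Tr (solve 3 (λ k x y → k :* x :* (k :* x) :* (k :* y) :+ k :* x :* (k :* y :* (k :* y))
              := k :* (k :* k) :* (x :* x :* y :+ x :* (y :* y))) refl k (comb e b) (comb e b′)) ⟩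
        Tr (k * (k * k) * ε (comb e b) (comb e b′))
          ≡⟨ polar (ε (comb e b) (comb e b′)) ⟩
        Tr (polarForm l m (ε (comb e b) (comb e b′)))
          ≡⟨ Z≡0 b b′ ⟩
        0# ∎
        where open ≡-Reasoning
      G = compose (shearGL N det≢0 w≢0) g
      ∋⇔ : ∀ p → (S ∋ p) ⇔ (Nucleus (coords (projectivity G p)) ⊎
                            Indexed (λ b → Φ (cubic (k * comb e b)) (coords (projectivity G p)) ≡ 0#))
      ∋⇔ = change N det≢0 w≢0 (λ x → cubic (k * x)) maps-x
      On : Point → Carrier → Set
      On p x = Φ (cubic x) (coords (projectivity G p)) ≡ 0#
      to : ∀ p → Indexed (λ b → On p (k * comb e b)) → Any (On p) (span∖0 e′)
      to p (b , b≢0 , on) = span∖0⁺ e′ (On p) b≢0 (subst (On p) (sym (comb-scale k e b)) on)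
      from : ∀ p → Any (On p) (span∖0 e′) → Indexed (λ b → On p (k * comb e b))
      from p any = let (b , b∈ , on) = find (Any.map⁻ {f = comb e′} any) in
        b , All.lookup nonzeroBits-≢0 b∈ , subst (On p) (comb-scale k e b) on

  normalArc : ∀ S → IsProperMathonArc 8 S → NormalArc S
  normalArc S (max , (C , _ , _ , closed , g , ∋C) , ¬denniston) =
    normalArc′ S C closed (isFamily C closed (at-most-7 S max C closed g ∋C) (another S max C closed g ∋C))
      g ∋C ¬denniston

-- Normal forms are of Mathon type; isomorphisms from field automorphisms

module Models {h : ℕ} (𝔽 : BinaryField h) (O : OddField 𝔽) where

  open BinaryField 𝔽
  open OddField O
  open OddFieldProperties 𝔽 O
  open ProjectivePlane 𝔽
  open MathonArcs 𝔽
  open Geometry 𝔽 O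
  open Span 𝔽 O
  open CubicArcs 𝔽 O
  open NormalForm 𝔽 O
  open Extraction 𝔽 O
  open Semilinear 𝔽 O
  open Classification 𝔽 O

  module _ (e : Carrier³) (ind : Independent e) (iso : Isotropic e) where

    open Arc e ind iso

    -- The line z = √u x is external when Tr (x³) = Tr (u x) on the span of e.
    arc-isMathon : ∀ u → (∀ b → b ≢ 0ᵇ → Tr (comb e b * (comb e b * comb e b)) ≡ Tr (u * comb e b))
        → IsMathonType arc
    arc-isMathon u trace = C , C? , (conic (comb e b₁) , b₁ , (λ ()) , refl) , closed ,
      shearGL N D≢0 (0≢1 ∘ sym) , λ p → mk⇔ (to p) (from p)
      where
      conic : Carrier → Conic
      conic x = F (1# + x * (x * x) + u * x) 1# x

      C : Pred Conic 0ℓ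
      C c = Indexed (λ b → c ≡ conic (comb e b))

      C? : Decidable C
      C? c = map′
        (λ any → let (b , b∈ , eq) = find any in b , All.lookup nonzeroBits-≢0 b∈ , eq)
        (λ (b , b≢0 , eq) → lose (∈-nonzeroBits b b≢0) eq)
        (Any.any? (λ b → c ≟ᶜ conic (comb e b)) nonzeroBits)

      traces : ∀ b → b ≢ 0ᵇ → Tr ((1# + comb e b * (comb e b * comb e b) + u * comb e b) * 1#) ≡ 1#
      traces b b≢0 = begin
        Tr ((1# + x * (x * x) + u * x) * 1#)      ≡⟨ cong Tr (*-identityʳ _) ⟩
        Tr (1# + x * (x * x) + u * x)             ≡⟨ Tr-+₃ 1# (x * (x * x)) (u * x) ⟩
        Tr 1# + Tr (x * (x * x)) + Tr (u * x)     ≡⟨ cong₂ (λ p q → p + q + Tr (u * x)) Tr-1 (trace b b≢0) ⟩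
        1# + Tr (u * x) + Tr (u * x)              ≡⟨ solve 1 (λ t → con true :+ t :+ t := con true) refl
            (Tr (u * x)) ⟩
        1#                                        ∎
        where
        open ≡-Reasoning
        x = comb e b

      compose-conics : ∀ {b b′} → comb e b ≢ comb e b′ → conic (comb e b) ⊕ conic (comb e b′)
          ≡ conic (comb e (b ⊞ b′))
      compose-conics {b} {b′} x≢y = trans (F-cong
        (by₁ (1# + (x + y) * ((x + y) * (x + y)) + u * (x + y))
            (solve 4 (λ u x y i → ((con true :+ x :* (x :* x) :+ u :* x) :* x
            :+ (con true :+ y :* (y :* y) :+ u :* y) :* y) :* i
            :+ (con true :+ (x :+ y) :* ((x :+ y) :* (x :+ y)) :+ u :* (x :+ y))
            := (con true :+ (x :+ y) :* ((x :+ y) :* (x :+ y)) :+ u :* (x :+ y)) :* ((x :+ y) :* i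
            :+ con true)) refl u x y ((x + y) ⁻¹)) inv)
        (by₁ 1# (solve 3 (λ x y i → (con true :* x :+ con true :* y) :* i :+ con true
            := con true :* ((x :+ y) :* i :+ con true)) refl x y ((x + y) ⁻¹)) inv)
        refl) (cong conic (sym (comb-⊞ e b b′)))
        where
        x = comb e b
        y = comb e b′
        inv = *-inverseʳ (x + y) (x≢y ∘ +≡0⇒≡)

      closed : IsClosed C
      closed = record
        { trace-one  = λ { (b , b≢0 , refl) → traces b b≢0 }
        ; l-nonzero  = λ { (b , b≢0 , refl) → ind b b≢0 }
        ; l-distinct = λ { (b , _ , refl) (b′ , _ , refl) c≢d x≡y → c≢d (cong conic x≡y) }
        ; ⊕-closed   = λ { (b , _ , refl) (b′ , _ , refl) c≢d → b ⊞ b′ ,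
            (λ b⊞b′≡0 → c≢d (cong (conic ∘ comb e) (⊞≡0⇒≡ b b′ b⊞b′≡0))) ,
            compose-conics {b} {b′} (c≢d ∘ cong conic) }
        }

      N : Shear
      N = shear 1# 0# 0# 1# (√ u) 0# 1#
      D≢0 : det N ≢ 0#
      D≢0 eq = 0≢1 (sym (trans (solve 1 (λ x → x := x :* con true :+ con false :* con false) refl 1#) eq))

      N-maps : ∀ x → Maps N (cubic x) (conic x)
      N-maps x = maps
        (by₁ x (solve 3 (λ u v x → (con true :* con true :+ con false :* con false) :* (con true
            :+ x :* (x :* x)) :+ ((con true :+ x :* (x :* x) :+ u :* x) :* (con true :* con true)
            :+ con true :* con false :+ con true :* (con false :* con false) :+ x :* (v :* v))
            := x :* (v :* v :+ u)) refl u (√ u) x) (√-square u))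
        (solve 2 (λ u x → (con true :* con true :+ con false :* con false) :* con true
            := (con true :+ x :* (x :* x) :+ u :* x) :* (con false :* con false) :+ con false :* con true
            :+ con true :* (con true :* con true) :+ x :* (con false :* con false)) refl u x)
        (solve 1 (λ x → (con true :* con true :+ con false :* con false) :* x := con true :* con true :* x)
            refl x)

      Np : Point → Point
      Np = projectivity (shearGL N D≢0 (0≢1 ∘ sym))

      to : ∀ p → InArc p → ConicUnion C (Np p)
      to p (inj₁ nuc) = inj₁ (Equivalence.from (≈F₀⇔Nucleus (Np p))
          (Equivalence.from (Nucleus-shear N D≢0 (coords p)) nuc))
      to p (inj₂ any) = let (b , b∈ , on) = find (Any.map⁻ {f = comb e} any) in
        inj₂ (conic (comb e b) , (b , All.lookup nonzeroBits-≢0 b∈ , refl) ,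
          Equivalence.from (OnConic⇔Φ (conic (comb e b)) (Np p))
              (Equivalence.from (Maps⇒on⇔ N D≢0 (N-maps (comb e b)) (coords p)) on))
      from : ∀ p → ConicUnion C (Np p) → InArc p
      from p (inj₁ ≈F₀) = inj₁ (Equivalence.to (Nucleus-shear N D≢0 (coords p))
          (Equivalence.to (≈F₀⇔Nucleus (Np p)) ≈F₀))
      from p (inj₂ (_ , (b , b≢0 , refl) , on)) = inj₂ (span∖0⁺ e (λ x → Φ (cubic x) (coords p) ≡ 0#) b≢0
        (Equivalence.to (Maps⇒on⇔ N D≢0 (N-maps (comb e b)) (coords p))
            (Equivalence.to (OnConic⇔Φ (conic (comb e b)) (Np p)) on)))

    module _ (s : FieldAutomorphism) {S : PointSet} (normal : NormalArc S) where

      open FieldAutomorphism s using () renaming (to to σ)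
      open NormalArc normal using (G; ∋⇔) renaming (e to e₀; independent to ind₀; isotropic to iso₀)

      ≅-arc : (∀ {b} → b ≢ 0ᵇ → σ (comb e₀ b) ∈ span∖0 e) →
              (∀ {y} → y ∈ span∖0 e → Indexed (λ b → y ≡ σ (comb e₀ b))) → S ≅ arc
      -- A representative applies σ before its matrix. To apply σ after G, the identity σ(Gv) =
      -- σ(G)σ(v) moves it to the front.
      ≅-arc into onto = record { linear = σ-GL s G ; automorphism = s } , λ p → mk⇔
        (λ p∈ → subst Q (sym (σ-· s (GL₃.matrix G) (coords p))) (to p (Equivalence.to (∋⇔ p) p∈)))
        (λ q → Equivalence.from (∋⇔ p) (from p (subst Q (σ-· s (GL₃.matrix G) (coords p)) q)))
        where
        Q : Vec₃ → Set
        Q v = Nucleus v ⊎ Any (λ x → Φ (cubic x) v ≡ 0#) (span∖0 e)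
        to : ∀ p → Arc.InArc e₀ ind₀ iso₀ (projectivity G p) → Q (Vec.map σ (GL₃.matrix G · coords p))
        to p (inj₁ nuc) = inj₁ (Equivalence.to (σ-Nucleus s _) nuc)
        to p (inj₂ any) = let (b , b∈ , on) = find (Any.map⁻ {f = comb e₀} any) in
          inj₂ (lose (into (All.lookup nonzeroBits-≢0 b∈))
              (Equivalence.to (σ-on-cubic s (comb e₀ b) (GL₃.matrix G · coords p)) on))
        from : ∀ p → Q (Vec.map σ (GL₃.matrix G · coords p)) → Arc.InArc e₀ ind₀ iso₀ (projectivity G p)
        from p (inj₁ nuc) = inj₁ (Equivalence.from (σ-Nucleus s (GL₃.matrix G · coords p)) nuc)
        from p (inj₂ any) = let (y , y∈ , on) = find any
                                (b , b≢0 , y≡) = onto y∈ in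
          inj₂ (span∖0⁺ e₀ (λ x → Φ (cubic x) (GL₃.matrix G · coords p) ≡ 0#) b≢0
            (Equivalence.from (σ-on-cubic s (comb e₀ b) (GL₃.matrix G · coords p))
              (subst (λ y → Φ (cubic y) (Vec.map σ (GL₃.matrix G · coords p)) ≡ 0#) y≡ on)))

-- Explicit arithmetic in GF(32)

open GF32 using (Element; _≟_; all?; _+_; _*_; 0#; 1#)
open BinaryField GF32 using (Tr)
open ProjectivePlane GF32
open MathonArcs GF32


square : Element → Element
square x = x * x

-- The trace in coordinates: 1 and t³ have trace 1, while t, t² and t⁴ have trace 0.
tr : Element → Bool
tr (a₀ ∷ a₁ ∷ a₂ ∷ a₃ ∷ a₄ ∷ []) = a₀ xor a₃

embed : Bool → Element
embed false = 0#
embed true  = 1#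

Tr≡tr : ∀ x → Tr x ≡ embed (tr x)
Tr≡tr = toWitness {a? = all? 5 λ x → Tr x ≟ embed (tr x)} _

embed-+ : ∀ a b → embed (a xor b) ≡ embed a + embed b
embed-+ false b     = sym (GF32.+-identityˡ _)
embed-+ true  false = refl
embed-+ true  true  = refl

tr-+ : ∀ x y → tr (x + y) ≡ tr x xor tr y
tr-+ = toWitness {a? = all? 5 λ x → all? 5 λ y → tr (x + y) Bool.≟ (tr x xor tr y)} _

oddField : OddField GF32
oddField = record
  { _≟_           = _≟_
  ; x+x≡0         = GF32.+-self
  ; √             = √
  ; √-square      = toWitness {a? = all? 5 λ x → (√ x * √ x) ≟ x} _
  ; ∛             = ∛
  ; ∛-cube        = toWitness {a? = all? 5 λ x → (∛ x * (∛ x * ∛ x)) ≟ x} _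
  ; cube≡1        = toWitness {a? = all? 5 λ x → ((x * (x * x)) ≟ 1#) →-dec (x ≟ 1#)} _
  ; Tr-+          = λ x y → begin
      Tr (x + y)                   ≡⟨ Tr≡tr (x + y) ⟩
      embed (tr (x + y))           ≡⟨ cong embed (tr-+ x y) ⟩
      embed (tr x xor tr y)        ≡⟨ embed-+ (tr x) (tr y) ⟩
      embed (tr x) + embed (tr y)  ≡⟨ cong₂ _+_ (Tr≡tr x) (Tr≡tr y) ⟨
      Tr x + Tr y                  ∎
  ; Tr-square     = λ x → trans (Tr≡tr (x * x)) (trans (cong embed (tr-square x)) (sym (Tr≡tr x)))
  ; Tr-0⊎1        = λ x → binary (tr x) (Tr≡tr x)
  ; Tr-1          = refl
  ; artinSchreier = λ x tr≡0 → halfTrace x , halfTrace-root x tr≡0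
  }
  where
  open ≡-Reasoning
  -- x¹⁶ squares to x³² = x, and x²¹ cubes to x⁶³ = x, as x³¹ = 1 for x ≠ 0. The half-trace w = x +
  -- x⁴ + x¹⁶ satisfies w² + w = x + Tr x.
  √ ∛ halfTrace : Element → Element
  √ x = square (square (square (square x)))
  ∛ x = x * (square (square x) * √ x)
  halfTrace x = x + (square (square x) + √ x)
  halfTrace-root : ∀ x → Tr x ≡ 0# → halfTrace x * halfTrace x + halfTrace x ≡ x
  halfTrace-root = toWitness {a? = all? 5 λ x
      → (Tr x ≟ 0#) →-dec ((halfTrace x * halfTrace x + halfTrace x) ≟ x)} _
  tr-square : ∀ x → tr (x * x) ≡ tr x
  tr-square = toWitness {a? = all? 5 λ x → tr (x * x) Bool.≟ tr x} _
  binary : ∀ {x} b → x ≡ embed b → x ≡ 0# ⊎ x ≡ 1#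
  binary false eq = inj₁ eq
  binary true  eq = inj₂ eq

vectors : ∀ n → List (Vec Bool n)
vectors zero    = [] ∷ []
vectors (suc n) = map (false ∷_) (vectors n) ++ map (true ∷_) (vectors n)

elements-unique : Unique (vectors 5)
elements-unique = from-yes (unique? _≟_ (vectors 5))

30<elements : 30 < length (vectors 5)
30<elements = from-yes (30 ℕ.<? 32)

open Span GF32 oddField
open CubicArcs GF32 oddField
open NormalForm GF32 oddField using (Indexed; b₁; b₂; b₃; comb-b₁; comb-b₂; comb-b₃)
open Semilinear GF32 oddField
open Classification GF32 oddField
open Models GF32 oddField
open Rigidity GF32 oddField (vectors 5) elements-unique 30<elements

-- Totally isotropic subspaces and the three arcs

-- The form Tr (ε x y) in coordinates. Those of 1 are absent, because 1 spans the radical; on the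
-- other four the form is nondegenerate.
polar : Element → Element → Bool
polar (_ ∷ x₁ ∷ x₂ ∷ x₃ ∷ x₄ ∷ []) (_ ∷ y₁ ∷ y₂ ∷ y₃ ∷ y₄ ∷ []) =
  (x₁ ∧ (y₂ xor y₃)) xor (x₂ ∧ (y₁ xor y₄)) xor (x₃ ∧ y₁) xor (x₄ ∧ y₂)

Tr-ε : ∀ x y → Tr (ε x y) ≡ embed (polar x y)
Tr-ε x y = trans (Tr≡tr (ε x y)) (cong embed (tr-ε x y))
  where
  tr-ε : ∀ x y → tr (ε x y) ≡ polar x y
  tr-ε = toWitness {a? = all? 5 λ x → all? 5 λ y → tr (ε x y) Bool.≟ polar x y} _

frob : Element → Element
frob (a₀ ∷ a₁ ∷ a₂ ∷ a₃ ∷ a₄ ∷ []) = (a₀ xor a₄) ∷ a₃ ∷ (a₁ xor a₄) ∷ (a₃ xor a₄) ∷ a₂ ∷ []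

frob≡square : ∀ x → frob x ≡ x * x
frob≡square = toWitness {a? = all? 5 λ x → frob x ≟ (x * x)} _

frob^ : ℕ → Element → Element
frob^ zero    x = x
frob^ (suc k) x = frob^ k (frob x)

pattern 𝟎 = Fin.zero
pattern 𝟏 = Fin.suc Fin.zero
pattern 𝟐 = Fin.suc (Fin.suc Fin.zero)

-- ⟨1 , t , t² + t³⟩, ⟨1 , t , t² + t³ + t⁴⟩ and ⟨1 , t + t² , t + t⁴⟩ represent the
-- Frobenius orbits on the 15 maximal totally isotropic subspaces.
basis : Fin 3 → Carrier³
basis 𝟎 = 1# , (false ∷ true ∷ false ∷ false ∷ false ∷ []) , (false ∷ false ∷ true ∷ true ∷ false ∷ [])
basis 𝟏 = 1# , (false ∷ true ∷ false ∷ false ∷ false ∷ []) , (false ∷ false ∷ true ∷ true ∷ true ∷ [])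
basis 𝟐 = 1# , (false ∷ true ∷ true ∷ false ∷ false ∷ []) , (false ∷ true ∷ false ∷ false ∷ true ∷ [])

-- Each factor negates one of the two linear forms that cut out the subspace.
inSpan : Fin 3 → Element → Bool
inSpan 𝟎 (_ ∷ a₁ ∷ a₂ ∷ a₃ ∷ a₄ ∷ []) = (a₂ xor a₃ xor true) ∧ (a₄ xor true)
inSpan 𝟏 (_ ∷ a₁ ∷ a₂ ∷ a₃ ∷ a₄ ∷ []) = (a₂ xor a₃ xor true) ∧ (a₃ xor a₄ xor true)
inSpan 𝟐 (_ ∷ a₁ ∷ a₂ ∷ a₃ ∷ a₄ ∷ []) = (a₃ xor true) ∧ (a₁ xor a₂ xor a₄ xor true)

coordinates : Fin 3 → Element → Bits
coordinates 𝟎 (a₀ ∷ a₁ ∷ a₂ ∷ a₃ ∷ a₄ ∷ []) = a₀ , a₁ , a₂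
coordinates 𝟏 (a₀ ∷ a₁ ∷ a₂ ∷ a₃ ∷ a₄ ∷ []) = a₀ , a₁ , a₂
coordinates 𝟐 (a₀ ∷ a₁ ∷ a₂ ∷ a₃ ∷ a₄ ∷ []) = a₀ , a₂ , a₄

comb-coordinates : ∀ i x → inSpan i x ≡ true → comb (basis i) (coordinates i x) ≡ x
comb-coordinates 𝟎 = toWitness
    {a? = all? 5 λ x → (inSpan 𝟎 x Bool.≟ true) →-dec (comb (basis 𝟎) (coordinates 𝟎 x) ≟ x)} _
comb-coordinates 𝟏 = toWitness
    {a? = all? 5 λ x → (inSpan 𝟏 x Bool.≟ true) →-dec (comb (basis 𝟏) (coordinates 𝟏 x) ≟ x)} _
comb-coordinates 𝟐 = toWitness
    {a? = all? 5 λ x → (inSpan 𝟐 x Bool.≟ true) →-dec (comb (basis 𝟐) (coordinates 𝟐 x) ≟ x)} _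

spans : List (Fin 3 × ℕ)
spans = cartesianProduct (𝟎 ∷ 𝟏 ∷ 𝟐 ∷ []) (0 ∷ 1 ∷ 2 ∷ 3 ∷ 4 ∷ [])

Inside : Element → Element → Element → Fin 3 × ℕ → Set
Inside x y z (i , k) = (inSpan i (frob^ k x) ≡ true) × (inSpan i (frob^ k y) ≡ true)
    × (inSpan i (frob^ k z) ≡ true)

inside? : ∀ x y z → Decidable (Inside x y z)
inside? x y z (i , k) =
  (inSpan i (frob^ k x) Bool.≟ true) ×-dec (inSpan i (frob^ k y) Bool.≟ true) ×-dec
      (inSpan i (frob^ k z) Bool.≟ true)

-- Decided by enumeration. Each hypothesis follows the variable it restricts, so that unsuitable
-- pairs x, y are discarded before z is enumerated. Applying Frobenius to x, y, z and not to the
-- subspaces reduces membership to three fixed pairs of linear equations.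
isotropic⇒inside : ∀ x → x ≢ 0# → ∀ y → y ≢ 0# → y ≢ x → polar x y ≡ false →
  ∀ z → z ≢ 0# → z ≢ x → z ≢ y → z ≢ x + y → polar x z ≡ false → polar y z ≡ false →
  Any (Inside x y z) spans
isotropic⇒inside = toWitness {a? =
  all? 5 λ x → ¬? (x ≟ 0#) →-dec
      (all? 5 λ y → ¬? (y ≟ 0#) →-dec (¬? (y ≟ x) →-dec ((polar x y Bool.≟ false) →-dec
  (all? 5 λ z → ¬? (z ≟ 0#) →-dec (¬? (z ≟ x) →-dec (¬? (z ≟ y) →-dec (¬? (z ≟ (x + y)) →-dec
  ((polar x z Bool.≟ false) →-dec ((polar y z Bool.≟ false) →-dec Any.any? (inside? x y z) spans)))))))))} _

allBits : List Bits
allBits = 0ᵇ ∷ nonzeroBits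

∈-allBits : ∀ b → b ∈ allBits
∈-allBits b with b ≟ᵇ 0ᵇ
... | yes refl = here refl
... | no  b≢0  = there (∈-nonzeroBits b b≢0)

basis-independent : ∀ i → Independent (basis i)
basis-independent i b b≢0 = All.lookup (check i) (∈-nonzeroBits b b≢0)
  where
  check : ∀ i → All (λ b → comb (basis i) b ≢ 0#) nonzeroBits
  check 𝟎 = from-yes (All.all? (λ b → ¬? (comb (basis 𝟎) b ≟ 0#)) nonzeroBits)
  check 𝟏 = from-yes (All.all? (λ b → ¬? (comb (basis 𝟏) b ≟ 0#)) nonzeroBits)
  check 𝟐 = from-yes (All.all? (λ b → ¬? (comb (basis 𝟐) b ≟ 0#)) nonzeroBits)

basis-isotropic : ∀ i → Isotropic (basis i)
basis-isotropic i b b′ = trans (Tr-ε (comb (basis i) b) (comb (basis i) b′))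
  (cong embed (All.lookup (All.lookup (check i) (∈-allBits b)) (∈-allBits b′)))
  where
  Polar : Fin 3 → Set
  Polar i = All (λ b → All (λ b′ → polar (comb (basis i) b) (comb (basis i) b′) ≡ false) allBits) allBits
  polar? : ∀ i → Dec (Polar i)
  polar? i = All.all? (λ b → All.all? (λ b′ → polar (comb (basis i) b) (comb (basis i) b′) Bool.≟ false)
      allBits) allBits
  check : ∀ i → Polar i
  check 𝟎 = from-yes (polar? 𝟎)
  check 𝟏 = from-yes (polar? 𝟏)
  check 𝟐 = from-yes (polar? 𝟐)

K : Fin 3 → PointSet
K i = Arc.arc (basis i) (basis-independent i) (basis-isotropic i)

K-proper : ∀ i → IsProperMathonArc 8 (K i)
K-proper i = Arc.maximalArc (basis i) ind iso ,
  arc-isMathon (basis i) ind iso (functional i) (λ b b≢0 → All.lookup (check i) (∈-nonzeroBits b b≢0)) ,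
  notDenniston (basis i) ind iso
  where
  ind = basis-independent i
  iso = basis-isotropic i
  -- Tr (x³) is additive on a totally isotropic subspace, hence of the form Tr (u x).
  functional : Fin 3 → Element
  functional 𝟎 = true  ∷ false ∷ true ∷ false ∷ false ∷ []
  functional 𝟏 = false ∷ false ∷ true ∷ true  ∷ false ∷ []
  functional 𝟐 = true  ∷ false ∷ true ∷ false ∷ false ∷ []
  Traces : Fin 3 → Set
  Traces i = All (λ b → let x = comb (basis i) b in Tr (x * (x * x)) ≡ Tr (functional i * x)) nonzeroBits
  traces? : ∀ i → Dec (Traces i)
  traces? i = All.all? (λ b → let x = comb (basis i) b in Tr (x * (x * x)) ≟ Tr (functional i * x)) nonzeroBits
  check : ∀ i → Traces i
  check 𝟎 = from-yes (traces? 𝟎)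
  check 𝟏 = from-yes (traces? 𝟏)
  check 𝟐 = from-yes (traces? 𝟐)

-- The three arcs are pairwise non-isomorphic

horner : ∀ {n} → Vec Bool n → Element → Element
horner []       x = 0#
horner (a ∷ as) x = embed a + x * horner as x

generator : Element
generator = false ∷ true ∷ false ∷ false ∷ false ∷ []

horner-generator : ∀ x → horner x generator ≡ x
horner-generator = toWitness {a? = all? 5 λ x → horner x generator ≟ x} _

minimalPolynomial : Vec Bool 6
minimalPolynomial = true ∷ false ∷ true ∷ false ∷ false ∷ true ∷ []

module _ (s : FieldAutomorphism) where

  open FieldAutomorphism s using () renaming (to to σ; isRingIsomorphism to σ-iso)
  open IsRingIsomorphism σ-iso using (+-homo; *-homo; 0#-homo; 1#-homo)

  σ-horner : ∀ {n} (as : Vec Bool n) x → σ (horner as x) ≡ horner as (σ x)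
  σ-horner []       x = 0#-homo
  σ-horner (a ∷ as) x = trans (+-homo (embed a) (x * horner as x))
    (cong₂ _+_ (σ-embed a) (trans (*-homo x (horner as x)) (cong (σ x *_) (σ-horner as x))))
    where
    σ-embed : ∀ a → σ (embed a) ≡ embed a
    σ-embed false = 0#-homo
    σ-embed true  = 1#-homo

  -- The powers 1, t, ..., t⁴ span GF(32) over GF(2), so σ is determined by the image of t; `σ-root`
  -- leaves the roots of the minimal polynomial as candidates.
  σ≡horner : ∀ x → σ x ≡ horner x (σ generator)
  σ≡horner x = trans (cong σ (sym (horner-generator x))) (σ-horner x generator)

  σ-root : horner minimalPolynomial (σ generator) ≡ 0#
  σ-root = trans (sym (σ-horner minimalPolynomial generator)) 0#-homo

Sends : Fin 3 → Fin 3 → Element → Set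
Sends i j r = All (λ b → horner (comb (basis i) b) r ∈ span∖0 (basis j)) nonzeroBits

-- Quantifying over the roots r of t⁵ + t² + 1 in place of field automorphisms makes the condition
-- decidable.
NotConjugate : Fin 3 → Fin 3 → Set
NotConjugate i j = ∀ r → horner minimalPolynomial r ≡ 0# → ¬ Sends i j r

notConjugate? : ∀ i j → Dec (NotConjugate i j)
notConjugate? i j = all? 5 λ r → (horner minimalPolynomial r ≟ 0#) →-dec
  ¬? (All.all? (λ b → horner (comb (basis i) b) r ∈? span∖0 (basis j)) nonzeroBits)

K-distinct : ∀ i j → K i ≅ K j → i ≡ j
K-distinct i j iso = decide i j (λ nc → nc (σ generator) (σ-root automorphism) sends)
  where
  open ΓL₃ (proj₁ iso) using (automorphism; σ)
  sends : Sends i j (σ generator)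
  sends = All.map (λ {b} b≢0 → subst (_∈ span∖0 (basis j)) (σ≡horner automorphism (comb (basis i) b))
    (≅⇒σ (basis i) (basis j) (basis-independent i) (basis-isotropic i) (basis-independent j)
        (basis-isotropic j) iso b b≢0))
    nonzeroBits-≢0
  decide : ∀ i j → ¬ NotConjugate i j → i ≡ j
  decide 𝟎 𝟎 _ = refl
  decide 𝟎 𝟏 n = ⊥-elim (n (toWitness {a? = notConjugate? 𝟎 𝟏} _))
  decide 𝟎 𝟐 n = ⊥-elim (n (toWitness {a? = notConjugate? 𝟎 𝟐} _))
  decide 𝟏 𝟎 n = ⊥-elim (n (toWitness {a? = notConjugate? 𝟏 𝟎} _))
  decide 𝟏 𝟏 _ = refl
  decide 𝟏 𝟐 n = ⊥-elim (n (toWitness {a? = notConjugate? 𝟏 𝟐} _))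
  decide 𝟐 𝟎 n = ⊥-elim (n (toWitness {a? = notConjugate? 𝟐 𝟎} _))
  decide 𝟐 𝟏 n = ⊥-elim (n (toWitness {a? = notConjugate? 𝟐 𝟏} _))
  decide 𝟐 𝟐 _ = refl

-- Every normal form is isomorphic to one of the three arcs

frob^≡frobenius : ∀ k x → frob^ k x ≡ FieldAutomorphism.to (frobenius k) x
frob^≡frobenius zero    x = refl
frob^≡frobenius (suc k) x = trans (cong (frob^ k) (frob≡square x)) (frob^≡frobenius k (x * x))

module _ {S : PointSet} (normal : NormalArc S) where

  open NormalArc normal

  private
    x y z : Element
    x = proj₁ e
    y = proj₁ (proj₂ e)
    z = proj₂ (proj₂ e)

    ≢0 : ∀ {c} b → b ≢ 0ᵇ → comb e b ≡ c → c ≢ 0#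
    ≢0 b b≢0 eq c≡0 = independent b b≢0 (trans eq c≡0)

    polar≡false : ∀ {p q} b b′ → comb e b ≡ p → comb e b′ ≡ q → polar p q ≡ false
    polar≡false b b′ refl refl = embed-injective
        (trans (sym (Tr-ε (comb e b) (comb e b′))) (isotropic b b′))
      where
      embed-injective : ∀ {a} → embed a ≡ 0# → a ≡ false
      embed-injective {false} _ = refl

    +≢0⇒≢ : ∀ {p q : Element} → p + q ≢ 0# → q ≢ p
    +≢0⇒≢ {p} ≢0 refl = ≢0 (GF32.+-self p)

  inside : Any (Inside x y z) spans
  inside = isotropic⇒inside
    x (≢0 b₁ (λ ()) (comb-b₁ e))
    y (≢0 b₂ (λ ()) (comb-b₂ e)) (+≢0⇒≢ (≢0 (b₁ ⊞ b₂) (λ ()) e₁₂))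
    (polar≡false b₁ b₂ (comb-b₁ e) (comb-b₂ e))
    z (≢0 b₃ (λ ()) (comb-b₃ e))
    (+≢0⇒≢ (≢0 (b₁ ⊞ b₃) (λ ()) (trans (comb-⊞ e b₁ b₃) (cong₂ _+_ (comb-b₁ e) (comb-b₃ e)))))
    (+≢0⇒≢ (≢0 (b₂ ⊞ b₃) (λ ()) (trans (comb-⊞ e b₂ b₃) (cong₂ _+_ (comb-b₂ e) (comb-b₃ e)))))
    (+≢0⇒≢ (≢0 (b₁ ⊞ b₂ ⊞ b₃) (λ ()) (trans (comb-⊞ e (b₁ ⊞ b₂) b₃) (cong₂ _+_ e₁₂ (comb-b₃ e)))))
    (polar≡false b₁ b₃ (comb-b₁ e) (comb-b₃ e))
    (polar≡false b₂ b₃ (comb-b₂ e) (comb-b₃ e))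
    where
    e₁₂ : comb e (b₁ ⊞ b₂) ≡ x + y
    e₁₂ = trans (comb-⊞ e b₁ b₂) (cong₂ _+_ (comb-b₁ e) (comb-b₂ e))

  inside⇒≅ : ∀ i k → Inside x y z (i , k) → S ≅ K i
  inside⇒≅ i k (x∈ , y∈ , z∈) = ≅-arc (basis i) (basis-independent i) (basis-isotropic i) (frobenius k)
      normal into onto
    where
    σ : Element → Element
    σ = FieldAutomorphism.to (frobenius k)

    open IsAdditiveSubgroup (combs-subgroup (basis i))

    coordinate : ∀ w → inSpan i (frob^ k w) ≡ true → combs (basis i) (σ w)
    coordinate w w∈ = coordinates i (frob^ k w) ,
      trans (sym (frob^≡frobenius k w)) (sym (comb-coordinates i (frob^ k w) w∈))

    scaled : ∀ a {w} → combs (basis i) w → combs (basis i) (OddFieldProperties.⟦_⟧₂ GF32 oddField a * w)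
    scaled false w∈ = 0∈
    scaled true {w} w∈ = subst (combs (basis i)) (sym (GF32.*-identityˡ w)) w∈

    into : ∀ {b} → b ≢ 0ᵇ → σ (comb e b) ∈ span∖0 (basis i)
    into {b@(a₁ , a₂ , a₃)} b≢0 = member (subst (combs (basis i)) (sym (σ-comb (frobenius k) x y z b))
        (+-closed (+-closed (scaled a₁ (coordinate x x∈)) (scaled a₂ (coordinate y y∈)))
            (scaled a₃ (coordinate z z∈))))
      where
      member : combs (basis i) (σ (comb e b)) → σ (comb e b) ∈ span∖0 (basis i)
      member (b′ , eq) = span∖0⁺ (basis i) (σ (comb e b) ≡_)
        (comb-≢0 {basis i} {b′} (λ eq′ → σ-≢0 (frobenius k) (independent b b≢0) (trans eq eq′))) eq

    image : List Element
    image = map (σ ∘ comb e) nonzeroBits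

    image-unique : Unique image
    image-unique = Unique.map⁺ (comb-injective independent ∘ FieldAutomorphism.injective (frobenius k))
        nonzeroBits-unique

    -- Seven distinct images lie among seven elements; an element outside the image would make
    -- eight.
    onto : ∀ {w} → w ∈ span∖0 (basis i) → Indexed (λ b → w ≡ σ (comb e b))
    onto {w} w∈ with w ∈? image
    ... | yes w∈image = let (b , b∈ , eq) = find (Any.map⁻ {f = σ ∘ comb e} w∈image) in b , All.lookup nonzeroBits-≢0 b∈ , eq
    ... | no  w∉image = ⊥-elim (ℕ.1+n≰n (unique-⊆⇒length≤ (setoid Element)
            (All.tabulate (λ { v∈ refl → w∉image v∈ }) ∷ image-unique)
            (w∈ ∷ All.map⁺ {f = σ ∘ comb e} (All.map into nonzeroBits-≢0))))

K-complete : ∀ S → IsProperMathonArc 8 S → ∃[ i ] (S ≅ K i)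
K-complete S proper = let ((i , k) , ins) = Any.satisfied (inside normal) in i , inside⇒≅ normal i k ins
  where
  normal : NormalArc S
  normal = normalArc S proper

mainTheorem3 : Σ (Fin 3 → PointSet) λ K →
    (∀ i → IsProperMathonArc 8 (K i)) ×
    (∀ i j → K i ≅ K j → i ≡ j) ×
    (∀ S → IsProperMathonArc 8 S → ∃[ i ] (S ≅ K i))
mainTheorem3 = K , K-proper , K-distinct , K-complete
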